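{- Let $p$ be an odd prime, let $1\le w<p$ be an integer, let $1\le N\le p$, and let $f(x)\in\mathbb{F}_p[x]$ have degree $d\ge 1$. Let $$F(w,N,p;f(x))=\#\{u\in\{0,\ldots,N-1\} : q_{p,w}(u)\equiv f(u)\bmod p\}.$$ Then $$F(w,N,p;f(x))\ll \min\Big\{(p-1-w+d)^{1/4}N^{1/2}p^{1/3},\ (p-1-w+d)^{1/8}N^{1/2}p^{3/8},\ \frac{d^{1/4}N^{1/2}p^{4/3}}{\gcd(w,p-1)},\ \frac{d^{1/8}N^{1/2}p^{11/8}}{\gcd(w,p-1)}\Big\},$$ where the implied constant is absolute.
   Context: For an odd prime $p$ and an integer $w\ge1$, the polynomial quotient $q_{p,w}(u)$ of an integer $u\ge0$ is the unique integer with $0\le q_{p,w}(u)\le p-1$ and $q_{p,w}(u)\equiv \frac{u^w-u^{wp}}{p}\bmod p$ (note $u^w-u^{wp}$ is divisible by $p$). Integers in $\{0,\dots,p-1\}$ are identified with elements of $\mathbb{F}_p$. $A\ll B$ means $|A|\le cB$ for some constant $c>0$. -}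

module Defs where

open import Data.Nat using (ℕ; zero; suc; _+_; _*_; _^_; NonZero)
open import Data.Nat.DivMod using (_%_)
open import Data.Integer as ℤ using (ℤ; +_; _-_; _/ℕ_; _%ℕ_)
open import Data.Fin using (Fin; toℕ)
open import Data.Vec using (Vec; []; _∷_)
open import Data.List using (List; length; filter; upTo)
open import Relation.Binary.PropositionalEquality using (_≡_)
open import Data.Nat.Properties using (_≟_)

-- Polynomial quotient q_{p,w}(u) ∈ {0,…,p-1}: ((u^w - u^{wp}) / p) mod p, computed in ℤ
-- (the division is exact since p ∣ u^w - u^{wp}).
polyQuot : (p : ℕ) .{{_ : NonZero p}} → (w u : ℕ) → ℕ
polyQuot p w u = ((+ (u ^ w) - + (u ^ (w * p))) /ℕ p) %ℕ p

-- A polynomial over F_p is a coefficient vector (a₀, a₁, …, a_d), lowest degree first,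
-- with coefficients in Fin p ≅ F_p.  Evaluation at an integer u, as an element of ℕ (unreduced).
evalℕ : {p n : ℕ} → Vec (Fin p) n → ℕ → ℕ
evalℕ [] u = 0
evalℕ (a ∷ as) u = toℕ a + u * evalℕ as u

polyEval : (p : ℕ) .{{_ : NonZero p}} → {n : ℕ} → Vec (Fin p) n → ℕ → ℕ
polyEval p f u = evalℕ f u % p

countF : (w N p : ℕ) .{{_ : NonZero p}} → {n : ℕ} → Vec (Fin p) n → ℕ
countF w N p f = length (filter (λ u → polyQuot p w u ≟ polyEval p f u) (upTo N))

{-# OPTIONS --safe #-}
-- Write r(u) = (u^p - u) / p.  Since u^(wp) = (u + p r(u))^w, the polynomial quotient satisfies
-- q_{p,w}(u) ≡ -w u^(w-1) r(u) mod p, so for 0 < u < p the equation q_{p,w}(u) = f(u) becomes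
-- r(u) = g(u) with g = -w^(p-2) X^(p-w) f, or, on the class u^w = a, with g = -(wa)^(p-2) X f;
-- there are at most (p-1)/gcd(w,p-1) classes.
--
-- If u and u + h are both solutions, then Ψ(u) = g(u+h) - g(u) - r(h), where
-- Ψ = ((X+h)^p - X^p - h^p) / p.  As X (X+h) Ψ′ ≡ h (X - X^p) mod p, Stepanov's method in the form of
-- Heath-Brown and Konyagin, with an auxiliary polynomial Σ λ_{kab} X^(pk) (X+h)^a Ψ^b, shows that
-- the number T of such u satisfies T^3 ≪ deg(g) p^2.  Summing over 0 < h < N gives
-- (number of solutions)^2 ≪ N T, and all four bounds follow.
module Submission where

open import Defs
open import Data.Nat as ℕ using (ℕ; zero; suc; _≤_; _<_; z≤n; s≤s; s≤s⁻¹; NonZero; _∸_)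
import Data.Nat.Properties as ℕ
import Data.Nat.DivMod as ℕ
import Data.Nat.Divisibility as ℕ∣
open import Data.Nat.GCD using (gcd; gcd[m,n]∣m; gcd[m,n]∣n; gcd[m,n]≤n)
open import Data.Nat.Primality using (Prime; prime⇒nonZero; prime⇒nonTrivial; euclidsLemma; ¬prime[1])
import Data.Nat.Tactic.RingSolver as ℕ-Solver
open import Data.Nat.Solver using (module +-*-Solver)
import Data.Integer as ℤ
import Data.Integer.Properties as ℤ
import Data.Integer.DivMod as ℤ
import Data.Integer.Divisibility.Signed as ℤ∣
open import Data.Integer.Tactic.RingSolver using (solve-∀)
open import Data.Fin as Fin using (Fin; toℕ; fromℕ<; funToFin; finToFun)
import Data.Fin.Properties as Fin
open import Data.Vec using (Vec; []; _∷_; last)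
open import Data.List using (List; []; _∷_; length; filter; upTo; applyUpTo; map)
open import Data.List.Properties using (filter-none; length-filter; length-map; length-upTo)
open import Data.List.Membership.Propositional using (_∈_)
open import Data.List.Membership.Propositional.Properties using (∈-upTo⁺; ∈-upTo⁻; ∈-filter⁺)
open import Data.List.Relation.Unary.Any using (here; there)
open import Data.List.Relation.Unary.All as All using (All; []; _∷_)
import Data.List.Relation.Unary.All.Properties as All
open import Data.List.Relation.Unary.AllPairs using (AllPairs; []; _∷_)
import Data.List.Relation.Unary.AllPairs.Properties as AllPairs
open import Data.List.Relation.Unary.Unique.Propositional using (Unique)
import Data.List.Relation.Unary.Unique.Propositional.Properties as Unique
open import Data.Maybe using (Maybe; just; nothing)
open import Data.Product using (_×_; _,_; ∃; proj₁; proj₂)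
open import Data.Sum using (_⊎_; inj₁; inj₂)
open import Data.Empty using (⊥-elim)
open import Function using (_∘_; id)
open import Relation.Nullary using (¬_; Dec; yes; no)
open import Relation.Nullary.Decidable using (_×-dec_; ¬?)
open import Relation.Unary using (Decidable)
open import Relation.Binary.Bundles using (Setoid)
open import Relation.Binary.Definitions using (tri<; tri≈; tri>)
open import Relation.Binary.PropositionalEquality as ≡ using (_≡_; _≢_; refl; cong; cong₂; sym; trans; subst; subst₂)
import Relation.Binary.Reasoning.Setoid as SetoidReasoning
open import Algebra.Bundles using (CommutativeRing)
open import Algebra.Structures using (IsCommutativeRing)
open import Algebra.Solver.Ring.AlmostCommutativeRing using (fromCommutativeRing; _-Raw-AlmostCommutative⟶_)
import Algebra.Solver.Ring

-- `(X ^ p - X) / p` does not have integer coefficients, so `r(u) = g(u)` is not an equation modulo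
-- `p` that can be differentiated. Pairs repair this: the linear terms cancel in
-- `r(u+h) - r(u) - r(h)`, and what remains is a value of the integral polynomial `Ψ`. Its degree is
-- large but its derivative is simple, so at a common point, where also `X ^ p = X`, the derivatives
-- of the auxiliary polynomial take the values of polynomials of low degree, and few linear
-- conditions make them vanish. The delicate point is that the auxiliary polynomial is nonzero.
-- Modulo `X ^ p`, `Ψ` is the truncation of `h log (1 + X/h)`, so the products `(X+h) ^ a Ψ ^ b`
-- behave like exponential polynomials `exp (a v) v ^ b`, and a nontrivial combination of `A B ≤ p`
-- of them cannot vanish to order `p`. Polynomials are power series over ℤ with a degree bound,
-- compared modulo `n`; for `n = 0` the same theory yields the identities over ℤ in which a factor
-- `p` is divided out.

module StepanovMethod where

  open import Data.Integer using (ℤ; +_; _+_; _*_; -_; _-_; 0ℤ; 1ℤ)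

  -- Congruences of integers

  infix 4 _≡_[mod_]

  -- The quotient is kept as data: `fermatQuotient` and the series `Ψ` are read off from it. The
  -- modulus may be 0, in which case a congruence is an equality of integers.
  record _≡_[mod_] (a b : ℤ) (n : ℕ) : Set where
    constructor by
    field
      quotient : ℤ
      equality : a ≡ b + quotient * + n

  module _ {n : ℕ} where

    ≡⇒mod : ∀ {a b} → a ≡ b → a ≡ b [mod n ]
    ≡⇒mod {a} refl = by 0ℤ (lem a (+ n))
      where
      lem : ∀ a n → a ≡ a + 0ℤ * n
      lem = solve-∀

    mod-refl : ∀ {a} → a ≡ a [mod n ]
    mod-refl = ≡⇒mod refl

    mod-sym : ∀ {a b} → a ≡ b [mod n ] → b ≡ a [mod n ]
    mod-sym {a} {b} (by k refl) = by (- k) (lem b k (+ n))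
      where
      lem : ∀ b k n → b ≡ b + k * n + - k * n
      lem = solve-∀

    mod-trans : ∀ {a b c} → a ≡ b [mod n ] → b ≡ c [mod n ] → a ≡ c [mod n ]
    mod-trans {c = c} (by k refl) (by l refl) = by (k + l) (lem c k l (+ n))
      where
      lem : ∀ c k l n → c + l * n + k * n ≡ c + (k + l) * n
      lem = solve-∀

    mod-+ : ∀ {a b c d} → a ≡ b [mod n ] → c ≡ d [mod n ] → a + c ≡ b + d [mod n ]
    mod-+ {b = b} {d = d} (by k refl) (by l refl) = by (k + l) (lem b d k l (+ n))
      where
      lem : ∀ b d k l n → b + k * n + (d + l * n) ≡ b + d + (k + l) * n
      lem = solve-∀

    mod-* : ∀ {a b c d} → a ≡ b [mod n ] → c ≡ d [mod n ] → a * c ≡ b * d [mod n ]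
    mod-* {b = b} {d = d} (by k refl) (by l refl) = by (k * d + b * l + k * l * + n) (lem b d k l (+ n))
      where
      lem : ∀ b d k l n → (b + k * n) * (d + l * n) ≡ b * d + (k * d + b * l + k * l * n) * n
      lem = solve-∀

    mod-neg : ∀ {a b} → a ≡ b [mod n ] → - a ≡ - b [mod n ]
    mod-neg {b = b} (by k refl) = by (- k) (lem b k (+ n))
      where
      lem : ∀ b k n → - (b + k * n) ≡ - b + - k * n
      lem = solve-∀

    mod-^ : ∀ {a b} k → a ≡ b [mod n ] → a ℤ.^ k ≡ b ℤ.^ k [mod n ]
    mod-^ zero    a≡b = mod-refl
    mod-^ (suc k) a≡b = mod-* a≡b (mod-^ k a≡b)

  mod-setoid : ℕ → Setoid _ _
  mod-setoid n = record
    { _≈_ = _≡_[mod n ]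
    ; isEquivalence = record { refl = mod-refl ; sym = mod-sym ; trans = mod-trans }
    }

  mod-0⇒≡ : ∀ {a b} → a ≡ b [mod 0 ] → a ≡ b
  mod-0⇒≡ {b = b} (by k refl) = lem b k
    where
    lem : ∀ b k → b + k * 0ℤ ≡ b
    lem = solve-∀

  -- Formal power series over ℤ

  record Series : Set where
    no-eta-equality
    constructor series
    infixl 9 _‼_
    field _‼_ : ℕ → ℤ
  open Series public

  infix 4 _≗_
  _≗_ : Series → Series → Set
  f ≗ g = ∀ i → f ‼ i ≡ g ‼ i

  tail : Series → Series
  tail f ‼ i = f ‼ suc i

  infixl 6 _⊕_
  infixl 7 _⊛_ _·_
  infix 8 ⊖_

  _⊕_ : Series → Series → Series
  (f ⊕ g) ‼ i = f ‼ i + g ‼ i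

  ⊖_ : Series → Series
  (⊖ f) ‼ i = - (f ‼ i)

  _·_ : ℤ → Series → Series
  (c · f) ‼ i = c * f ‼ i

  _⊛_ : Series → Series → Series
  (f ⊛ g) ‼ zero  = f ‼ 0 * g ‼ 0
  (f ⊛ g) ‼ suc i = f ‼ 0 * g ‼ suc i + (tail f ⊛ g) ‼ i

  const : ℤ → Series
  const c ‼ zero  = c
  const c ‼ suc i = 0ℤ

  X : Series
  X ‼ zero  = 0ℤ
  X ‼ suc i = const 1ℤ ‼ i

  infixr 8 _^_
  _^_ : Series → ℕ → Series
  f ^ zero  = const 1ℤ
  f ^ suc m = f ⊛ f ^ m

  -- `Series` has no eta, so series with definitionally equal coefficients, such as `tail (f ⊕ g)`
  -- and `tail f ⊕ tail g`, are exchanged through this lemma with `λ j → refl`.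
  ⊛-cong≗ : ∀ {f f′ g g′} → f ≗ f′ → g ≗ g′ → f ⊛ g ≗ f′ ⊛ g′
  ⊛-cong≗ p q zero    = cong₂ _*_ (p 0) (q 0)
  ⊛-cong≗ p q (suc i) = cong₂ _+_ (cong₂ _*_ (p 0) (q (suc i))) (⊛-cong≗ (λ j → p (suc j)) q i)

  ⊛-zeroˡ : ∀ {f} g → (∀ i → f ‼ i ≡ 0ℤ) → ∀ i → (f ⊛ g) ‼ i ≡ 0ℤ
  ⊛-zeroˡ g z zero    = trans (cong (_* g ‼ 0) (z 0)) (ℤ.*-zeroˡ (g ‼ 0))
  ⊛-zeroˡ g z (suc i) =
    cong₂ _+_ (trans (cong (_* g ‼ suc i) (z 0)) (ℤ.*-zeroˡ (g ‼ suc i))) (⊛-zeroˡ g (λ j → z (suc j)) i)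

  const-⊛ : ∀ c g → const c ⊛ g ≗ c · g
  const-⊛ c g zero    = refl
  const-⊛ c g (suc i) =
    trans (cong (λ z → c * g ‼ suc i + z) (⊛-zeroˡ g (λ j → refl) i)) (ℤ.+-identityʳ (c * g ‼ suc i))

  X-⊛ : ∀ f i → (X ⊛ f) ‼ suc i ≡ f ‼ i
  X-⊛ f i = trans (cong₂ _+_ (ℤ.*-zeroˡ (f ‼ suc i)) (trans (⊛-cong≗ (λ j → refl) (λ j → refl) i) (const-⊛ 1ℤ f i)))
                  (lem (f ‼ i))
    where
    lem : ∀ a → 0ℤ + 1ℤ * a ≡ a
    lem = solve-∀

  ⊛-distribʳ : ∀ h f g → (f ⊕ g) ⊛ h ≗ (f ⊛ h) ⊕ (g ⊛ h)
  ⊛-distribʳ h f g zero    = ℤ.*-distribʳ-+ (h ‼ 0) (f ‼ 0) (g ‼ 0)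
  ⊛-distribʳ h f g (suc i) =
    trans (cong (λ z → (f ‼ 0 + g ‼ 0) * h ‼ suc i + z)
            (trans (⊛-cong≗ (λ j → refl) (λ j → refl) i) (⊛-distribʳ h (tail f) (tail g) i)))
          (lem (f ‼ 0) (g ‼ 0) (h ‼ suc i) ((tail f ⊛ h) ‼ i) ((tail g ⊛ h) ‼ i))
    where
    lem : ∀ a b c x y → (a + b) * c + (x + y) ≡ a * c + x + (b * c + y)
    lem = solve-∀

  ·-⊛ : ∀ c f g → (c · f) ⊛ g ≗ c · (f ⊛ g)
  ·-⊛ c f g zero    = ℤ.*-assoc c (f ‼ 0) (g ‼ 0)
  ·-⊛ c f g (suc i) =
    trans (cong (λ z → c * f ‼ 0 * g ‼ suc i + z)
            (trans (⊛-cong≗ (λ j → refl) (λ j → refl) i) (·-⊛ c (tail f) g i)))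
          (lem c (f ‼ 0) (g ‼ suc i) ((tail f ⊛ g) ‼ i))
    where
    lem : ∀ a b c x → a * b * c + a * x ≡ a * (b * c + x)
    lem = solve-∀

  -- The product is defined by peeling off the constant term of the left factor; the induction for
  -- commutativity needs this mirror image.
  ⊛-tailʳ : ∀ f g i → (f ⊛ g) ‼ suc i ≡ f ‼ suc i * g ‼ 0 + (f ⊛ tail g) ‼ i
  ⊛-tailʳ f g zero    = ℤ.+-comm (f ‼ 0 * g ‼ 1) (f ‼ 1 * g ‼ 0)
  ⊛-tailʳ f g (suc i) =
    trans (cong (λ z → f ‼ 0 * g ‼ suc (suc i) + z) (⊛-tailʳ (tail f) g i))
          (lem (f ‼ 0 * g ‼ suc (suc i)) (f ‼ suc (suc i) * g ‼ 0) ((tail f ⊛ tail g) ‼ i))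
    where
    lem : ∀ a b c → a + (b + c) ≡ b + (a + c)
    lem = solve-∀

  ⊛-comm : ∀ f g → f ⊛ g ≗ g ⊛ f
  ⊛-comm f g zero    = ℤ.*-comm (f ‼ 0) (g ‼ 0)
  ⊛-comm f g (suc i) =
    trans (cong₂ _+_ (ℤ.*-comm (f ‼ 0) (g ‼ suc i)) (⊛-comm (tail f) g i)) (sym (⊛-tailʳ g f i))

  ⊛-assoc : ∀ f g h → (f ⊛ g) ⊛ h ≗ f ⊛ (g ⊛ h)
  ⊛-assoc f g h zero    = ℤ.*-assoc (f ‼ 0) (g ‼ 0) (h ‼ 0)
  ⊛-assoc f g h (suc i) =
    trans (cong (λ z → f ‼ 0 * g ‼ 0 * h ‼ suc i + z) step)
          (lem (f ‼ 0) (g ‼ 0) (h ‼ suc i) ((tail g ⊛ h) ‼ i) ((tail f ⊛ (g ⊛ h)) ‼ i))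
    where
    step : (tail (f ⊛ g) ⊛ h) ‼ i ≡ f ‼ 0 * (tail g ⊛ h) ‼ i + (tail f ⊛ (g ⊛ h)) ‼ i
    step = trans (⊛-cong≗ {f′ = (f ‼ 0 · tail g) ⊕ (tail f ⊛ g)} (λ j → refl) (λ j → refl) i)
          (trans (⊛-distribʳ h (f ‼ 0 · tail g) (tail f ⊛ g) i)
                 (cong₂ _+_ (·-⊛ (f ‼ 0) (tail g) h i) (⊛-assoc (tail f) g h i)))
    lem : ∀ a b c x y → a * b * c + (a * x + y) ≡ a * (b * c + x) + y
    lem = solve-∀

  ⊛-identityˡ : ∀ f → const 1ℤ ⊛ f ≗ f
  ⊛-identityˡ f i = trans (const-⊛ 1ℤ f i) (ℤ.*-identityˡ (f ‼ i))

  -- The ring of power series modulo `n`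

  module Ring (n : ℕ) where

    infix 4 _≈_
    record _≈_ (f g : Series) : Set where
      constructor coeffs
      field at : ∀ i → f ‼ i ≡ g ‼ i [mod n ]
    open _≈_ public

    ≗⇒≈ : ∀ {f g} → f ≗ g → f ≈ g
    ≗⇒≈ e = coeffs λ i → ≡⇒mod (e i)

    ⊛-cong : ∀ {f f′ g g′} → f ≈ f′ → g ≈ g′ → f ⊛ g ≈ f′ ⊛ g′
    ⊛-cong p q = coeffs (go p q)
      where
      go : ∀ {f f′ g g′} → f ≈ f′ → g ≈ g′ → ∀ i → (f ⊛ g) ‼ i ≡ (f′ ⊛ g′) ‼ i [mod n ]
      go p q zero    = mod-* (at p 0) (at q 0)
      go p q (suc i) = mod-+ (mod-* (at p 0) (at q (suc i))) (go (coeffs λ j → at p (suc j)) q i)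

    isCommutativeRing : IsCommutativeRing _≈_ _⊕_ _⊛_ ⊖_ (const 0ℤ) (const 1ℤ)
    isCommutativeRing = record
      { isRing = record
        { +-isAbelianGroup = record
          { isGroup = record
            { isMonoid = record
              { isSemigroup = record
                { isMagma = record
                  { isEquivalence = record
                    { refl = coeffs λ i → mod-refl
                    ; sym = λ p → coeffs λ i → mod-sym (at p i)
                    ; trans = λ p q → coeffs λ i → mod-trans (at p i) (at q i)
                    }
                  ; ∙-cong = λ p q → coeffs λ i → mod-+ (at p i) (at q i)
                  }
                ; assoc = λ f g h → ≗⇒≈ λ i → ℤ.+-assoc (f ‼ i) (g ‼ i) (h ‼ i)
                }
              ; identity = (λ f → ≗⇒≈ (idˡ f)) , (λ f → ≗⇒≈ λ i → trans (ℤ.+-comm (f ‼ i) _) (idˡ f i))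
              }
            ; inverse = (λ f → ≗⇒≈ (invˡ f)) , (λ f → ≗⇒≈ λ i → trans (ℤ.+-comm (f ‼ i) _) (invˡ f i))
            ; ⁻¹-cong = λ p → coeffs λ i → mod-neg (at p i)
            }
          ; comm = λ f g → ≗⇒≈ λ i → ℤ.+-comm (f ‼ i) (g ‼ i)
          }
        ; *-cong = ⊛-cong
        ; *-assoc = λ f g h → ≗⇒≈ (⊛-assoc f g h)
        ; *-identity = (λ f → ≗⇒≈ (⊛-identityˡ f)) ,
                       (λ f → ≗⇒≈ λ i → trans (⊛-comm f (const 1ℤ) i) (⊛-identityˡ f i))
        ; distrib = (λ f g h → ≗⇒≈ λ i →
                       trans (⊛-comm f (g ⊕ h) i)
                      (trans (⊛-distribʳ f g h i) (cong₂ _+_ (⊛-comm g f i) (⊛-comm h f i)))) ,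
                    (λ f g h → ≗⇒≈ (⊛-distribʳ f g h))
        }
      ; *-comm = λ f g → ≗⇒≈ (⊛-comm f g)
      }
      where
      idˡ : ∀ f i → (const 0ℤ ⊕ f) ‼ i ≡ f ‼ i
      idˡ f zero    = ℤ.+-identityˡ (f ‼ 0)
      idˡ f (suc i) = ℤ.+-identityˡ (f ‼ suc i)
      invˡ : ∀ f i → (⊖ f ⊕ f) ‼ i ≡ const 0ℤ ‼ i
      invˡ f zero    = ℤ.+-inverseˡ (f ‼ 0)
      invˡ f (suc i) = ℤ.+-inverseˡ (f ‼ suc i)

    ring : CommutativeRing _ _
    ring = record { isCommutativeRing = isCommutativeRing }

    open CommutativeRing ring public
      using (setoid; +-cong; +-congˡ; +-congʳ; *-congˡ; *-congʳ; zeroˡ; zeroʳ;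
             +-identityˡ; +-identityʳ; *-identityˡ; *-identityʳ; -‿cong; *-comm; *-assoc; +-assoc)
      renaming (refl to ≈-refl; sym to ≈-sym; trans to ≈-trans; reflexive to ≈-reflexive)

    const-cong : ∀ {a b} → a ≡ b [mod n ] → const a ≈ const b
    const-cong p = coeffs λ { zero → p ; (suc i) → mod-refl }

    const-+ : ∀ a b → const (a + b) ≈ const a ⊕ const b
    const-+ a b = ≗⇒≈ λ { zero → refl ; (suc i) → refl }

    const-* : ∀ a b → const (a * b) ≈ const a ⊛ const b
    const-* a b = ≗⇒≈ λ i → sym (trans (const-⊛ a (const b) i) (lem i))
      where
      lem : (a · const b) ≗ const (a * b)
      lem zero    = refl
      lem (suc i) = ℤ.*-zeroʳ a

    const-neg : ∀ a → const (- a) ≈ ⊖ const a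
    const-neg a = ≗⇒≈ λ { zero → refl ; (suc i) → refl }

    private
      morphism : ℤ.+-*-rawRing -Raw-AlmostCommutative⟶ fromCommutativeRing ring
      morphism = record
        { ⟦_⟧ = const ; +-homo = const-+ ; *-homo = const-* ; -‿homo = const-neg
        ; 0-homo = ≈-refl ; 1-homo = ≈-refl }

      const-≟ : ∀ a b → Maybe (const a ≈ const b)
      const-≟ a b with a ℤ.≟ b
      ... | yes refl = just ≈-refl
      ... | no _ = nothing

    module Solver = Algebra.Solver.Ring ℤ.+-*-rawRing (fromCommutativeRing ring) morphism const-≟

  -- Polynomials: degree, evaluation, roots

  lin : ℤ → Series
  lin s = X ⊕ const (- s)

  -- Horner's scheme for the truncation at degree `k`. A power series has no value of its own, so
  -- the bound is an argument until `_⇓[_]_` hides it.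
  ev : ℕ → ℤ → Series → ℤ
  ev zero    s f = f ‼ 0
  ev (suc k) s f = f ‼ 0 + s * ev k s (tail f)

  module Polynomial (n : ℕ) where
    open Ring n

    private
      variable
        f g : Series
        k l : ℕ
        s u v : ℤ

    tail-cong : f ≈ g → tail f ≈ tail g
    tail-cong e = coeffs λ i → at e (suc i)

    tail-⊛ : ∀ f g → tail (f ⊛ g) ≈ f ‼ 0 · tail g ⊕ tail f ⊛ g
    tail-⊛ f g = ≗⇒≈ λ i → refl

    lin-⊛-0 : ∀ s f → (lin s ⊛ f) ‼ 0 ≡ - s * f ‼ 0
    lin-⊛-0 s f = cong (_* f ‼ 0) (ℤ.+-identityˡ (- s))

    lin-⊛-suc : ∀ s f i → (lin s ⊛ f) ‼ suc i ≡ f ‼ i + - s * f ‼ suc i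
    lin-⊛-suc s f i = trans (⊛-distribʳ f X (const (- s)) (suc i))
                            (cong₂ _+_ (X-⊛ f i) (const-⊛ (- s) f (suc i)))

    record Deg (k : ℕ) (f : Series) : Set where
      constructor deg
      field vanish : ∀ i → k < i → f ‼ i ≡ 0ℤ [mod n ]
    open Deg public

    Deg-mono : k ≤ l → Deg k f → Deg l f
    Deg-mono k≤l (deg d) = deg λ i l<i → d i (ℕ.≤-<-trans k≤l l<i)

    Deg-cong : f ≈ g → Deg k f → Deg k g
    Deg-cong e (deg d) = deg λ i k<i → mod-trans (mod-sym (at e i)) (d i k<i)

    Deg-⊕ : Deg k f → Deg k g → Deg k (f ⊕ g)
    Deg-⊕ (deg d) (deg e) = deg λ i k<i → mod-+ (d i k<i) (e i k<i)

    Deg-tail : Deg (suc k) f → Deg k (tail f)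
    Deg-tail (deg d) = deg λ i k<i → d (suc i) (s≤s k<i)

    Deg-const : ∀ c → Deg 0 (const c)
    Deg-const c = deg λ { (suc i) _ → mod-refl }

    Deg-X : Deg 1 X
    Deg-X = deg λ { (suc (suc i)) _ → mod-refl ; (suc zero) (s≤s ()) }

    Deg-0⇒const : Deg 0 f → f ≈ const (f ‼ 0)
    Deg-0⇒const (deg d) = coeffs λ { zero → mod-refl ; (suc i) → d (suc i) (s≤s z≤n) }

    const-⊛-≈ : ∀ c g → const c ⊛ g ≈ c · g
    const-⊛-≈ c g = ≗⇒≈ (const-⊛ c g)

    private
      *-≡0ʳ : ∀ a {b} → b ≡ 0ℤ [mod n ] → a * b ≡ 0ℤ [mod n ]
      *-≡0ʳ a b≡0 = mod-trans (mod-* (mod-refl {a = a}) b≡0) (≡⇒mod (ℤ.*-zeroʳ a))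

    Deg-⊛ : Deg k f → Deg l g → Deg (k ℕ.+ l) (f ⊛ g)
    Deg-⊛ df dg = deg (go df dg)
      where
      go : Deg k f → Deg l g → ∀ i → k ℕ.+ l < i → (f ⊛ g) ‼ i ≡ 0ℤ [mod n ]
      go {zero} {f} {l} {g} df (deg dg) i l<i = mod-trans
        (at (≈-trans (⊛-cong (Deg-0⇒const df) ≈-refl) (const-⊛-≈ (f ‼ 0) g)) i) (*-≡0ʳ (f ‼ 0) (dg i l<i))
      go {suc k} {f} {l} {g} df dg (suc i) (s≤s k+l<i) = mod-+
        (*-≡0ʳ (f ‼ 0) (vanish dg (suc i) (s≤s (ℕ.≤-trans (ℕ.m≤n+m l k) (ℕ.<⇒≤ k+l<i)))))
        (go {k} (Deg-tail df) dg i k+l<i)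

    Deg-^ : ∀ {f} m → Deg k f → Deg (m ℕ.* k) (f ^ m)
    Deg-^ zero    d = Deg-const 1ℤ
    Deg-^ (suc m) d = Deg-⊛ d (Deg-^ m d)

    Deg-lin : ∀ s → Deg 1 (lin s)
    Deg-lin s = Deg-⊕ Deg-X (Deg-mono z≤n (Deg-const (- s)))

    ev-cong : ∀ k s → f ≈ g → ev k s f ≡ ev k s g [mod n ]
    ev-cong zero    s e = at e 0
    ev-cong (suc k) s e = mod-+ (at e 0) (mod-* (mod-refl {a = s}) (ev-cong k s (tail-cong e)))

    ev-⊕ : ∀ k s f g → ev k s (f ⊕ g) ≡ ev k s f + ev k s g [mod n ]
    ev-⊕ zero    s f g = mod-refl
    ev-⊕ (suc k) s f g = mod-trans
      (mod-+ (mod-refl {a = f ‼ 0 + g ‼ 0}) (mod-* (mod-refl {a = s})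
        (mod-trans (ev-cong {tail (f ⊕ g)} {tail f ⊕ tail g} k s (≗⇒≈ λ i → refl)) (ev-⊕ k s (tail f) (tail g)))))
      (≡⇒mod (lem (f ‼ 0) (g ‼ 0) s (ev k s (tail f)) (ev k s (tail g))))
      where
      lem : ∀ a b s x y → a + b + s * (x + y) ≡ a + s * x + (b + s * y)
      lem = solve-∀

    ev-· : ∀ k s c f → ev k s (c · f) ≡ c * ev k s f [mod n ]
    ev-· zero    s c f = mod-refl
    ev-· (suc k) s c f = mod-trans
      (mod-+ (mod-refl {a = c * f ‼ 0}) (mod-* (mod-refl {a = s})
        (mod-trans (ev-cong {tail (c · f)} {c · tail f} k s (≗⇒≈ λ i → refl)) (ev-· k s c (tail f)))))
      (≡⇒mod (lem (f ‼ 0) c s (ev k s (tail f))))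
      where
      lem : ∀ a c s x → c * a + s * (c * x) ≡ c * (a + s * x)
      lem = solve-∀

    ev-zero : ∀ k s → f ≈ const 0ℤ → ev k s f ≡ 0ℤ [mod n ]
    ev-zero zero    s e = at e 0
    ev-zero (suc k) s e = mod-trans
      (mod-+ (at e 0) (mod-* (mod-refl {a = s}) (ev-zero k s (coeffs λ { zero → at e 1 ; (suc i) → at e (suc (suc i)) }))))
      (≡⇒mod (lem s))
      where
      lem : ∀ s → 0ℤ + s * 0ℤ ≡ 0ℤ
      lem = solve-∀

    ev-const : ∀ k s c → ev k s (const c) ≡ c [mod n ]
    ev-const zero    s c = mod-refl
    ev-const (suc k) s c = mod-trans
      (mod-+ (mod-refl {a = c}) (mod-* (mod-refl {a = s}) (ev-zero {tail (const c)} k s (coeffs λ { zero → mod-refl ; (suc i) → mod-refl }))))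
      (≡⇒mod (lem c s))
      where
      lem : ∀ c s → c + s * 0ℤ ≡ c
      lem = solve-∀

    ev-extend : ∀ k j s → Deg k f → ev (k ℕ.+ j) s f ≡ ev k s f [mod n ]
    ev-extend zero    j s d = mod-trans (ev-cong j s (Deg-0⇒const d)) (ev-const j s _)
    ev-extend {f} (suc k) j s d = mod-+ (mod-refl {a = f ‼ 0}) (mod-* (mod-refl {a = s}) (ev-extend k j s (Deg-tail d)))

    -- Induction on the degree bound of `f` through `tail-⊛`. It produces values of `g` truncated at
    -- different bounds, which `ev-extend` identifies.
    ev-⊛ : ∀ k l s f g → Deg k f → Deg l g → ev (k ℕ.+ l) s (f ⊛ g) ≡ ev k s f * ev l s g [mod n ]
    ev-⊛ zero l s f g df dg = mod-trans
      (ev-cong l s (≈-trans (⊛-cong (Deg-0⇒const df) ≈-refl) (const-⊛-≈ (f ‼ 0) g))) (ev-· l s (f ‼ 0) g)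
    ev-⊛ (suc k) l s f g df dg = begin
      f ‼ 0 * g ‼ 0 + s * ev (k ℕ.+ l) s (tail (f ⊛ g))
        ≈⟨ mod-+ (mod-refl {a = f ‼ 0 * g ‼ 0}) (mod-* (mod-refl {a = s}) (mod-trans (ev-cong (k ℕ.+ l) s (tail-⊛ f g))
             (mod-trans (ev-⊕ (k ℕ.+ l) s _ _) (mod-+ (ev-· (k ℕ.+ l) s (f ‼ 0) (tail g))
               (ev-⊛ k l s (tail f) g (Deg-tail df) dg))))) ⟩
      f ‼ 0 * g ‼ 0 + s * (f ‼ 0 * ev (k ℕ.+ l) s (tail g) + ev k s (tail f) * ev l s g)
        ≡⟨ lem (f ‼ 0) (g ‼ 0) s (ev (k ℕ.+ l) s (tail g)) (ev k s (tail f)) (ev l s g) ⟩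
      f ‼ 0 * ev (suc k ℕ.+ l) s g + s * ev k s (tail f) * ev l s g
        ≡⟨ cong (λ m → f ‼ 0 * ev m s g + s * ev k s (tail f) * ev l s g) (ℕ.+-comm (suc k) l) ⟩
      f ‼ 0 * ev (l ℕ.+ suc k) s g + s * ev k s (tail f) * ev l s g
        ≈⟨ mod-+ (mod-* (mod-refl {a = f ‼ 0}) (ev-extend l (suc k) s dg)) mod-refl ⟩
      f ‼ 0 * ev l s g + s * ev k s (tail f) * ev l s g
        ≡⟨ sym (ℤ.*-distribʳ-+ (ev l s g) (f ‼ 0) _) ⟩
      (f ‼ 0 + s * ev k s (tail f)) * ev l s g ∎
      where
      open SetoidReasoning (mod-setoid n)
      lem : ∀ a b s x y z → a * b + s * (a * x + y * z) ≡ a * (b + s * x) + s * y * z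
      lem = solve-∀

    infix 4 _⇓[_]_
    -- Evaluation as a relation with a hidden degree bound, so that values of compound polynomials
    -- are assembled without arithmetic on bounds; by `⇓-unique` the choice of bound does not affect
    -- the value.
    record _⇓[_]_ (f : Series) (s v : ℤ) : Set where
      constructor value
      field
        bound  : ℕ
        degree : Deg bound f
        eval   : ev bound s f ≡ v [mod n ]

    Poly : Series → Set
    Poly f = ∃ λ k → Deg k f

    Poly⇒⇓ : Poly f → ∃ λ v → f ⇓[ s ] v
    Poly⇒⇓ (k , d) = _ , value k d mod-refl

    ⇓-≡ : u ≡ v [mod n ] → f ⇓[ s ] u → f ⇓[ s ] v
    ⇓-≡ e (value k d q) = value k d (mod-trans q e)

    ⇓-cong : f ≈ g → f ⇓[ s ] v → g ⇓[ s ] v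
    ⇓-cong e (value k d q) = value k (Deg-cong e d) (mod-trans (ev-cong k _ (≈-sym e)) q)

    ⇓-extend : ∀ j → (q : f ⇓[ s ] v) → ev (_⇓[_]_.bound q ℕ.+ j) s f ≡ v [mod n ]
    ⇓-extend j (value k d q) = mod-trans (ev-extend k j _ d) q

    ⇓-unique : f ⇓[ s ] u → f ⇓[ s ] v → u ≡ v [mod n ]
    ⇓-unique {f} {s} {u} {v} p@(value k _ _) q@(value l _ _) = mod-trans
      (mod-sym (⇓-extend l p)) (subst (λ m → ev m s f ≡ v [mod n ]) (ℕ.+-comm l k) (⇓-extend k q))

    ⇓-⊕ : f ⇓[ s ] u → g ⇓[ s ] v → f ⊕ g ⇓[ s ] u + v
    ⇓-⊕ {f} {s} {u} {g} {v} p@(value k d _) q@(value l e _) = value (k ℕ.+ l)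
      (Deg-⊕ (Deg-mono (ℕ.m≤m+n k l) d) (Deg-mono (ℕ.m≤n+m l k) e))
      (mod-trans (ev-⊕ (k ℕ.+ l) s f g)
        (mod-+ (⇓-extend l p) (subst (λ m → ev m s g ≡ v [mod n ]) (ℕ.+-comm l k) (⇓-extend k q))))

    ⇓-⊛ : f ⇓[ s ] u → g ⇓[ s ] v → f ⊛ g ⇓[ s ] u * v
    ⇓-⊛ (value k d p) (value l e q) = value (k ℕ.+ l) (Deg-⊛ d e)
      (mod-trans (ev-⊛ k l _ _ _ d e) (mod-* p q))

    ⇓-const : ∀ c → const c ⇓[ s ] c
    ⇓-const c = value 0 (Deg-const c) mod-refl

    ⇓-X : X ⇓[ s ] s
    ⇓-X {s} = value 1 Deg-X (≡⇒mod (lem s))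
      where
      lem : ∀ s → 0ℤ + s * 1ℤ ≡ s
      lem = solve-∀

    ⇓-⊖ : f ⇓[ s ] u → ⊖ f ⇓[ s ] - u
    ⇓-⊖ {f} {s} {u} p = ⇓-≡ (≡⇒mod (lem u))
      (⇓-cong (Solver.solve 1 (λ x → con (- 1ℤ) :* x := :- x) ≈-refl f) (⇓-⊛ (⇓-const (- 1ℤ)) p))
      where
      open Solver
      lem : ∀ a → - 1ℤ * a ≡ - a
      lem = solve-∀

    ⇓-^ : ∀ m → f ⇓[ s ] u → f ^ m ⇓[ s ] u ℤ.^ m
    ⇓-^ zero    p = ⇓-const 1ℤ
    ⇓-^ (suc m) p = ⇓-⊛ p (⇓-^ m p)

    ⇓-lin : ∀ a → lin a ⇓[ s ] s - a
    ⇓-lin a = ⇓-⊕ ⇓-X (⇓-const (- a))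

    -- Synthetic division by X - s.
    quo : ℕ → ℤ → Series → Series
    quo zero    s f = const 0ℤ
    quo (suc k) s f = series λ { zero → ev k s (tail f) ; (suc i) → quo k s (tail f) ‼ i }

    Deg-quo : ∀ k s f → Deg k (quo k s f)
    Deg-quo zero    s f = Deg-const 0ℤ
    Deg-quo (suc k) s f = deg λ { (suc i) (s≤s k<i) → vanish (Deg-quo k s (tail f)) i k<i }

    quo-spec : ∀ k s f → Deg k f → f ≈ const (ev k s f) ⊕ lin s ⊛ quo k s f
    quo-spec k s f d = coeffs (go k f d)
      where
      shuffle₀ : ∀ a s e → a ≡ a + s * e + - s * e
      shuffle₀ = solve-∀
      zeros : ∀ s → 0ℤ ≡ 0ℤ + (0ℤ + - s * 0ℤ)
      zeros = solve-∀
      zero₀ : ∀ a s → a ≡ a + - s * 0ℤ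
      zero₀ = solve-∀
      go : ∀ k f → Deg k f → ∀ i → f ‼ i ≡ (const (ev k s f) ⊕ lin s ⊛ quo k s f) ‼ i [mod n ]
      go zero f d zero = ≡⇒mod (trans (zero₀ (f ‼ 0) s) (cong (λ z → f ‼ 0 + z) (sym (lin-⊛-0 s (const 0ℤ)))))
      go zero f d (suc zero) = mod-trans (vanish d 1 (s≤s z≤n))
        (≡⇒mod (trans (zeros s) (cong (λ z → 0ℤ + z) (sym (lin-⊛-suc s (const 0ℤ) 0)))))
      go zero f d (suc (suc i)) = mod-trans (vanish d (suc (suc i)) (s≤s z≤n))
        (≡⇒mod (trans (zeros s) (cong (λ z → 0ℤ + z) (sym (lin-⊛-suc s (const 0ℤ) (suc i))))))
      go (suc k) f d zero = ≡⇒mod (trans (shuffle₀ (f ‼ 0) s (ev k s (tail f)))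
        (cong (λ z → f ‼ 0 + s * ev k s (tail f) + z) (sym (lin-⊛-0 s (quo (suc k) s f)))))
      go (suc k) f d (suc zero) = mod-trans (go k (tail f) (Deg-tail d) 0)
        (≡⇒mod (trans (cong (λ z → ev k s (tail f) + z) (lin-⊛-0 s (quo k s (tail f))))
          (trans (sym (ℤ.+-identityˡ _)) (cong (λ z → 0ℤ + z) (sym (lin-⊛-suc s (quo (suc k) s f) 0))))))
      go (suc k) f d (suc (suc i)) = mod-trans (go k (tail f) (Deg-tail d) (suc i))
        (≡⇒mod (cong (λ z → 0ℤ + z) (trans (lin-⊛-suc s (quo k s (tail f)) i)
          (sym (lin-⊛-suc s (quo (suc k) s f) (suc i))))))

    factor : f ⇓[ s ] 0ℤ → ∃ λ q → Poly q × f ≈ lin s ⊛ q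
    factor {f} {s} (value k d e) = quo k s f , (k , Deg-quo k s f) ,
      ≈-trans (quo-spec k s f d) (≈-trans (+-congʳ (const-cong e)) (+-identityˡ _))

    -- Since `lin s` is monic, `q ‼ i` equals `(lin s ⊛ q) ‼ suc i` plus `s * q ‼ suc i`. The
    -- coefficients of `q` therefore vanish one after the other, downwards from the bound that
    -- `Poly q` supplies.
    Deg-quotient : ∀ s q → Poly q → ∀ k → (∀ i → k ≤ i → (lin s ⊛ q) ‼ suc i ≡ 0ℤ [mod n ]) →
                   ∀ i → k ≤ i → q ‼ i ≡ 0ℤ [mod n ]
    Deg-quotient s q (l , d) k h i k≤i = go (suc l) i k≤i (ℕ.m≤n+m (suc l) i)
      where
      solve-for : ∀ a s b → a ≡ a + - s * b + s * b
      solve-for = solve-∀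
      zeros : ∀ s → 0ℤ + s * 0ℤ ≡ 0ℤ
      zeros = solve-∀
      go : ∀ j i → k ≤ i → l < i ℕ.+ j → q ‼ i ≡ 0ℤ [mod n ]
      go zero    i k≤i l<i = vanish d i (subst (l <_) (ℕ.+-identityʳ i) l<i)
      go (suc j) i k≤i l<i+j = mod-trans
        (≡⇒mod (trans (solve-for (q ‼ i) s (q ‼ suc i)) (cong (_+ s * q ‼ suc i) (sym (lin-⊛-suc s q i)))))
        (mod-trans (mod-+ (h i k≤i) (mod-* (mod-refl {a = s})
          (go j (suc i) (ℕ.m≤n⇒m≤1+n k≤i) (subst (l <_) (ℕ.+-suc i j) l<i+j)))) (≡⇒mod (zeros s)))

  -- Roots and multiplicities modulo a prime

  module PrimeField (p : ℕ) (pp : Prime p) where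
    open Ring p
    open Polynomial p

    ∣⇒mod : ∀ {a} → p ℕ∣.∣ ℤ.∣ a ∣ → a ≡ 0ℤ [mod p ]
    ∣⇒mod {a} d with ℤ∣.∣ᵤ⇒∣ {+ p} {a} d
    ... | ℤ∣.divides q e = by q (trans e (sym (ℤ.+-identityˡ _)))

    mod⇒∣ : ∀ {a} → a ≡ 0ℤ [mod p ] → p ℕ∣.∣ ℤ.∣ a ∣
    mod⇒∣ {a} (by q e) = ℤ∣.∣⇒∣ᵤ {+ p} {a} (ℤ∣.divides q (trans e (ℤ.+-identityˡ _)))

    *-domain : ∀ a b → a * b ≡ 0ℤ [mod p ] → a ≡ 0ℤ [mod p ] ⊎ b ≡ 0ℤ [mod p ]
    *-domain a b e with euclidsLemma ℤ.∣ a ∣ ℤ.∣ b ∣ pp (subst (p ℕ∣.∣_) (ℤ.abs-* a b) (mod⇒∣ e))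
    ... | inj₁ d = inj₁ (∣⇒mod d)
    ... | inj₂ d = inj₂ (∣⇒mod d)

    *-cancel-0 : ∀ a b → ¬ a ≡ 0ℤ [mod p ] → a * b ≡ 0ℤ [mod p ] → b ≡ 0ℤ [mod p ]
    *-cancel-0 a b a≢0 e with *-domain a b e
    ... | inj₁ x = ⊥-elim (a≢0 x)
    ... | inj₂ y = y

    ^-≢0 : ∀ a m → ¬ a ≡ 0ℤ [mod p ] → ¬ 1ℤ ≡ 0ℤ [mod p ] → ¬ a ℤ.^ m ≡ 0ℤ [mod p ]
    ^-≢0 a zero    a≢0 1≢0 e = 1≢0 e
    ^-≢0 a (suc m) a≢0 1≢0 e = ^-≢0 a m a≢0 1≢0 (*-cancel-0 a _ a≢0 e)

    sub≡0⇒≡ : ∀ {a b} → a - b ≡ 0ℤ [mod p ] → a ≡ b [mod p ]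
    sub≡0⇒≡ {a} {b} e = mod-trans (≡⇒mod (lem a b)) (mod-trans (mod-+ e (mod-refl {a = b})) (≡⇒mod (ℤ.+-identityˡ b)))
      where
      lem : ∀ a b → a ≡ a - b + b
      lem = solve-∀

    ≡⇒sub≡0 : ∀ {a b} → a ≡ b [mod p ] → a - b ≡ 0ℤ [mod p ]
    ≡⇒sub≡0 {a} {b} e = mod-trans (mod-+ e (mod-refl {a = - b})) (≡⇒mod (ℤ.+-inverseʳ b))

    -- The constant term `- s` is invertible, so the coefficients of `f` vanish from the bottom
    -- upwards. This is where the roots counted below have to be nonzero.
    lin-cancel-0 : ∀ s f → ¬ s ≡ 0ℤ [mod p ] → lin s ⊛ f ≈ const 0ℤ → f ≈ const 0ℤ
    lin-cancel-0 s f s≢0 e = coeffs λ { zero → go 0 ; (suc i) → go (suc i) }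
      where
      lem₀ : ∀ s b → s * b ≡ - (- s * b)
      lem₀ = solve-∀
      lem : ∀ s a b → s * b ≡ a - (a + - s * b)
      lem = solve-∀
      go : ∀ i → f ‼ i ≡ 0ℤ [mod p ]
      go zero = *-cancel-0 s _ s≢0 (mod-trans
        (≡⇒mod (trans (lem₀ s (f ‼ 0)) (cong -_ (sym (lin-⊛-0 s f))))) (mod-neg (at e 0)))
      go (suc i) = *-cancel-0 s _ s≢0 (mod-trans
        (≡⇒mod (trans (lem s (f ‼ i) (f ‼ suc i)) (cong (λ z → f ‼ i - z) (sym (lin-⊛-suc s f i)))))
        (mod-+ (go i) (mod-neg (at e (suc i)))))

    lin-cancel : ∀ s f g → ¬ s ≡ 0ℤ [mod p ] → lin s ⊛ f ≈ lin s ⊛ g → f ≈ g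
    lin-cancel s f g s≢0 e = ≈-trans (Solver.solve 2 (λ f g → f := (f :+ :- g) :+ g) ≈-refl f g)
      (≈-trans (+-congʳ (lin-cancel-0 s (f ⊕ ⊖ g) s≢0
        (≈-trans (Solver.solve 3 (λ l f g → l :* (f :+ :- g) := l :* f :+ :- (l :* g)) ≈-refl (lin s) f g)
        (≈-trans (+-congʳ e) (Solver.solve 1 (λ x → x :+ :- x := con 0ℤ) ≈-refl (lin s ⊛ g))))))
      (+-identityˡ g))
      where open Solver

    -- Order at least `m`. The quotient must be a polynomial: for `s ≢ 0` the factor `lin s` is a
    -- unit among power series, and divisibility alone would say nothing.
    record RootOfOrder (s : ℤ) (m : ℕ) (f : Series) : Set where
      constructor root
      field
        quotient : Series
        poly     : Poly quotient
        equality : f ≈ lin s ^ m ⊛ quotient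

    RootOfOrder-cong : ∀ {s m f g} → f ≈ g → RootOfOrder s m f → RootOfOrder s m g
    RootOfOrder-cong f≈g (root q pq e) = root q pq (≈-trans (≈-sym f≈g) e)

    1≢0 : ¬ 1ℤ ≡ 0ℤ [mod p ]
    1≢0 e = ¬prime[1] (subst Prime (ℕ∣.∣1⇒≡1 (mod⇒∣ e)) pp)

    Poly-⊛ : ∀ {f g} → Poly f → Poly g → Poly (f ⊛ g)
    Poly-⊛ (k , d) (l , e) = k ℕ.+ l , Deg-⊛ d e

    Poly-lin^ : ∀ s m → Poly (lin s ^ m)
    Poly-lin^ s m = m ℕ.* 1 , Deg-^ m (Deg-lin s)

    -- At `s` the product `lin s ⊛ f` vanishes while `(s - t) ^ m` does not, so `s` is a root of the
    -- quotient `q`, and the factor `lin s` can be taken out of `q`.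
    RootOfOrder-cancel : ∀ {s t m f} → ¬ s ≡ 0ℤ [mod p ] → ¬ s ≡ t [mod p ] →
                         RootOfOrder t m (lin s ⊛ f) → Poly f → RootOfOrder t m f
    RootOfOrder-cancel {s} {t} {m} {f} s≢0 s≢t (root q pq e) pf =
      let v , q⇓v = Poly⇒⇓ {s = s} pq
          w , f⇓w = Poly⇒⇓ {s = s} pf
          v≡0 = *-cancel-0 ((s - t) ℤ.^ m) v (^-≢0 (s - t) m (λ e → s≢t (sub≡0⇒≡ e)) 1≢0)
                  (⇓-unique (⇓-cong (≈-sym e) (⇓-⊛ {u = (s - t) ℤ.^ m} {v = v} (⇓-^ m (⇓-lin t)) q⇓v))
                    (⇓-≡ (≡⇒mod (zero* s w)) (⇓-⊛ {u = s - s} {v = w} (⇓-lin s) f⇓w)))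
          q′ , pq′ , e′ = factor (⇓-≡ v≡0 q⇓v)
      in root q′ pq′ (lin-cancel s f (lin t ^ m ⊛ q′) s≢0 (≈-trans e (≈-trans (*-congˡ e′)
           (solve 3 (λ a b c → a :* (b :* c) := b :* (a :* c)) ≈-refl (lin t ^ m) (lin s) q′))))
      where
      open Solver
      zero* : ∀ x y → (x - x) * y ≡ 0ℤ
      zero* = solve-∀

    ⊛-≉0ʳ : ∀ {f g} → ¬ f ⊛ g ≈ const 0ℤ → ¬ g ≈ const 0ℤ
    ⊛-≉0ʳ {f} fg≉0 e = fg≉0 (≈-trans (*-congˡ e) (zeroʳ f))

    -- The powers of `lin s` are removed one at a time. Each lowers the degree bound by one and, by
    -- `RootOfOrder-cancel`, preserves the multiplicities at the other points, so that `root-count`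
    -- only has to add up.
    divide-out : ∀ k {n f s q} ss m → ¬ s ≡ 0ℤ [mod p ] → All (λ t → ¬ s ≡ t [mod p ]) ss →
      Poly q → f ≈ lin s ^ k ⊛ q → Deg n f → ¬ f ≈ const 0ℤ → All (λ t → RootOfOrder t m f) ss →
      ∃ λ n′ → (n ≡ k ℕ.+ n′) × Deg n′ q × (¬ q ≈ const 0ℤ) × All (λ t → RootOfOrder t m q) ss
    divide-out zero {n} {f} {s} {q} ss m s≢0 s≢ pq e d f≉0 rs =
      n , refl , Deg-cong f≈q d , (λ q≈0 → f≉0 (≈-trans f≈q q≈0)) ,
      All.map (RootOfOrder-cong f≈q) rs
      where
      f≈q : f ≈ q
      f≈q = ≈-trans e (*-identityˡ q)
    -- A factor `lin s` in degree 0: `Deg-quotient` with bound 0 makes the whole cofactor vanish,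
    -- against `f≉0`.
    divide-out (suc k) {zero} {f} {s} {q} ss m s≢0 s≢ pq e d f≉0 rs =
      ⊥-elim (⊛-≉0ʳ (λ z → f≉0 (≈-trans e′ z)) (coeffs λ { zero → low 0 ; (suc i) → low (suc i) }))
      where
      f₁ = lin s ^ k ⊛ q
      e′ : f ≈ lin s ⊛ f₁
      e′ = ≈-trans e (*-assoc (lin s) (lin s ^ k) q)
      low : ∀ i → f₁ ‼ i ≡ 0ℤ [mod p ]
      low i = Deg-quotient s f₁ (Poly-⊛ (Poly-lin^ s k) pq) 0 (λ i _ → vanish (Deg-cong e′ d) (suc i) (s≤s z≤n)) i z≤n
    divide-out (suc k) {suc n} {f} {s} {q} ss m s≢0 s≢ pq e d f≉0 rs =
      let n′ , eq , rest = divide-out k {n} {f₁} {s} {q} ss m s≢0 s≢ pq ≈-refl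
            (deg (Deg-quotient s f₁ pf₁ (suc n) (λ i n<i → vanish (Deg-cong e′ d) (suc i) (s≤s n<i))))
            (⊛-≉0ʳ (λ z → f≉0 (≈-trans e′ z)))
            (All.zipWith (λ (s≢t , r) → RootOfOrder-cancel s≢0 s≢t (RootOfOrder-cong e′ r) pf₁) (s≢ , rs))
      in n′ , cong suc eq , rest
      where
      f₁ = lin s ^ k ⊛ q
      pf₁ : Poly f₁
      pf₁ = Poly-⊛ (Poly-lin^ s k) pq
      e′ : f ≈ lin s ⊛ f₁
      e′ = ≈-trans e (*-assoc (lin s) (lin s ^ k) q)

    root-count : ∀ ss m {n f} → All (λ s → ¬ s ≡ 0ℤ [mod p ]) ss → AllPairs (λ s t → ¬ s ≡ t [mod p ]) ss →
      Deg n f → ¬ f ≈ const 0ℤ → All (λ s → RootOfOrder s m f) ss → length ss ℕ.* m ≤ n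
    root-count [] m _ _ d f≉0 rs = z≤n
    root-count (s ∷ ss) m (s≢0 ∷ ss≢0) (s≢ ∷ ss≢) d f≉0 (root q pq e ∷ rs)
      with divide-out m ss m s≢0 s≢ pq e d f≉0 rs
    ... | n′ , refl , d′ , q≉0 , rs′ = ℕ.+-monoʳ-≤ m (root-count ss m ss≢0 ss≢ d′ q≉0 rs′)

    pos≢0 : ∀ {k} → 0 < k → k < p → ¬ + k ≡ 0ℤ [mod p ]
    pos≢0 {suc k} _ k<p e = ℕ.<⇒≱ k<p (ℕ∣.∣⇒≤ (mod⇒∣ e))

    residue-≤ : ∀ {a b} → a ≤ b → b < p → + a ≡ + b [mod p ] → a ≡ b
    residue-≤ {a} {b} a≤b b<p e with b ℕ.∸ a in eq
    ... | zero  = ℕ.≤-antisym a≤b (ℕ.m∸n≡0⇒m≤n eq)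
    ... | suc k = ⊥-elim (pos≢0 {suc k} (s≤s z≤n) (ℕ.≤-<-trans (subst (_≤ b) eq (ℕ.m∸n≤m b a)) b<p)
        (mod-trans (≡⇒mod (sym diff)) (≡⇒sub≡0 (mod-sym e))))
      where
      diff : + b - + a ≡ + suc k
      diff = trans (ℤ.m-n≡m⊖n b a) (trans (ℤ.⊖-≥ a≤b) (cong +_ eq))

    residue-injective : ∀ {a b} → a < p → b < p → + a ≡ + b [mod p ] → a ≡ b
    residue-injective {a} {b} a<p b<p e with ℕ.≤-total a b
    ... | inj₁ a≤b = residue-≤ a≤b b<p e
    ... | inj₂ b≤a = sym (residue-≤ b≤a a<p (mod-sym e))

  -- Finite sums and the derivation θ = X (X + h) d/dX

  euler : Series → Series
  euler f ‼ i = + i * f ‼ i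

  euler-tail : ∀ f → tail (euler f) ≗ euler (tail f) ⊕ tail f
  euler-tail f i = lem (+ i) (f ‼ suc i)
    where
    lem : ∀ i a → (1ℤ + i) * a ≡ i * a + a
    lem = solve-∀

  euler-⊛ : ∀ f g → euler (f ⊛ g) ≗ euler f ⊛ g ⊕ f ⊛ euler g
  euler-⊛ f g zero = lem (f ‼ 0) (g ‼ 0)
    where
    lem : ∀ a b → 0ℤ * (a * b) ≡ 0ℤ * a * b + a * (0ℤ * b)
    lem = solve-∀
  euler-⊛ f g (suc i) = trans
    (lem₁ (+ i) (f ‼ 0) (g ‼ suc i) ((tail f ⊛ g) ‼ i))
    (trans (cong (λ z → (1ℤ + + i) * (f ‼ 0 * g ‼ suc i) + (z + (tail f ⊛ g) ‼ i)) (euler-⊛ (tail f) g i))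
    (trans (lem₂ (+ i) (f ‼ 0) (g ‼ suc i) ((tail f ⊛ g) ‼ i) ((euler (tail f) ⊛ g) ‼ i) ((tail f ⊛ euler g) ‼ i))
      (cong (λ z → 0ℤ * f ‼ 0 * g ‼ suc i + z + (f ‼ 0 * ((1ℤ + + i) * g ‼ suc i) + (tail f ⊛ euler g) ‼ i))
        (sym (trans (⊛-cong≗ (euler-tail f) (λ _ → refl) i) (⊛-distribʳ g (euler (tail f)) (tail f) i))))))
    where
    lem₁ : ∀ i a b x → (1ℤ + i) * (a * b + x) ≡ (1ℤ + i) * (a * b) + (i * x + x)
    lem₁ = solve-∀
    lem₂ : ∀ i a b x y z → (1ℤ + i) * (a * b) + (y + z + x) ≡ 0ℤ * a * b + (y + x) + (a * ((1ℤ + i) * b) + z)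
    lem₂ = solve-∀

  module Sums (n : ℕ) where
    open Ring n
    open Polynomial n

    Σ : ℕ → (ℕ → Series) → Series
    Σ zero    F = const 0ℤ
    Σ (suc k) F = F 0 ⊕ Σ k (λ i → F (suc i))

    Σ-cong : ∀ k {F G} → (∀ i → i < k → F i ≈ G i) → Σ k F ≈ Σ k G
    Σ-cong zero    e = ≈-refl
    Σ-cong (suc k) e = +-cong (e 0 (s≤s z≤n)) (Σ-cong k (λ i i<k → e (suc i) (s≤s i<k)))

    Σ-zero : ∀ k {F} → (∀ i → i < k → F i ≈ const 0ℤ) → Σ k F ≈ const 0ℤ
    Σ-zero zero    e = ≈-refl
    Σ-zero (suc k) e = ≈-trans (+-cong (e 0 (s≤s z≤n)) (Σ-zero k (λ i i<k → e (suc i) (s≤s i<k)))) (+-identityˡ _)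

    Σ-⊕ : ∀ k F G → Σ k (λ i → F i ⊕ G i) ≈ Σ k F ⊕ Σ k G
    Σ-⊕ zero    F G = ≈-sym (+-identityˡ _)
    Σ-⊕ (suc k) F G = ≈-trans (+-congˡ (Σ-⊕ k _ _))
      (solve 4 (λ a b c d → a :+ b :+ (c :+ d) := a :+ c :+ (b :+ d)) ≈-refl (F 0) (G 0) _ _)
      where open Solver

    Σ-⊛ : ∀ k g F → g ⊛ Σ k F ≈ Σ k (λ i → g ⊛ F i)
    Σ-⊛ zero    g F = zeroʳ g
    Σ-⊛ (suc k) g F = ≈-trans (solve 3 (λ a b c → a :* (b :+ c) := a :* b :+ a :* c) ≈-refl g (F 0) _)
      (+-congˡ (Σ-⊛ k g _))
      where open Solver

    Σ-split : ∀ k l F → Σ (k ℕ.+ l) F ≈ Σ k F ⊕ Σ l (λ i → F (k ℕ.+ i))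
    Σ-split zero    l F = ≈-sym (+-identityˡ _)
    Σ-split (suc k) l F = ≈-trans (+-congˡ (Σ-split k l _)) (≈-sym (+-assoc _ _ _))

    Σ-flatten : ∀ k l F → Σ (k ℕ.* l) F ≈ Σ k (λ i → Σ l (λ j → F (i ℕ.* l ℕ.+ j)))
    Σ-flatten zero    l F = ≈-refl
    Σ-flatten (suc k) l F = ≈-trans (Σ-split l (k ℕ.* l) F) (+-congˡ (≈-trans (Σ-flatten k l _)
      (Σ-cong k λ i _ → Σ-cong l λ j _ → ≈-reflexive (cong F (sym (ℕ.+-assoc l (i ℕ.* l) j))))))

    Σ-last : ∀ k F → Σ (suc k) F ≈ Σ k F ⊕ F k
    Σ-last zero    F = solve 1 (λ a → a :+ con 0ℤ := con 0ℤ :+ a) ≈-refl (F 0)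
      where open Solver
    Σ-last (suc k) F = ≈-trans (+-congˡ (Σ-last k _)) (≈-sym (+-assoc _ _ _))

    -- Serves the differentiation of `Ψ ^ b`, which moves the exponent from `b` to `b - 1`; the two
    -- boundary terms vanish there.
    Σ-shift : ∀ k F → F 0 ≈ const 0ℤ → F k ≈ const 0ℤ → Σ k F ≈ Σ k (λ i → F (suc i))
    Σ-shift k F e₀ eₖ = begin
      Σ k F                          ≈⟨ +-identityʳ _ ⟨
      Σ k F ⊕ const 0ℤ               ≈⟨ +-congˡ eₖ ⟨
      Σ k F ⊕ F k                    ≈⟨ Σ-last k F ⟨
      F 0 ⊕ Σ k (λ i → F (suc i))    ≈⟨ +-congʳ e₀ ⟩
      const 0ℤ ⊕ Σ k (λ i → F (suc i)) ≈⟨ +-identityˡ _ ⟩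
      Σ k (λ i → F (suc i)) ∎
      where open SetoidReasoning setoid

    Σ-single : ∀ k j F → j < k → (∀ i → i < k → ¬ i ≡ j → F i ≈ const 0ℤ) → Σ k F ≈ F j
    Σ-single (suc k) zero    F _ e =
      ≈-trans (+-congˡ (Σ-zero k (λ i i<k → e (suc i) (s≤s i<k) λ ()))) (+-identityʳ _)
    Σ-single (suc k) (suc j) F (s≤s j<k) e =
      ≈-trans (+-cong (e 0 (s≤s z≤n) λ ()) (Σ-single k j _ j<k (λ i i<k i≢j → e (suc i) (s≤s i<k) λ { refl → i≢j refl })))
              (+-identityˡ _)

    comb₃ : ℕ → ℕ → ℕ → (ℕ → ℕ → ℕ → ℤ) → (ℕ → ℕ → ℕ → Series) → Series
    comb₃ C A B c F = Σ C λ k → Σ A λ a → Σ B λ b → const (c k a b) ⊛ F k a b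

    Deg-Σ : ∀ k {d F} → (∀ i → i < k → Deg d (F i)) → Deg d (Σ k F)
    Deg-Σ zero    e = Deg-mono z≤n (Deg-const 0ℤ)
    Deg-Σ (suc k) e = Deg-⊕ (e 0 (s≤s z≤n)) (Deg-Σ k (λ i i<k → e (suc i) (s≤s i<k)))

    infix 4 _~[_]_
    record _~[_]_ (f : Series) (s : ℤ) (g : Series) : Set where
      constructor agree
      field
        {common} : ℤ
        left     : f ⇓[ s ] common
        right    : g ⇓[ s ] common

    ~-⊕ : ∀ {s f f′ g g′} → f ~[ s ] f′ → g ~[ s ] g′ → f ⊕ g ~[ s ] f′ ⊕ g′
    ~-⊕ (agree p q) (agree p′ q′) = agree (⇓-⊕ p p′) (⇓-⊕ q q′)

    ~-⊛ : ∀ {s f f′ g g′} → f ~[ s ] f′ → g ~[ s ] g′ → f ⊛ g ~[ s ] f′ ⊛ g′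
    ~-⊛ (agree p q) (agree p′ q′) = agree (⇓-⊛ p p′) (⇓-⊛ q q′)

    ~-⊖ : ∀ {s f f′} → f ~[ s ] f′ → ⊖ f ~[ s ] ⊖ f′
    ~-⊖ (agree p q) = agree (⇓-⊖ p) (⇓-⊖ q)

    ~-^ : ∀ {s f f′} m → f ~[ s ] f′ → f ^ m ~[ s ] f′ ^ m
    ~-^ m (agree p q) = agree (⇓-^ m p) (⇓-^ m q)

    ~-const : ∀ {s} c → const c ~[ s ] const c
    ~-const c = agree (⇓-const c) (⇓-const c)

    ~-cong : ∀ {s f f′ g g′} → f ≈ f′ → g ≈ g′ → f ~[ s ] g → f′ ~[ s ] g′
    ~-cong e e′ (agree p q) = agree (⇓-cong e p) (⇓-cong e′ q)

    ~-Σ : ∀ k {s F G} → (∀ i → i < k → F i ~[ s ] G i) → Σ k F ~[ s ] Σ k G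
    ~-Σ zero    e = ~-const 0ℤ
    ~-Σ (suc k) e = ~-⊕ (e 0 (s≤s z≤n)) (~-Σ k (λ i i<k → e (suc i) (s≤s i<k)))

    -- Divisibility by `X ^ k` modulo `n`.
    record Ord (k : ℕ) (f : Series) : Set where
      constructor ord
      field low : ∀ i → i < k → f ‼ i ≡ 0ℤ [mod n ]
    open Ord public

    Ord-cong : ∀ {k f g} → f ≈ g → Ord k f → Ord k g
    Ord-cong e (ord o) = ord λ i i<k → mod-trans (mod-sym (at e i)) (o i i<k)

    Ord-⊕ : ∀ {k f g} → Ord k f → Ord k g → Ord k (f ⊕ g)
    Ord-⊕ (ord o) (ord o′) = ord λ i i<k → mod-+ (o i i<k) (o′ i i<k)

    Ord-⊛ : ∀ {k f} g → Ord k f → Ord k (f ⊛ g)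
    Ord-⊛ g o = ord (go g o)
      where
      *-≡0ˡ : ∀ {a} b → a ≡ 0ℤ [mod n ] → a * b ≡ 0ℤ [mod n ]
      *-≡0ˡ b a≡0 = mod-trans (mod-* a≡0 (mod-refl {a = b})) (≡⇒mod (ℤ.*-zeroˡ b))
      go : ∀ {k f} g → Ord k f → ∀ i → i < k → (f ⊛ g) ‼ i ≡ 0ℤ [mod n ]
      go g o zero    0<k = *-≡0ˡ (g ‼ 0) (low o 0 0<k)
      go {suc k} {f} g o (suc i) (s≤s i<k) =
        mod-+ (*-≡0ˡ (g ‼ suc i) (low o 0 (s≤s z≤n)))
              (go {k} {tail f} g (ord λ j j<k → low o (suc j) (s≤s j<k)) i i<k)

    Ord-mono : ∀ {k l f} → l ≤ k → Ord k f → Ord l f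
    Ord-mono l≤k (ord o) = ord λ i i<l → o i (ℕ.<-≤-trans i<l l≤k)

    Ord-X^ : ∀ k → Ord k (X ^ k)
    Ord-X^ zero    = ord λ i ()
    Ord-X^ (suc k) = ord λ
      { zero _ → ≡⇒mod (ℤ.*-zeroˡ ((X ^ k) ‼ 0))
      ; (suc i) (s≤s i<k) → mod-trans (≡⇒mod (X-⊛ (X ^ k) i)) (low (Ord-X^ k) i i<k) }

    Ord-X-cancel : ∀ {k f} → Ord (suc k) (X ⊛ f) → Ord k f
    Ord-X-cancel {k} {f} (ord o) = ord λ i i<k → mod-trans (≡⇒mod (sym (X-⊛ f i))) (o (suc i) (s≤s i<k))

    X^-cancel : ∀ k {f} → X ^ k ⊛ f ≈ const 0ℤ → f ≈ const 0ℤ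
    X^-cancel zero    {f} e = ≈-trans (≈-sym (*-identityˡ f)) e
    X^-cancel (suc k) {f} e = X^-cancel k (coeffs λ { zero → go 0 ; (suc i) → go (suc i) })
      where
      go : ∀ i → (X ^ k ⊛ f) ‼ i ≡ 0ℤ [mod n ]
      go i = mod-trans (≡⇒mod (sym (X-⊛ (X ^ k ⊛ f) i))) (at (≈-trans (≈-sym (*-assoc X (X ^ k) f)) e) (suc i))

  module Derivation (n : ℕ) (h : ℤ) where
    open Ring n
    open Polynomial n
    open Sums n

    t : Series
    t = X ⊕ const h

    -- The factor `X (X + h)` makes `θ` multiply powers of `X` and of `t` by simple polynomials and
    -- clears the denominator in the derivative of `Ψ`. The price is that the points `0` and `- h`
    -- must be avoided.
    θ : Series → Series
    θ f = t ⊛ euler f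

    euler-cong : ∀ {f g} → f ≈ g → euler f ≈ euler g
    euler-cong e = coeffs λ i → mod-* (mod-refl {a = + i}) (at e i)

    θ-cong : ∀ {f g} → f ≈ g → θ f ≈ θ g
    θ-cong e = *-congˡ (euler-cong e)

    θ-⊛ : ∀ f g → θ (f ⊛ g) ≈ θ f ⊛ g ⊕ f ⊛ θ g
    θ-⊛ f g = ≈-trans (*-congˡ (≗⇒≈ (euler-⊛ f g)))
      (solve 5 (λ t f g a b → t :* (a :* g :+ f :* b) := t :* a :* g :+ f :* (t :* b)) ≈-refl t f g (euler f) (euler g))
      where open Solver

    θ-⊕ : ∀ f g → θ (f ⊕ g) ≈ θ f ⊕ θ g
    θ-⊕ f g = ≈-trans (*-congˡ (≗⇒≈ {g = euler f ⊕ euler g} λ i → ℤ.*-distribˡ-+ (+ i) (f ‼ i) (g ‼ i)))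
      (solve 3 (λ t a b → t :* (a :+ b) := t :* a :+ t :* b) ≈-refl t (euler f) (euler g))
      where open Solver

    θ-const : ∀ c → θ (const c) ≈ const 0ℤ
    θ-const c = ≈-trans (*-congˡ (≗⇒≈ {g = const 0ℤ} λ { zero → ℤ.*-zeroˡ c ; (suc i) → ℤ.*-zeroʳ (+ suc i) })) (zeroʳ t)

    θ-const-⊛ : ∀ c f → θ (const c ⊛ f) ≈ const c ⊛ θ f
    θ-const-⊛ c f = ≈-trans (θ-⊛ (const c) f) (≈-trans (+-congʳ (≈-trans (*-congʳ (θ-const c)) (zeroˡ f))) (+-identityˡ _))

    euler-X : euler X ≗ X
    euler-X zero          = refl
    euler-X (suc zero)    = refl
    euler-X (suc (suc i)) = ℤ.*-zeroʳ (+ suc (suc i))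

    θ-X : θ X ≈ X ⊛ t
    θ-X = ≈-trans (*-congˡ (≗⇒≈ euler-X)) (*-comm t X)

    θ-t : θ t ≈ X ⊛ t
    θ-t = ≈-trans (θ-⊕ X (const h)) (≈-trans (+-cong θ-X (θ-const h)) (+-identityʳ _))

    θ-^ : ∀ f m → θ (f ^ suc m) ≈ const (+ suc m) ⊛ (f ^ m ⊛ θ f)
    θ-^ f zero = ≈-trans (θ-⊛ f (const 1ℤ)) (≈-trans (+-congˡ (*-congˡ (θ-const 1ℤ)))
      (solve 2 (λ f d → d :* con 1ℤ :+ f :* con 0ℤ := con 1ℤ :* (con 1ℤ :* d)) ≈-refl f (θ f)))
      where open Solver
    θ-^ f (suc m) = ≈-trans (θ-⊛ f (f ^ suc m)) (≈-trans (+-congˡ (*-congˡ (θ-^ f m)))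
      (≈-trans (solve 4 (λ c f a d → d :* (f :* a) :+ f :* (c :* (a :* d)) := (con 1ℤ :+ c) :* (f :* a :* d)) ≈-refl
         (const (+ suc m)) f (f ^ m) (θ f))
       (*-congʳ (≈-sym (const-+ 1ℤ (+ suc m))))))
      where open Solver

    θ-eigen-^ : ∀ {f e} m → θ f ≈ e ⊛ f → θ (f ^ m) ≈ const (+ m) ⊛ (e ⊛ f ^ m)
    θ-eigen-^ {f} {e} zero    _ = ≈-trans (θ-const 1ℤ) (≈-sym (zeroˡ _))
    θ-eigen-^ {f} {e} (suc m) p = ≈-trans (θ-^ f m) (*-congˡ (≈-trans (*-congˡ p)
      (solve 3 (λ a e f → a :* (e :* f) := e :* (f :* a)) ≈-refl (f ^ m) e f)))
      where open Solver

    Ord-θ : ∀ {k f} → Ord k f → Ord k (θ f)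
    Ord-θ {k} {f} (ord o) = Ord-cong (*-comm (euler f) t)
      (Ord-⊛ t (ord λ i i<k → mod-trans (mod-* (mod-refl {a = + i}) (o i i<k)) (≡⇒mod (ℤ.*-zeroʳ (+ i)))))

    t^-at-0 : ∀ m → (t ^ m) ‼ 0 ≡ h ℤ.^ m
    t^-at-0 zero    = refl
    t^-at-0 (suc m) = cong₂ _*_ (ℤ.+-identityˡ h) (t^-at-0 m)

    Deg-t : Deg 1 t
    Deg-t = Deg-⊕ Deg-X (Deg-mono z≤n (Deg-const h))

    Deg-θ : ∀ {k f} → Deg k f → Deg (suc k) (θ f)
    Deg-θ (deg d) = Deg-⊛ Deg-t (deg λ i k<i → mod-trans (mod-* (mod-refl {a = + i}) (d i k<i)) (≡⇒mod (ℤ.*-zeroʳ (+ i))))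

    iter : ℕ → Series → Series
    iter zero    f = f
    iter (suc m) f = iter m (θ f)

    iter-cong : ∀ m {f g} → f ≈ g → iter m f ≈ iter m g
    iter-cong zero    e = e
    iter-cong (suc m) e = iter-cong m (θ-cong e)

    iter-⊕ : ∀ m f g → iter m (f ⊕ g) ≈ iter m f ⊕ iter m g
    iter-⊕ zero    f g = ≈-refl
    iter-⊕ (suc m) f g = ≈-trans (iter-cong m (θ-⊕ f g)) (iter-⊕ m (θ f) (θ g))

    iter-const-⊛ : ∀ m c f → iter m (const c ⊛ f) ≈ const c ⊛ iter m f
    iter-const-⊛ zero    c f = ≈-refl
    iter-const-⊛ (suc m) c f = ≈-trans (iter-cong m (θ-const-⊛ c f)) (iter-const-⊛ m c (θ f))

    iter-⊖ : ∀ m f → iter m (⊖ f) ≈ ⊖ iter m f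
    iter-⊖ m f = ≈-trans (iter-cong m (≈-sym (neg f))) (≈-trans (iter-const-⊛ m (- 1ℤ) f) (neg (iter m f)))
      where
      open Solver
      neg : ∀ f → const (- 1ℤ) ⊛ f ≈ ⊖ f
      neg = solve 1 (λ f → con (- 1ℤ) :* f := :- f) ≈-refl

    iter-0 : ∀ m → iter m (const 0ℤ) ≈ const 0ℤ
    iter-0 zero    = ≈-refl
    iter-0 (suc m) = ≈-trans (iter-cong m (θ-const 0ℤ)) (iter-0 m)

    iter-Σ : ∀ m k F → iter m (Σ k F) ≈ Σ k (λ i → iter m (F i))
    iter-Σ m zero    F = iter-0 m
    iter-Σ m (suc k) F = ≈-trans (iter-⊕ m _ _) (+-congˡ (iter-Σ m k _))

  -- Multiplicities, and independence of the monomials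

  module Multiplicity (p : ℕ) (pp : Prime p) (h : ℤ) where
    open Ring p
    open Polynomial p
    open PrimeField p pp
    open Sums p
    open Derivation p h

    θ-lin : ∀ s → θ (lin s) ≈ X ⊛ t
    θ-lin s = ≈-trans (θ-⊕ X (const (- s))) (≈-trans (+-cong θ-X (θ-const (- s))) (+-identityʳ _))

    lin^-cancel : ∀ s k f g → ¬ s ≡ 0ℤ [mod p ] → lin s ^ k ⊛ f ≈ lin s ^ k ⊛ g → f ≈ g
    lin^-cancel s zero    f g s≢0 e = ≈-trans (≈-sym (*-identityˡ f)) (≈-trans e (*-identityˡ g))
    lin^-cancel s (suc k) f g s≢0 e = lin^-cancel s k f g s≢0 (lin-cancel s _ _ s≢0
      (≈-trans (≈-sym (*-assoc (lin s) (lin s ^ k) f)) (≈-trans e (*-assoc (lin s) (lin s ^ k) g))))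

    -- By induction `f` and `θ f` are both divisible by `lin s ^ m`, with cofactors `q` and `r`. The
    -- product rule gives `m X (X + h) q = lin s (r - θ q)`. At `s` the factor `m s (s + h)` is
    -- nonzero because `0 < m < p`, so `s` is a root of `q` and one more power comes out.
    order-from-derivatives : ∀ {s} m → m ≤ p → ¬ s ≡ 0ℤ [mod p ] → ¬ s + h ≡ 0ℤ [mod p ] →
      ∀ {f} → Poly f → (∀ i → i < m → iter i f ⇓[ s ] 0ℤ) → RootOfOrder s m f
    order-from-derivatives zero _ _ _ {f} pf _ = root f pf (≈-sym (*-identityˡ f))
    order-from-derivatives {s} (suc zero) _ _ _ {f} pf z =
      let q , pq , e = factor (z 0 (s≤s z≤n))
      in root q pq (≈-trans e (*-congʳ (≈-sym (*-identityʳ (lin s)))))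
    order-from-derivatives {s} (suc m@(suc m′)) m<p s≢0 s+h≢0 {f} pf@(_ , df) z =
      let root q pq e = order-from-derivatives m (ℕ.<⇒≤ m<p) s≢0 s+h≢0 pf (λ i i<m → z i (ℕ.m≤n⇒m≤1+n i<m))
          root r pr e′ = order-from-derivatives m (ℕ.<⇒≤ m<p) s≢0 s+h≢0 {θ f} (_ , Deg-θ df)
                           (λ i i<m → z (suc i) (s≤s i<m))
          key = lin^-cancel s m′ _ _ s≢0 (θ-identity q r e e′)
          v , q⇓v = Poly⇒⇓ {s = s} pq
          a , θq⇓a = Poly⇒⇓ {s = s} (_ , Deg-θ (proj₂ pq))
          b , r⇓b = Poly⇒⇓ {s = s} pr
          c = + m * (s * (s + h))
          cv≡0 = ⇓-unique
            (⇓-⊛ {u = c} {v = v} (⇓-⊛ {u = + m} {v = s * (s + h)} (⇓-const (+ m))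
              (⇓-⊛ {u = s} {v = s + h} ⇓-X (⇓-⊕ {u = s} {v = h} ⇓-X (⇓-const h)))) q⇓v)
            (⇓-≡ (≡⇒mod (zero* s (b + - a)))
              (⇓-cong (≈-sym key) (⇓-⊛ {u = s - s} {v = b + - a} (⇓-lin s) (⇓-⊕ {v = - a} r⇓b (⇓-⊖ θq⇓a)))))
          v≡0 = *-cancel-0 c v (c≢0 c refl) cv≡0
          q′ , pq′ , e″ = factor (⇓-≡ v≡0 q⇓v)
      in root q′ pq′ (≈-trans e (≈-trans (*-congˡ e″)
           (solve 3 (λ a b c → a :* (b :* c) := b :* a :* c) ≈-refl (lin s ^ m) (lin s) q′)))
      where
      open Solver
      zero* : ∀ x y → (x - x) * y ≡ 0ℤ
      zero* = solve-∀
      c≢0 : ∀ c → c ≡ + m * (s * (s + h)) → ¬ c ≡ 0ℤ [mod p ]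
      c≢0 c refl e = s+h≢0 (*-cancel-0 s (s + h) s≢0
        (*-cancel-0 (+ m) (s * (s + h)) (pos≢0 (s≤s z≤n) m<p) e))
      θ-identity : ∀ q r → f ≈ lin s ^ m ⊛ q → θ f ≈ lin s ^ m ⊛ r →
        lin s ^ m′ ⊛ (const (+ m) ⊛ (X ⊛ t) ⊛ q) ≈ lin s ^ m′ ⊛ (lin s ⊛ (r ⊕ ⊖ θ q))
      θ-identity q r e e′ = begin
        lin s ^ m′ ⊛ (const (+ m) ⊛ (X ⊛ t) ⊛ q)
          ≈⟨ solve 5 (λ L c x q d → L :* (c :* x :* q) := c :* (L :* x) :* q :+ d :+ :- d) ≈-refl
               (lin s ^ m′) (const (+ m)) (X ⊛ t) q (lin s ^ m ⊛ θ q) ⟩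
        const (+ m) ⊛ (lin s ^ m′ ⊛ (X ⊛ t)) ⊛ q ⊕ lin s ^ m ⊛ θ q ⊕ ⊖ (lin s ^ m ⊛ θ q)
          ≈⟨ +-congʳ (≈-trans (+-congʳ (*-congʳ (≈-sym
                (≈-trans (θ-^ (lin s) m′) (*-congˡ (*-congˡ (θ-lin s))))))) (≈-sym (θ-⊛ (lin s ^ m) q))) ⟩
        θ (lin s ^ m ⊛ q) ⊕ ⊖ (lin s ^ m ⊛ θ q)
          ≈⟨ +-congʳ (≈-trans (θ-cong (≈-sym e)) e′) ⟩
        lin s ^ m ⊛ r ⊕ ⊖ (lin s ^ m ⊛ θ q)
          ≈⟨ solve 4 (λ l L r d → l :* L :* r :+ :- (l :* L :* d) := L :* (l :* (r :+ :- d))) ≈-refl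
               (lin s) (lin s ^ m′) r (θ q) ⟩
        lin s ^ m′ ⊛ (lin s ⊛ (r ⊕ ⊖ θ q)) ∎
        where open SetoidReasoning setoid

  module Independence (p : ℕ) (pp : Prime p) (h : ℤ) (h≢0 : ¬ h ≡ 0ℤ [mod p ]) (Ψ : Series)
    (θ-Ψ : Ring._≈_ p (Derivation.θ p h Ψ) (const h ⊛ (X ⊕ ⊖ (X ^ p)))) where
    open Ring p
    open Derivation p h
    open Polynomial p
    open PrimeField p pp
    open Sums p

    Z : Series
    Z = X ^ p

    θ-t^ : ∀ a → θ (t ^ a) ≈ const (+ a) ⊛ (X ⊛ t ^ a)
    θ-t^ a = θ-eigen-^ a θ-t

    θ-Ψ^ : ∀ b → θ (Ψ ^ b) ≈ const (+ b * h) ⊛ ((X ⊕ ⊖ Z) ⊛ Ψ ^ ℕ.pred b)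
    θ-Ψ^ zero    = ≈-trans (θ-const 1ℤ) (≈-sym (≈-trans (*-congʳ (const-cong (≡⇒mod (ℤ.*-zeroˡ h)))) (zeroˡ _)))
    θ-Ψ^ (suc b) = ≈-trans (θ-^ Ψ b) (≈-trans (*-congˡ (*-congˡ θ-Ψ))
      (≈-trans (solve 4 (λ c P h x → c :* (P :* (h :* x)) := c :* h :* (x :* P)) ≈-refl
          (const (+ suc b)) (Ψ ^ b) (const h) (X ⊕ ⊖ Z))
        (*-congʳ (≈-sym (const-* (+ suc b) h)))))
      where open Solver

    θ-t^Ψ^ : ∀ a b → θ (t ^ a ⊛ Ψ ^ b) ≈
      const (+ a) ⊛ (X ⊛ (t ^ a ⊛ Ψ ^ b)) ⊕ const (+ b * h) ⊛ ((X ⊕ ⊖ Z) ⊛ (t ^ a ⊛ Ψ ^ ℕ.pred b))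
    θ-t^Ψ^ a b = ≈-trans (θ-⊛ (t ^ a) (Ψ ^ b)) (≈-trans (+-cong (*-congʳ (θ-t^ a)) (*-congˡ (θ-Ψ^ b)))
      (solve 7 (λ A x T P B d Q → A :* (x :* T) :* P :+ T :* (B :* (d :* Q))
                                := A :* (x :* (T :* P)) :+ B :* (d :* (T :* Q))) ≈-refl
         (const (+ a)) X (t ^ a) (Ψ ^ b) (const (+ b * h)) (X ⊕ ⊖ Z) (Ψ ^ ℕ.pred b)))
      where open Solver

    -- In the variable `v = log (X + h)` the operator `(X + h) d/dX` is `d/dv`. Modulo `X ^ p` these
    -- combinations act as exponential polynomials in `v` with frequencies `a < A` and degree below
    -- `B`, and `lower K` is `d/dv - K` on their coefficients.
    comb₂ : ℕ → ℕ → (ℕ → ℕ → ℤ) → Series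
    comb₂ A B c = Σ A λ a → Σ B λ b → const (c a b) ⊛ (t ^ a ⊛ Ψ ^ b)

    comb₂-zero : ∀ A B c → (∀ a b → a < A → c a b ≡ 0ℤ [mod p ]) → comb₂ A B c ≈ const 0ℤ
    comb₂-zero A B c e = Σ-zero A λ a a<A → Σ-zero B λ b _ → ≈-trans (*-congʳ (const-cong (e a b a<A))) (zeroˡ _)

    -- The coefficients of (θ - K X) applied to comb₂, divided by X, modulo X ^ (p - 1).
    lower : ℕ → (ℕ → ℕ → ℤ) → ℕ → ℕ → ℤ
    lower K c a b = (+ a - + K) * c a b + + suc b * h * c a (suc b)

    -- On column `a`, `θ` contributes `a X` from `t ^ a` and, after reindexing, the entry at height
    -- `b + 1` from `Ψ ^ b`; the condition at height `B` closes the reindexing at the top. The part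
    -- of `θ Ψ` that contains `Z` is collected in the last summand, to be dropped modulo `X ^ p`.
    lower-row : ∀ B K c a → c a B ≡ 0ℤ [mod p ] →
      X ⊛ Σ B (λ b → const (lower K c a b) ⊛ (t ^ a ⊛ Ψ ^ b)) ≈
      Σ B (λ b → θ (const (c a b) ⊛ (t ^ a ⊛ Ψ ^ b)))
        ⊕ const (- + K) ⊛ (X ⊛ Σ B (λ b → const (c a b) ⊛ (t ^ a ⊛ Ψ ^ b)))
        ⊕ Z ⊛ Σ B (λ b → const (+ b * h * c a b) ⊛ (t ^ a ⊛ Ψ ^ ℕ.pred b))
    lower-row B K c a cB≡0 = begin
      X ⊛ Σ B (λ b → const (lower K c a b) ⊛ M b)
        ≈⟨ *-congˡ (Σ-cong B λ b _ → expand b) ⟩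
      X ⊛ Σ B (λ b → const (+ a) ⊛ (const (c a b) ⊛ M b) ⊕ const (- + K) ⊛ (const (c a b) ⊛ M b) ⊕ D (suc b))
        ≈⟨ *-congˡ (≈-trans (Σ-⊕ B _ _) (+-cong (Σ-⊕ B _ _) (≈-sym (Σ-shift B D D0 DB)))) ⟩
      X ⊛ (Σ B (λ b → const (+ a) ⊛ (const (c a b) ⊛ M b)) ⊕ Σ B (λ b → const (- + K) ⊛ (const (c a b) ⊛ M b)) ⊕ Σ B D)
        ≈⟨ *-congˡ (+-congʳ (+-cong (≈-sym (Σ-⊛ B _ _)) (≈-sym (Σ-⊛ B _ _)))) ⟩
      X ⊛ (const (+ a) ⊛ S ⊕ const (- + K) ⊛ S ⊕ Σ B D)
        ≈⟨ solve 6 (λ x a s k d z → x :* (a :* s :+ k :* s :+ d) :=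
              (a :* (x :* s) :+ (x :+ :- z) :* d) :+ k :* (x :* s) :+ z :* d) ≈-refl
              X (const (+ a)) S (const (- + K)) (Σ B D) Z ⟩
      const (+ a) ⊛ (X ⊛ S) ⊕ (X ⊕ ⊖ Z) ⊛ Σ B D ⊕ const (- + K) ⊛ (X ⊛ S) ⊕ Z ⊛ Σ B D
        ≈⟨ +-congʳ (+-congʳ (≈-sym θ-row)) ⟩
      Σ B (λ b → θ (const (c a b) ⊛ M b)) ⊕ const (- + K) ⊛ (X ⊛ S) ⊕ Z ⊛ Σ B D ∎
      where
      open SetoidReasoning setoid
      open Solver
      M : ℕ → Series
      M b = t ^ a ⊛ Ψ ^ b
      D : ℕ → Series
      D b = const (+ b * h * c a b) ⊛ (t ^ a ⊛ Ψ ^ ℕ.pred b)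
      S : Series
      S = Σ B (λ b → const (c a b) ⊛ M b)
      D0 : D 0 ≈ const 0ℤ
      D0 = ≈-trans (*-congʳ (const-cong (≡⇒mod (trans (cong (_* c a 0) (ℤ.*-zeroˡ h)) (ℤ.*-zeroˡ (c a 0)))))) (zeroˡ _)
      DB : D B ≈ const 0ℤ
      DB = ≈-trans (*-congʳ (const-cong (mod-trans (mod-* (mod-refl {a = + B * h}) cB≡0) (≡⇒mod (ℤ.*-zeroʳ (+ B * h)))))) (zeroˡ _)
      expand : ∀ b → const (lower K c a b) ⊛ M b ≈
        const (+ a) ⊛ (const (c a b) ⊛ M b) ⊕ const (- + K) ⊛ (const (c a b) ⊛ M b) ⊕ D (suc b)
      expand b = ≈-trans
        (*-congʳ (≈-trans (const-+ _ _) (+-congʳ (≈-trans (const-* _ _) (*-congʳ (const-+ _ _))))))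
        (solve 5 (λ a k c d m → ((a :+ k) :* c :+ d) :* m := a :* (c :* m) :+ k :* (c :* m) :+ d :* m) ≈-refl
           (const (+ a)) (const (- + K)) (const (c a b)) (const (+ suc b * h * c a (suc b))) (M b))
      term : ∀ b → θ (const (c a b) ⊛ M b) ≈ (const (+ a) ⊛ X) ⊛ (const (c a b) ⊛ M b) ⊕ (X ⊕ ⊖ Z) ⊛ D b
      term b = ≈-trans (θ-const-⊛ (c a b) (M b)) (≈-trans (*-congˡ (θ-t^Ψ^ a b))
        (≈-trans (solve 7 (λ c a x m b z q → c :* (a :* (x :* m) :+ b :* (z :* q)) := a :* x :* (c :* m) :+ z :* (b :* c :* q)) ≈-refl
            (const (c a b)) (const (+ a)) X (M b) (const (+ b * h)) (X ⊕ ⊖ Z) (t ^ a ⊛ Ψ ^ ℕ.pred b))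
          (+-congˡ (*-congˡ (*-congʳ (≈-sym (const-* (+ b * h) (c a b))))))))
      θ-row : Σ B (λ b → θ (const (c a b) ⊛ M b)) ≈ const (+ a) ⊛ (X ⊛ S) ⊕ (X ⊕ ⊖ Z) ⊛ Σ B D
      θ-row = ≈-trans (Σ-cong B λ b _ → term b) (≈-trans (Σ-⊕ B _ _)
        (+-cong (≈-trans (≈-sym (Σ-⊛ B _ _)) (*-assoc _ _ _)) (≈-sym (Σ-⊛ B _ _))))

    lower-comb₂ : ∀ A B K c → (∀ a → c a B ≡ 0ℤ [mod p ]) → ∃ λ W →
      X ⊛ comb₂ A B (lower K c) ≈ θ (comb₂ A B c) ⊕ const (- + K) ⊛ (X ⊛ comb₂ A B c) ⊕ Z ⊛ W
    lower-comb₂ A B K c cB≡0 = Σ A W , (begin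
      X ⊛ Σ A (λ a → Σ B (λ b → const (lower K c a b) ⊛ M a b))
        ≈⟨ Σ-⊛ A X _ ⟩
      Σ A (λ a → X ⊛ Σ B (λ b → const (lower K c a b) ⊛ M a b))
        ≈⟨ Σ-cong A (λ a _ → lower-row B K c a (cB≡0 a)) ⟩
      Σ A (λ a → Σ B (λ b → θ (const (c a b) ⊛ M a b)) ⊕ const (- + K) ⊛ (X ⊛ S a) ⊕ Z ⊛ W a)
        ≈⟨ ≈-trans (Σ-⊕ A _ _) (+-congʳ (Σ-⊕ A _ _)) ⟩
      Σ A (λ a → Σ B (λ b → θ (const (c a b) ⊛ M a b))) ⊕ Σ A (λ a → const (- + K) ⊛ (X ⊛ S a)) ⊕ Σ A (λ a → Z ⊛ W a)
        ≈⟨ +-cong (+-cong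
             (≈-trans (Σ-cong A λ a _ → ≈-sym (iter-Σ 1 B _)) (≈-sym (iter-Σ 1 A _)))
             (≈-trans (≈-sym (Σ-⊛ A _ _)) (*-congˡ (≈-sym (Σ-⊛ A _ _)))))
             (≈-sym (Σ-⊛ A _ _)) ⟩
      θ (Σ A S) ⊕ const (- + K) ⊛ (X ⊛ Σ A S) ⊕ Z ⊛ Σ A W ∎)
      where
      open SetoidReasoning setoid
      M : ℕ → ℕ → Series
      M a b = t ^ a ⊛ Ψ ^ b
      S W : ℕ → Series
      S a = Σ B (λ b → const (c a b) ⊛ M a b)
      W a = Σ B (λ b → const (+ b * h * c a b) ⊛ (t ^ a ⊛ Ψ ^ ℕ.pred b))

    -- `θ` and multiplication by `X` do not decrease the order, and the error term is divisible by
    -- `X ^ p`; only the division by `X` costs one.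
    Ord-lower : ∀ {n} A B K c → (∀ a → c a B ≡ 0ℤ [mod p ]) → suc n ≤ p →
      Ord (suc n) (comb₂ A B c) → Ord n (comb₂ A B (lower K c))
    Ord-lower A B K c cB≡0 n<p o =
      let W , e = lower-comb₂ A B K c cB≡0
      in Ord-X-cancel (Ord-cong (≈-sym e) (Ord-⊕ (Ord-⊕ (Ord-θ o)
           (Ord-cong (solve 3 (λ k x f → f :* (k :* x) := k :* (x :* f)) ≈-refl (const (- + K)) X (comb₂ A B c))
             (Ord-⊛ (const (- + K) ⊛ X) o)))
           (Ord-⊛ W (Ord-mono n<p (Ord-X^ p)))))
      where open Solver

    -- The conditions on c say that its support consists of the columns a < K, of height at most B,
    -- and the column a = K, of height at most y; lower K shortens the last column by one.
    independent₂ : ∀ A B K y n c → A ≤ p → B ≤ p → n ≤ p → K < A → y ≤ B → K ℕ.* B ℕ.+ y ≤ n →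
      (∀ a b → B ≤ b → c a b ≡ 0ℤ [mod p ]) →
      (∀ a b → K < a → c a b ≡ 0ℤ [mod p ]) →
      (∀ b → y ≤ b → c K b ≡ 0ℤ [mod p ]) →
      Ord n (comb₂ A B c) → ∀ a b → a < A → c a b ≡ 0ℤ [mod p ]
    independent₂ A B zero zero n c _ _ _ _ _ _ _ right top _ zero    b _ = top b z≤n
    independent₂ A B zero zero n c _ _ _ _ _ _ _ right top _ (suc a) b _ = right (suc a) b (s≤s z≤n)
    -- Column `suc K` is empty, so column `K`, at full height `B`, takes over as the last one.
    independent₂ A B (suc K) zero n c A≤p B≤p n≤p K<A _ size high right top o =
      independent₂ A B K B n c A≤p B≤p n≤p (ℕ.<-trans (ℕ.n<1+n K) K<A) ℕ.≤-refl
        (subst (_≤ n) (trans (ℕ.+-identityʳ _) (ℕ.+-comm B (K ℕ.* B))) size) high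
        (λ a b K<a → split a b (ℕ.m≤n⇒m<n∨m≡n K<a)) (high K) o
      where
      split : ∀ a b → suc K < a ⊎ suc K ≡ a → c a b ≡ 0ℤ [mod p ]
      split a b (inj₁ K<a)  = right a b K<a
      split a b (inj₂ refl) = top b z≤n
    independent₂ A B K (suc y) zero c _ _ _ _ _ size _ _ _ _ a b _ with subst (_≤ 0) (ℕ.+-suc (K ℕ.* B) y) size
    ... | ()
    independent₂ A B K (suc y) (suc n) c A≤p B≤p n≤p K<A y<B size high right top o = result
      where
      *-≡0 : ∀ x {y} → y ≡ 0ℤ [mod p ] → x * y ≡ 0ℤ [mod p ]
      *-≡0 x y≡0 = mod-trans (mod-* (mod-refl {a = x}) y≡0) (≡⇒mod (ℤ.*-zeroʳ x))
      lower-≡0 : ∀ a b → (+ a - + K) * c a b ≡ 0ℤ [mod p ] → c a (suc b) ≡ 0ℤ [mod p ] → lower K c a b ≡ 0ℤ [mod p ]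
      lower-≡0 a b e e′ = mod-+ e (*-≡0 (+ suc b * h) e′)
      K-K≡0 : ∀ x → (+ K - + K) * x ≡ 0ℤ
      K-K≡0 x = lem (+ K) x
        where
        lem : ∀ k x → (k - k) * x ≡ 0ℤ
        lem = solve-∀

      lowered : ∀ a b → a < A → lower K c a b ≡ 0ℤ [mod p ]
      lowered = independent₂ A B K y n (lower K c) A≤p B≤p (ℕ.<⇒≤ n≤p) K<A (ℕ.<⇒≤ y<B)
        (s≤s⁻¹ (subst (_≤ suc n) (ℕ.+-suc (K ℕ.* B) y) size))
        (λ a b B≤b → lower-≡0 a b (*-≡0 (+ a - + K) (high a b B≤b)) (high a (suc b) (ℕ.m≤n⇒m≤1+n B≤b)))
        (λ a b K<a → lower-≡0 a b (*-≡0 (+ a - + K) (right a b K<a)) (right a (suc b) K<a))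
        (λ b y≤b → lower-≡0 K b (≡⇒mod (K-K≡0 (c K b))) (top (suc b) (s≤s y≤b)))
        (Ord-lower A B K c (λ a → high a B ℕ.≤-refl) n≤p o)

      a-K≢0 : ∀ a → a < A → ¬ a ≡ K → ¬ + a - + K ≡ 0ℤ [mod p ]
      a-K≢0 a a<A a≢K e = a≢K (residue-injective (ℕ.<-≤-trans a<A A≤p) (ℕ.<-≤-trans K<A A≤p) (sub≡0⇒≡ e))

      -- For `a ≠ K` the relation `lower K c a b ≡ 0` determines `c a b` from `c a (suc b)`, as
      -- `a - K` is invertible. The column is cleared from height `B` downwards, with `j` bounding
      -- the remaining distance.
      other-columns : ∀ a → a < A → ¬ a ≡ K → ∀ j b → B ≤ b ℕ.+ j → c a b ≡ 0ℤ [mod p ]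
      other-columns a a<A a≢K zero    b B≤b = high a b (subst (B ≤_) (ℕ.+-identityʳ b) B≤b)
      other-columns a a<A a≢K (suc j) b B≤b+j = *-cancel-0 (+ a - + K) (c a b) (a-K≢0 a a<A a≢K)
        (mod-trans (≡⇒mod (lem ((+ a - + K) * c a b) (+ suc b * h) (c a (suc b))))
          (mod-+ (lowered a b a<A) (mod-neg (*-≡0 (+ suc b * h)
            (other-columns a a<A a≢K j (suc b) (subst (B ≤_) (ℕ.+-suc b j) B≤b+j))))))
        where
        lem : ∀ x y z → x ≡ x + y * z - y * z
        lem = solve-∀

      -- In column `K` the diagonal term drops out, leaving `(b + 1) h c K (b + 1)`, whose numerical
      -- factor is invertible because `b + 1 < B ≤ p`. The entry at height 0 escapes and is left to
      -- `corner`.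
      last-column : ∀ b → c K (suc b) ≡ 0ℤ [mod p ]
      last-column b with B ℕ.≤? suc b
      ... | yes B≤b = high K (suc b) B≤b
      ... | no  B≰b = *-cancel-0 h (c K (suc b)) h≢0 (*-cancel-0 (+ suc b) (h * c K (suc b))
        (pos≢0 (s≤s z≤n) (ℕ.<-≤-trans (ℕ.≰⇒> B≰b) B≤p))
        (mod-trans (≡⇒mod (trans (sym (ℤ.*-assoc (+ suc b) h (c K (suc b))))
            (lem (+ K) (c K b) (+ suc b * h * c K (suc b))))) (lowered K b K<A)))
        where
        lem : ∀ k x y → y ≡ (k - k) * x + y
        lem = solve-∀

      vanishing-term : ∀ {x} f → x ≡ 0ℤ [mod p ] → const x ⊛ f ≈ const 0ℤ
      vanishing-term f e = ≈-trans (*-congʳ (const-cong e)) (zeroˡ f)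

      -- Only `c K 0` times `t ^ K` is left of the combination. Its constant term is `c K 0` times
      -- `h ^ K`, and it vanishes because the order is at least one.
      corner : c K 0 ≡ 0ℤ [mod p ]
      corner = *-cancel-0 (h ℤ.^ K) (c K 0) (^-≢0 h K h≢0 1≢0) (mod-trans (≡⇒mod (sym at-0))
        (mod-trans (mod-sym (at collapse 0)) (low o 0 (s≤s z≤n))))
        where
        collapse : comb₂ A B c ≈ const (c K 0) ⊛ (t ^ K ⊛ Ψ ^ 0)
        collapse = ≈-trans
          (Σ-single A K _ K<A (λ a a<A a≢K → Σ-zero B λ b _ → vanishing-term _ (other-columns a a<A a≢K B b (ℕ.m≤n+m B b))))
          (Σ-single B 0 _ (ℕ.≤-<-trans z≤n y<B) (λ { zero _ b≢0 → ⊥-elim (b≢0 refl) ; (suc b) _ _ → vanishing-term _ (last-column b) }))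
        at-0 : (const (c K 0) ⊛ (t ^ K ⊛ Ψ ^ 0)) ‼ 0 ≡ h ℤ.^ K * c K 0
        at-0 = trans (cong (λ z → c K 0 * (z * 1ℤ)) (t^-at-0 K)) (lem (c K 0) (h ℤ.^ K))
          where
          lem : ∀ x y → x * (y * 1ℤ) ≡ y * x
          lem = solve-∀

      result : ∀ a b → a < A → c a b ≡ 0ℤ [mod p ]
      result a b a<A with a ℕ.≟ K
      ... | no a≢K = other-columns a a<A a≢K B b (ℕ.m≤n+m B b)
      result a zero    a<A | yes refl = corner
      result a (suc b) a<A | yes refl = last-column b

    monomial : ℕ → ℕ → ℕ → Series
    monomial k a b = Z ^ k ⊛ (t ^ a ⊛ Ψ ^ b)

    comb₃-suc : ∀ C A B c → comb₃ (suc C) A B c monomial ≈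
      comb₂ A B (c 0) ⊕ Z ⊛ comb₃ C A B (λ k → c (suc k)) monomial
    comb₃-suc C A B c = +-cong
      (Σ-cong A λ a _ → Σ-cong B λ b _ → *-congˡ (*-identityˡ _))
      (≈-sym (≈-trans (Σ-⊛ C Z _) (Σ-cong C λ k _ → ≈-trans (Σ-⊛ A Z _) (Σ-cong A λ a _ → ≈-trans (Σ-⊛ B Z _)
        (Σ-cong B λ b _ → solve 4 (λ z c P m → z :* (c :* (P :* m)) := c :* (z :* P :* m)) ≈-refl
          Z (const (c (suc k) a b)) (Z ^ k) (t ^ a ⊛ Ψ ^ b))))))
      where open Solver

    -- Modulo `Z = X ^ p` only the layer `k = 0` survives. It is divisible by `X ^ p`, and `p` is at
    -- least its number of terms, so `independent₂` clears it; then `Z` cancels and the next layer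
    -- is the bottom one.
    independent₃ : ∀ C A B c → 0 < A → 0 < B → A ℕ.* B ≤ p → (∀ k a b → B ≤ b → c k a b ≡ 0ℤ [mod p ]) →
      (∀ k a b → A ≤ a → c k a b ≡ 0ℤ [mod p ]) →
      comb₃ C A B c monomial ≈ const 0ℤ → ∀ k a b → k < C → a < A → c k a b ≡ 0ℤ [mod p ]
    independent₃ (suc C) A@(suc A′) B@(suc _) c 0<A 0<B AB≤p high right e = λ
      { zero a b _ a<A → bottom a b a<A
      ; (suc k) a b (s≤s k<C) a<A → independent₃ C A B (λ k → c (suc k)) 0<A 0<B AB≤p
          (λ k → high (suc k)) (λ k → right (suc k)) rest k a b k<C a<A }
      where
      open Solver
      tail₃ = comb₃ C A B (λ k → c (suc k)) monomial
      bottom : ∀ a b → a < A → c 0 a b ≡ 0ℤ [mod p ]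
      bottom = independent₂ A B A′ B p (c 0) (ℕ.≤-trans (ℕ.m≤m*n A B) AB≤p) (ℕ.≤-trans (ℕ.m≤n*m B A) AB≤p)
        ℕ.≤-refl ℕ.≤-refl ℕ.≤-refl (subst (_≤ p) (ℕ.+-comm B (A′ ℕ.* B)) AB≤p) (high 0) (right 0) (high 0 A′)
        (Ord-cong (≈-trans (+-congʳ (≈-sym (≈-trans (≈-sym (comb₃-suc C A B c)) e)))
            (solve 2 (λ x y → x :+ y :+ :- y := x) ≈-refl (comb₂ A B (c 0)) (Z ⊛ tail₃)))
          (Ord-⊕ (ord λ { zero _ → mod-refl ; (suc i) _ → mod-refl })
            (Ord-cong (solve 2 (λ z f → z :* (:- f) := :- (z :* f)) ≈-refl Z tail₃) (Ord-⊛ (⊖ tail₃) (Ord-X^ p)))))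
      rest : tail₃ ≈ const 0ℤ
      rest = X^-cancel p (≈-trans (≈-sym (+-identityˡ _)) (≈-trans
        (+-congʳ (≈-sym (comb₂-zero A B (c 0) bottom)))
        (≈-trans (≈-sym (comb₃-suc C A B c)) e)))

  -- Homogeneous linear systems modulo p

  funToFin-cong : ∀ {m n} {f g : Fin m → Fin n} → (∀ i → f i ≡ g i) → funToFin f ≡ funToFin g
  funToFin-cong {zero}  e = refl
  funToFin-cong {suc m} e = cong₂ Fin.combine (e Fin.zero) (funToFin-cong (λ i → e (Fin.suc i)))

  module LinearSystem (p : ℕ) (pp : Prime p) where
    open Ring p
    open PrimeField p pp
    open Sums p

    instance
      p≢0 : NonZero p
      p≢0 = prime⇒nonZero pp

    mod-%ℕ : ∀ a → a ≡ + (a ℤ.%ℕ p) [mod p ]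
    mod-%ℕ a = by (a ℤ./ℕ p) (ℤ.a≡a%ℕn+[a/ℕn]*n a p)

    residue : ℤ → Fin p
    residue a = fromℕ< (ℤ.n%ℕd<d a p)

    residue-≡ : ∀ a b → residue a ≡ residue b → a ≡ b [mod p ]
    residue-≡ a b e = mod-trans (mod-%ℕ a) (mod-trans (≡⇒mod (cong +_ (Fin.fromℕ<-injective _ _ _ _ e))) (mod-sym (mod-%ℕ b)))

    extend : ∀ n → (Fin n → Fin p) → ℕ → ℤ
    extend n d j with j ℕ.<? n
    ... | yes j<n = + toℕ (d (fromℕ< j<n))
    ... | no  _   = 0ℤ

    extend-toℕ : ∀ n d (i : Fin n) → extend n d (toℕ i) ≡ + toℕ (d i)
    extend-toℕ n d i with toℕ i ℕ.<? n
    ... | yes i<n = cong (+_ ∘ toℕ ∘ d) (Fin.fromℕ<-toℕ i i<n)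
    ... | no  i≮n = ⊥-elim (i≮n (Fin.toℕ<n i))

    combination : ℕ → (ℕ → ℤ) → (ℕ → Series) → Series
    combination n x F = Σ n λ j → const (x j) ⊛ F j

    combination-sub : ∀ n x y F → combination n (λ j → x j - y j) F ≈ combination n x F ⊕ ⊖ combination n y F
    combination-sub zero    x y F = coeffs λ { zero → mod-refl ; (suc i) → mod-refl }
    combination-sub (suc n) x y F = ≈-trans
      (+-cong (*-congʳ (≈-trans (const-+ (x 0) (- y 0)) (+-congˡ (const-neg (y 0))))) (combination-sub n _ _ _))
      (solve 5 (λ x y f u v → (x :+ :- y) :* f :+ (u :+ :- v) := x :* f :+ u :+ :- (y :* f :+ v)) ≈-refl
         (const (x 0)) (const (y 0)) (F 0) _ _)
      where open Solver

    combination-coeff : ∀ n x F G r i → (∀ j → F j ‼ r ≡ G j ‼ i) →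
      combination n x F ‼ r ≡ combination n x G ‼ i
    combination-coeff zero    x F G zero    zero    e = refl
    combination-coeff zero    x F G zero    (suc i) e = refl
    combination-coeff zero    x F G (suc r) zero    e = refl
    combination-coeff zero    x F G (suc r) (suc i) e = refl
    combination-coeff (suc n) x F G r i e = cong₂ _+_
      (trans (const-⊛ (x 0) (F 0) r) (trans (cong (λ z → x 0 * z) (e 0)) (sym (const-⊛ (x 0) (G 0) i))))
      (combination-coeff n _ _ _ r i (λ j → e (suc j)))

    -- Pigeonhole instead of elimination: `p ^ n` vectors have at most `p ^ k` tuples of first `k`
    -- coefficients, so two of them collide, and their difference is the solution.
    nontrivial-solution : ∀ n k F → k < n → ∃ λ x →
      (∀ r → r < k → combination n x F ‼ r ≡ 0ℤ [mod p ]) × ¬ (∀ j → j < n → x j ≡ 0ℤ [mod p ])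
    nontrivial-solution n k F k<n =
      let i , j , i<j , eq = Fin.pigeonhole (ℕ.^-monoʳ-< p (ℕ.nonTrivial⇒n>1 p {{prime⇒nonTrivial pp}}) k<n) (λ i → funToFin (out i))
      in (λ l → x i l - x j l) ,
         (λ r r<k → mod-trans (at (combination-sub n (x i) (x j) F) r) (≡⇒sub≡0 (same i j eq r r<k))) ,
         (λ z → ℕ.<⇒≢ i<j (cong toℕ (codes-equal i j z)))
      where
      x : Fin (p ℕ.^ n) → ℕ → ℤ
      x i = extend n (finToFun i)
      out : Fin (p ℕ.^ n) → Fin k → Fin p
      out i r = residue (combination n (x i) F ‼ toℕ r)
      same : ∀ i j → funToFin (out i) ≡ funToFin (out j) → ∀ r → r < k →
             combination n (x i) F ‼ r ≡ combination n (x j) F ‼ r [mod p ]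
      same i j eq r r<k = subst (λ r → combination n (x i) F ‼ r ≡ combination n (x j) F ‼ r [mod p ])
        (Fin.toℕ-fromℕ< r<k) (residue-≡ _ _ (trans (sym (Fin.finToFun-funToFin (out i) (fromℕ< r<k)))
          (trans (cong (λ c → finToFun c (fromℕ< r<k)) eq) (Fin.finToFun-funToFin (out j) (fromℕ< r<k)))))
      codes-equal : ∀ i j → (∀ l → l < n → x i l - x j l ≡ 0ℤ [mod p ]) → i ≡ j
      codes-equal i j z = trans (sym (Fin.funToFin-finToFin {n} {p} i))
        (trans (funToFin-cong (λ l → Fin.toℕ-injective (residue-injective (Fin.toℕ<n _) (Fin.toℕ<n _)
          (mod-trans (≡⇒mod (sym (extend-toℕ n (finToFun i) l)))
            (mod-trans (sub≡0⇒≡ (z (toℕ l) (Fin.toℕ<n l))) (≡⇒mod (extend-toℕ n (finToFun j) l)))))))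
          (Fin.funToFin-finToFin {n} {p} j))

    digits-% : ∀ k {j} n .{{_ : NonZero n}} → j < n → (k ℕ.* n ℕ.+ j) ℕ.% n ≡ j
    digits-% k {j} n j<n = trans (cong (ℕ._% n) (ℕ.+-comm (k ℕ.* n) j))
      (trans (ℕ.[m+kn]%n≡m%n j k n) (ℕ.m<n⇒m%n≡m j<n))

    digits-/ : ∀ k {j} n .{{_ : NonZero n}} → j < n → (k ℕ.* n ℕ.+ j) ℕ./ n ≡ k
    digits-/ k {j} n j<n = trans (ℕ.+-distrib-/ (k ℕ.* n) j (ℕ.≤-<-trans (ℕ.≤-reflexive
        (cong₂ ℕ._+_ (ℕ.m*n%n≡0 k n) (ℕ.m<n⇒m%n≡m j<n))) j<n))
      (trans (cong₂ ℕ._+_ (ℕ.m*n/n≡m k n) (ℕ.m<n⇒m/n≡0 j<n)) (ℕ.+-identityʳ k))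

    digits-< : ∀ {k m j n} → k < m → j < n → k ℕ.* n ℕ.+ j < m ℕ.* n
    digits-< {k} {m} {j} {n} k<m j<n = ℕ.<-≤-trans (ℕ.+-monoʳ-< (k ℕ.* n) j<n)
      (ℕ.≤-trans (ℕ.≤-reflexive (ℕ.+-comm (k ℕ.* n) n)) (ℕ.*-monoˡ-≤ n k<m))

    digits : ∀ j n .{{_ : NonZero n}} → (j ℕ./ n) ℕ.* n ℕ.+ j ℕ.% n ≡ j
    digits j n = trans (ℕ.+-comm (j ℕ./ n ℕ.* n) _) (sym (ℕ.m≡m%n+[m/n]*n j n))

    record Coefficients (C A B M R : ℕ) (F : ℕ → ℕ → ℕ → ℕ → Series) : Set where
      field
        c          : ℕ → ℕ → ℕ → ℤ
        high       : ∀ k a b → B ≤ b → c k a b ≡ 0ℤ [mod p ]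
        right      : ∀ k a b → A ≤ a → c k a b ≡ 0ℤ [mod p ]
        solves     : ∀ m r → m < M → r < R → comb₃ C A B c (F m) ‼ r ≡ 0ℤ [mod p ]
        nontrivial : ¬ (∀ k a b → k < C → a < A → c k a b ≡ 0ℤ [mod p ])

    -- One index `j` encodes `(k, a, b)` in mixed radix, and the `M` groups of `R` equations become
    -- consecutive blocks of coefficients of a single series `G j`.
    exists-coefficients : ∀ C A B M R F .{{_ : NonZero A}} .{{_ : NonZero B}} .{{_ : NonZero R}} →
      M ℕ.* R < C ℕ.* A ℕ.* B → Coefficients C A B M R F
    exists-coefficients C A B M R F size = record
      { c = c ; high = high ; right = right
      ; solves = λ m r m<M r<R → mod-trans (mod-sym (at (nested m) r))
          (mod-trans (≡⇒mod (sym (combination-coeff (C ℕ.* A ℕ.* B) x G (G′ m) (m ℕ.* R ℕ.+ r) r (G-coeff m r r<R))))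
            (proj₁ (proj₂ solution) (m ℕ.* R ℕ.+ r) (digits-< m<M r<R)))
      ; nontrivial = λ z → proj₂ (proj₂ solution) λ j j<n → mod-trans (≡⇒mod (sym (c-digits j))) (z _ _ _
          (ℕ.m<n*o⇒m/o<n {j ℕ./ B} {C} {A} (ℕ.m<n*o⇒m/o<n {j} {C ℕ.* A} {B} j<n)) (ℕ.m%n<n (j ℕ./ B) A)) }
      where
      G′ : ℕ → ℕ → Series
      G′ m j = F m (j ℕ./ B ℕ./ A) (j ℕ./ B ℕ.% A) (j ℕ.% B)
      G : ℕ → Series
      G j = series λ r → G′ (r ℕ./ R) j ‼ (r ℕ.% R)
      G-coeff : ∀ m r → r < R → ∀ j → G j ‼ (m ℕ.* R ℕ.+ r) ≡ G′ m j ‼ r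
      G-coeff m r r<R j = cong₂ (λ u v → G′ u j ‼ v) (digits-/ m R r<R) (digits-% m R r<R)
      solution = nontrivial-solution (C ℕ.* A ℕ.* B) (M ℕ.* R) G size
      x = proj₁ solution
      -- Zero outside the box, because `independent₃` asks for `high` and `right` at all indices.
      c : ℕ → ℕ → ℕ → ℤ
      c k a b with a ℕ.<? A | b ℕ.<? B
      ... | yes _ | yes _ = x ((k ℕ.* A ℕ.+ a) ℕ.* B ℕ.+ b)
      ... | yes _ | no _  = 0ℤ
      ... | no _  | _     = 0ℤ
      c-in : ∀ k a b → a < A → b < B → c k a b ≡ x ((k ℕ.* A ℕ.+ a) ℕ.* B ℕ.+ b)
      c-in k a b a<A b<B with a ℕ.<? A | b ℕ.<? B
      ... | yes _ | yes _ = refl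
      ... | yes _ | no b≮B = ⊥-elim (b≮B b<B)
      ... | no a≮A | _     = ⊥-elim (a≮A a<A)
      high : ∀ k a b → B ≤ b → c k a b ≡ 0ℤ [mod p ]
      high k a b B≤b with a ℕ.<? A | b ℕ.<? B
      ... | yes _ | yes b<B = ⊥-elim (ℕ.<⇒≱ b<B B≤b)
      ... | yes _ | no _    = mod-refl
      ... | no _  | _       = mod-refl
      right : ∀ k a b → A ≤ a → c k a b ≡ 0ℤ [mod p ]
      right k a b A≤a with a ℕ.<? A | b ℕ.<? B
      ... | yes a<A | _ = ⊥-elim (ℕ.<⇒≱ a<A A≤a)
      ... | no _    | _ = mod-refl
      c-digits : ∀ j → c (j ℕ./ B ℕ./ A) (j ℕ./ B ℕ.% A) (j ℕ.% B) ≡ x j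
      c-digits j = trans (c-in _ _ _ (ℕ.m%n<n (j ℕ./ B) A) (ℕ.m%n<n j B))
        (cong x (trans (cong (λ i → i ℕ.* B ℕ.+ j ℕ.% B) (digits (j ℕ./ B) A)) (digits j B)))
      G′-index : ∀ m k a b → a < A → b < B → G′ m ((k ℕ.* A ℕ.+ a) ℕ.* B ℕ.+ b) ≡ F m k a b
      G′-index m k a b a<A b<B rewrite digits-/ (k ℕ.* A ℕ.+ a) B b<B | digits-% (k ℕ.* A ℕ.+ a) B b<B
        | digits-/ k A a<A | digits-% k A a<A = refl
      nested : ∀ m → combination (C ℕ.* A ℕ.* B) x (G′ m) ≈ comb₃ C A B c (F m)
      nested m = ≈-trans (Σ-flatten (C ℕ.* A) B _) (≈-trans (Σ-flatten C A _)
        (Σ-cong C λ k _ → Σ-cong A λ a a<A → Σ-cong B λ b b<B →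
          ≈-reflexive (cong₂ (λ u v → const u ⊛ v) (sym (c-in k a b a<A b<B)) (G′-index m k a b a<A b<B))))

  -- The auxiliary polynomial

  module Stepanov (p : ℕ) (pp : Prime p) (h : ℤ) (h≢0 : ¬ h ≡ 0ℤ [mod p ]) (Ψ G : Series) (g : ℕ)
    (θ-Ψ : Ring._≈_ p (Derivation.θ p h Ψ) (const h ⊛ (X ⊕ ⊖ (X ^ p))))
    (Deg-Ψ : Polynomial.Deg p p Ψ) (Deg-G : Polynomial.Deg p g G)
    (fermat : ∀ s → s ℤ.^ p ≡ s [mod p ]) where
    open Ring p
    open Derivation p h
    open Polynomial p
    open PrimeField p pp
    open Sums p
    open Multiplicity p pp h
    open Independence p pp h h≢0 Ψ θ-Ψ
    open LinearSystem p pp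

    θ-Z : θ Z ≈ const 0ℤ ⊛ Z
    θ-Z = ≈-trans (θ-eigen-^ p (≈-trans θ-X (*-comm X t)))
      (≈-trans (*-congʳ (const-cong {+ p} {0ℤ} (by 1ℤ (sym (trans (ℤ.+-identityˡ (1ℤ * + p)) (ℤ.*-identityˡ (+ p)))))))
        (≈-trans (zeroˡ _) (≈-sym (zeroˡ _))))

    θ-Z^ : ∀ k → θ (Z ^ k) ≈ const 0ℤ
    θ-Z^ k = ≈-trans (θ-eigen-^ k θ-Z)
      (solve 2 (λ a b → a :* (con 0ℤ :* b) := con 0ℤ) ≈-refl (const (+ k)) (Z ^ k))
      where open Solver

    -- The action of `θ` on the monomials, with `X` written as `t - h` so that only monomials occur
    -- on the right. It is abstract in `F` so that the same recursion can be run on the reduced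
    -- polynomials.
    step : (ℕ → ℕ → ℕ → Series) → ℕ → ℕ → ℕ → Series
    step F k a b = const (+ a) ⊛ (F k (suc a) b ⊕ const (- h) ⊛ F k a b)
      ⊕ const (+ b * h) ⊛ (F k (suc a) (ℕ.pred b) ⊕ const (- h) ⊛ F k a (ℕ.pred b) ⊕ ⊖ F (suc k) a (ℕ.pred b))

    θ-monomial : ∀ k a b → θ (monomial k a b) ≈ step monomial k a b
    θ-monomial k a b = begin
      θ (Z ^ k ⊛ (t ^ a ⊛ Ψ ^ b))
        ≈⟨ θ-⊛ _ _ ⟩
      θ (Z ^ k) ⊛ (t ^ a ⊛ Ψ ^ b) ⊕ Z ^ k ⊛ θ (t ^ a ⊛ Ψ ^ b)
        ≈⟨ +-cong (*-congʳ (θ-Z^ k)) (*-congˡ (θ-t^Ψ^ a b)) ⟩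
      const 0ℤ ⊛ (t ^ a ⊛ Ψ ^ b) ⊕ Z ^ k ⊛ (const (+ a) ⊛ (X ⊛ (t ^ a ⊛ Ψ ^ b))
        ⊕ const (+ b * h) ⊛ ((X ⊕ ⊖ Z) ⊛ (t ^ a ⊛ Ψ ^ ℕ.pred b)))
        ≈⟨ solve 9 (λ x h z K T P Q A B →
             con 0ℤ :* (T :* P) :+ K :* (A :* (x :* (T :* P)) :+ B :* ((x :+ :- z) :* (T :* Q))) :=
             A :* (K :* ((x :+ h) :* T :* P) :+ (:- h) :* (K :* (T :* P)))
               :+ B :* (K :* ((x :+ h) :* T :* Q) :+ (:- h) :* (K :* (T :* Q)) :+ :- (z :* K :* (T :* Q)))) ≈-refl
             X (const h) Z (Z ^ k) (t ^ a) (Ψ ^ b) (Ψ ^ ℕ.pred b) (const (+ a)) (const (+ b * h)) ⟩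
      const (+ a) ⊛ (monomial k (suc a) b ⊕ (⊖ const h) ⊛ monomial k a b)
        ⊕ const (+ b * h) ⊛ (monomial k (suc a) (ℕ.pred b) ⊕ (⊖ const h) ⊛ monomial k a (ℕ.pred b)
          ⊕ ⊖ monomial (suc k) a (ℕ.pred b))
        ≈⟨ +-cong (*-congˡ (+-congˡ (*-congʳ (≈-sym (const-neg h)))))
                  (*-congˡ (+-congʳ (+-congˡ (*-congʳ (≈-sym (const-neg h)))))) ⟩
      step monomial k a b ∎
      where
      open SetoidReasoning setoid
      open Solver

    iter-step : ∀ m F k a b → iter m (step F k a b) ≈ step (λ k a b → iter m (F k a b)) k a b
    iter-step m F k a b = ≈-trans (iter-⊕ m _ _) (+-cong
      (≈-trans (iter-const-⊛ m _ _) (*-congˡ (≈-trans (iter-⊕ m _ _) (+-congˡ (iter-const-⊛ m _ _)))))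
      (≈-trans (iter-const-⊛ m _ _) (*-congˡ (≈-trans (iter-⊕ m _ _)
        (+-cong (≈-trans (iter-⊕ m _ _) (+-congˡ (iter-const-⊛ m _ _))) (iter-⊖ m _))))))

    -- reduced m k a b agrees with the m-th derivative of monomial k a b at every point
    -- where Ψ = G and X ^ p = X, but has small degree.
    reduced : ℕ → ℕ → ℕ → ℕ → Series
    reduced zero    k a b = X ^ k ⊛ (t ^ a ⊛ G ^ b)
    reduced (suc m) k a b = step (reduced m) k a b

    ~-step : ∀ {s F F′} → (∀ k a b → F k a b ~[ s ] F′ k a b) → ∀ k a b → step F k a b ~[ s ] step F′ k a b
    ~-step e k a b = ~-⊕
      (~-⊛ (~-const _) (~-⊕ (e _ _ _) (~-⊛ (~-const _) (e _ _ _))))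
      (~-⊛ (~-const _) (~-⊕ (~-⊕ (e _ _ _) (~-⊛ (~-const _) (e _ _ _))) (~-⊖ (e _ _ _))))

    -- Replacing `Ψ` by `G` and `Z` by `X` does not commute with `θ`. Hence the derivative is first
    -- expanded in monomials by `step`, and the replacement takes place only at `m = 0`, where
    -- nothing is left to differentiate.
    reduced-agrees : ∀ {s} → Ψ ~[ s ] G → ∀ m k a b → iter m (monomial k a b) ~[ s ] reduced m k a b
    reduced-agrees {s} Ψ~G zero k a b = ~-⊛ (~-^ k Z~X)
      (~-⊛ (~-^ a (~-⊕ (agree ⇓-X ⇓-X) (~-const h))) (~-^ b Ψ~G))
      where
      Z~X : Z ~[ s ] X
      Z~X = agree (⇓-≡ (fermat s) (⇓-^ p ⇓-X)) ⇓-X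
    reduced-agrees Ψ~G (suc m) k a b = ~-cong
      (≈-sym (≈-trans (iter-cong m (θ-monomial k a b)) (iter-step m monomial k a b))) ≈-refl
      (~-step (reduced-agrees Ψ~G m) k a b)

    Deg-const-⊛ : ∀ c {d f} → Deg d f → Deg d (const c ⊛ f)
    Deg-const-⊛ c = Deg-⊛ (Deg-const c)

    Deg-⊖ : ∀ {d f} → Deg d f → Deg d (⊖ f)
    Deg-⊖ (deg v) = deg λ i d<i → mod-neg (v i d<i)

    -- Each `step` raises `k` or `a` by at most one and never raises `b`, so a derivative costs one
    -- degree.
    reduced-degree : ∀ m k a b → Deg (k ℕ.+ a ℕ.+ b ℕ.* g ℕ.+ m) (reduced m k a b)
    reduced-degree zero k a b = Deg-mono (ℕ.≤-reflexive eq)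
      (Deg-⊛ (Deg-^ k Deg-X) (Deg-⊛ (Deg-^ a Deg-t) (Deg-^ b Deg-G)))
      where
      eq : k ℕ.* 1 ℕ.+ (a ℕ.* 1 ℕ.+ b ℕ.* g) ≡ k ℕ.+ a ℕ.+ b ℕ.* g ℕ.+ 0
      eq = trans (cong₂ (λ x y → x ℕ.+ (y ℕ.+ b ℕ.* g)) (ℕ.*-identityʳ k) (ℕ.*-identityʳ a))
        (trans (sym (ℕ.+-assoc k a _)) (sym (ℕ.+-identityʳ _)))
    reduced-degree (suc m) k a b = Deg-⊕
      (Deg-const-⊛ _ (Deg-⊕ (raise-a b ℕ.≤-refl) (Deg-const-⊛ _ (same b ℕ.≤-refl))))
      (Deg-const-⊛ _ (Deg-⊕ (Deg-⊕ (raise-a (ℕ.pred b) ℕ.pred[n]≤n) (Deg-const-⊛ _ (same (ℕ.pred b) ℕ.pred[n]≤n)))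
        (Deg-⊖ raise-k)))
      where
      D = k ℕ.+ a ℕ.+ b ℕ.* g ℕ.+ suc m
      bound : ∀ u b′ → b′ ≤ b → u ≤ suc (k ℕ.+ a) → u ℕ.+ b′ ℕ.* g ℕ.+ m ≤ D
      bound u b′ b′≤b u≤ = ℕ.≤-trans (ℕ.+-monoˡ-≤ m (ℕ.+-mono-≤ u≤ (ℕ.*-monoˡ-≤ g b′≤b)))
        (ℕ.≤-reflexive (sym (ℕ.+-suc (k ℕ.+ a ℕ.+ b ℕ.* g) m)))
      raise-a : ∀ b′ → b′ ≤ b → Deg D (reduced m k (suc a) b′)
      raise-a b′ b′≤b = Deg-mono (bound (k ℕ.+ suc a) b′ b′≤b (ℕ.≤-reflexive (ℕ.+-suc k a))) (reduced-degree m k (suc a) b′)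
      same : ∀ b′ → b′ ≤ b → Deg D (reduced m k a b′)
      same b′ b′≤b = Deg-mono (bound (k ℕ.+ a) b′ b′≤b (ℕ.n≤1+n _)) (reduced-degree m k a b′)
      raise-k : Deg D (reduced m (suc k) a (ℕ.pred b))
      raise-k = Deg-mono (bound (suc k ℕ.+ a) _ ℕ.pred[n]≤n ℕ.≤-refl) (reduced-degree m (suc k) a (ℕ.pred b))

    monomial-degree : ∀ k a b → Deg (k ℕ.* p ℕ.+ (a ℕ.+ b ℕ.* p)) (monomial k a b)
    monomial-degree k a b = Deg-⊛ (Deg-^ k (Deg-mono (ℕ.≤-reflexive (ℕ.*-identityʳ p)) (Deg-^ p Deg-X)))
      (Deg-⊛ (Deg-mono (ℕ.≤-reflexive (ℕ.*-identityʳ a)) (Deg-^ a Deg-t)) (Deg-^ b Deg-Ψ))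

    Deg-comb₃ : ∀ C A B c F d → (∀ k a b → k ≤ C → a ≤ A → b ≤ B → Deg d (F k a b)) → Deg d (comb₃ C A B c F)
    Deg-comb₃ C A B c F d e = Deg-Σ C λ k k<C → Deg-Σ A λ a a<A → Deg-Σ B λ b b<B →
      Deg-const-⊛ (c k a b) (e k a b (ℕ.<⇒≤ k<C) (ℕ.<⇒≤ a<A) (ℕ.<⇒≤ b<B))

    -- There are more unknowns `C A B` than conditions, so some nonzero choice of coefficients makes
    -- all reduced derivatives of order below `M` vanish identically. The resulting `P` is nonzero
    -- by independence and has order at least `M` at each point, and its degree limits the number of
    -- points.
    stepanov : ∀ A B C M ss .{{_ : NonZero A}} .{{_ : NonZero B}} → A ℕ.* B ≤ p → M ≤ p →
      M ℕ.* suc (C ℕ.+ A ℕ.+ B ℕ.* g ℕ.+ M) < C ℕ.* A ℕ.* B →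
      All (λ s → ¬ s ≡ 0ℤ [mod p ]) ss → AllPairs (λ s s′ → ¬ s ≡ s′ [mod p ]) ss →
      All (λ s → ¬ s + h ≡ 0ℤ [mod p ] × Ψ ~[ s ] G) ss →
      length ss ℕ.* M ≤ C ℕ.* p ℕ.+ (A ℕ.+ B ℕ.* p)
    stepanov A B C M ss AB≤p M≤p size ss≢0 distinct ss-ok =
      root-count ss M ss≢0 distinct P-degree P≉0 (All.zipWith order (ss≢0 , ss-ok))
      where
      R = suc (C ℕ.+ A ℕ.+ B ℕ.* g ℕ.+ M)
      open Coefficients (exists-coefficients C A B M R reduced size)
      P : Series
      P = comb₃ C A B c monomial
      P-degree : Deg (C ℕ.* p ℕ.+ (A ℕ.+ B ℕ.* p)) P
      P-degree = Deg-comb₃ C A B c monomial _ λ k a b k≤C a≤A b≤B →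
        Deg-mono (ℕ.+-mono-≤ (ℕ.*-monoˡ-≤ p k≤C) (ℕ.+-mono-≤ a≤A (ℕ.*-monoˡ-≤ p b≤B))) (monomial-degree k a b)
      P≉0 : ¬ P ≈ const 0ℤ
      P≉0 e = nontrivial (λ k a b → independent₃ C A B c (ℕ.>-nonZero⁻¹ A) (ℕ.>-nonZero⁻¹ B) AB≤p high right e k a b)
      reduced≈0 : ∀ m → m < M → comb₃ C A B c (reduced m) ≈ const 0ℤ
      reduced≈0 m m<M = coeffs λ { zero → vanishes 0 ; (suc i) → vanishes (suc i) }
        where
        vanishes : ∀ i → comb₃ C A B c (reduced m) ‼ i ≡ 0ℤ [mod p ]
        -- The linear system covers the coefficients below `R`; the degree bound `R - 1` covers the
        -- others.
        vanishes i with i ℕ.<? R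
        ... | yes i<R = solves m i m<M i<R
        ... | no  i≮R = vanish (Deg-comb₃ C A B c (reduced m) (C ℕ.+ A ℕ.+ B ℕ.* g ℕ.+ M) λ k a b k≤C a≤A b≤B →
            Deg-mono (ℕ.+-mono-≤ (ℕ.+-mono-≤ (ℕ.+-mono-≤ k≤C a≤A) (ℕ.*-monoˡ-≤ g b≤B)) (ℕ.<⇒≤ m<M))
              (reduced-degree m k a b)) i (ℕ.≮⇒≥ i≮R)
      iter-P : ∀ m → iter m P ≈ comb₃ C A B c (λ k a b → iter m (monomial k a b))
      iter-P m = ≈-trans (iter-Σ m C _) (Σ-cong C λ k _ → ≈-trans (iter-Σ m A _)
        (Σ-cong A λ a _ → ≈-trans (iter-Σ m B _) (Σ-cong B λ b _ → iter-const-⊛ m _ _)))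
      order : ∀ {s} → ¬ s ≡ 0ℤ [mod p ] × ¬ s + h ≡ 0ℤ [mod p ] × Ψ ~[ s ] G → RootOfOrder s M P
      order {s} (s≢0 , s+h≢0 , Ψ~G) = order-from-derivatives M M≤p s≢0 s+h≢0 (_ , P-degree) λ m m<M →
        let agree l r = ~-cong (≈-sym (iter-P m)) (reduced≈0 m m<M)
              (~-Σ C λ k _ → ~-Σ A λ a _ → ~-Σ B λ b _ → ~-⊛ (~-const (c k a b)) (reduced-agrees Ψ~G m k a b))
        in ⇓-≡ (⇓-unique r (⇓-const 0ℤ)) l

  -- Fermat quotients

  private
    module Ring₀ = Ring 0
    module Polynomial₀ = Polynomial 0
    module Derivation₀ = Derivation 0

  mod-0⇒mod : ∀ {n a b} → a ≡ b [mod 0 ] → a ≡ b [mod n ]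
  mod-0⇒mod e = ≡⇒mod (mod-0⇒≡ e)

  module Frobenius (p : ℕ) (pp : Prime p) where
    open Ring p
    open Polynomial p
    open PrimeField p pp
    open Sums p

    instance
      p-nonZero : ℤ.NonZero (+ p)
      p-nonZero = ℤ.≢-nonZero λ p≡0 → ℕ.≢-nonZero⁻¹ p {{prime⇒nonZero pp}} (ℤ.+-injective p≡0)

    p≡0 : + p ≡ 0ℤ [mod p ]
    p≡0 = by 1ℤ (sym (trans (ℤ.+-identityˡ (1ℤ * + p)) (ℤ.*-identityˡ (+ p))))

    X^-coeff : ∀ m i → ¬ i ≡ m → (X ^ m) ‼ i ≡ 0ℤ
    X^-coeff zero    zero    i≢m with () ← i≢m refl
    X^-coeff zero    (suc i) i≢m = refl
    X^-coeff (suc m) zero    i≢m = ℤ.*-zeroˡ ((X ^ m) ‼ 0)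
    X^-coeff (suc m) (suc i) i≢m = trans (X-⊛ (X ^ m) i) (X^-coeff m i λ { refl → i≢m refl })

    X^-leading : ∀ m → (X ^ m) ‼ m ≡ 1ℤ
    X^-leading zero    = refl
    X^-leading (suc m) = trans (X-⊛ (X ^ m) m) (X^-leading m)

    module _ (h : ℤ) where
      open Derivation p h

      t-⊛-suc : ∀ f i → (t ⊛ f) ‼ suc i ≡ f ‼ i + h * f ‼ suc i
      t-⊛-suc f i = trans (⊛-distribʳ f X (const h) (suc i)) (cong₂ _+_ (X-⊛ f i) (const-⊛ h f (suc i)))

      t^-leading : ∀ m → (t ^ m) ‼ m ≡ 1ℤ [mod p ]
      t^-leading zero    = mod-refl
      t^-leading (suc m) = mod-trans (≡⇒mod (t-⊛-suc (t ^ m) m))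
        (mod-trans (mod-+ (t^-leading m) (mod-* (mod-refl {a = h})
            (vanish (Deg-^ m Deg-t) (suc m) (s≤s (ℕ.≤-reflexive (ℕ.*-identityʳ m))))))
          (≡⇒mod (lem h)))
        where
        lem : ∀ h → 1ℤ + h * 0ℤ ≡ 1ℤ
        lem = solve-∀

      -- In characteristic p the derivative of t ^ p vanishes, which kills the middle coefficients.
      frobenius : ¬ h ≡ 0ℤ [mod p ] → t ^ p ≈ X ^ p ⊕ const (h ℤ.^ p)
      frobenius h≢0 = coeffs go
        where
        euler≈0 : euler (t ^ p) ≈ const 0ℤ
        euler≈0 = lin-cancel-0 (- h) (euler (t ^ p)) (λ e → h≢0 (mod-trans (≡⇒mod (sym (ℤ.neg-involutive h))) (mod-neg e)))
          (≈-trans (*-congʳ (+-congˡ {X} (const-cong (≡⇒mod (ℤ.neg-involutive h)))))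
            (≈-trans (θ-eigen-^ p θ-t) (≈-trans (*-congʳ (const-cong p≡0)) (zeroˡ _))))
        go : ∀ i → (t ^ p) ‼ i ≡ (X ^ p ⊕ const (h ℤ.^ p)) ‼ i [mod p ]
        go zero = ≡⇒mod (trans (t^-at-0 p) (trans (sym (ℤ.+-identityˡ _))
          (cong (_+ h ℤ.^ p) (sym (X^-coeff p 0 (λ 0≡p → ℕ.≢-nonZero⁻¹ p {{prime⇒nonZero pp}} (sym 0≡p)))))))
        go (suc i) with ℕ.<-cmp (suc i) p
        ... | tri≈ _ i≡p _ = mod-trans (subst (λ j → (t ^ p) ‼ j ≡ 1ℤ [mod p ]) (sym i≡p) (t^-leading p))
          (≡⇒mod (sym (trans (ℤ.+-identityʳ _) (trans (cong ((X ^ p) ‼_) i≡p) (X^-leading p)))))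
        ... | tri< i<p i≢p _ = mod-trans
          (*-cancel-0 (+ suc i) ((t ^ p) ‼ suc i) (pos≢0 (s≤s z≤n) i<p) (at euler≈0 (suc i)))
          (≡⇒mod (sym (trans (ℤ.+-identityʳ _) (X^-coeff p (suc i) i≢p))))
        ... | tri> _ i≢p p<i = mod-trans
          (vanish (Deg-^ p Deg-t) (suc i) (subst (_< suc i) (sym (ℕ.*-identityʳ p)) p<i))
          (≡⇒mod (sym (trans (ℤ.+-identityʳ _) (X^-coeff p (suc i) i≢p))))

    ^-suc-fermat : ∀ s → (s + 1ℤ) ℤ.^ p ≡ s ℤ.^ p + 1ℤ [mod p ]
    ^-suc-fermat s = mod-trans
      (⇓-unique (⇓-^ p (⇓-⊕ {u = s} {v = 1ℤ} ⇓-X (⇓-const 1ℤ)))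
        (⇓-cong (≈-sym (frobenius 1ℤ 1≢0)) (⇓-⊕ {u = s ℤ.^ p} {v = 1ℤ ℤ.^ p} (⇓-^ p ⇓-X) (⇓-const (1ℤ ℤ.^ p)))))
      (≡⇒mod (cong (λ z → s ℤ.^ p + z) (ℤ.^-zeroˡ p)))

    fermat-ℕ : ∀ k → (+ k) ℤ.^ p ≡ + k [mod p ]
    fermat-ℕ zero    = zero^ p (ℕ.≢-nonZero⁻¹ p {{prime⇒nonZero pp}})
      where
      zero^ : ∀ m → ¬ m ≡ 0 → 0ℤ ℤ.^ m ≡ 0ℤ [mod p ]
      zero^ zero    m≢0 with () ← m≢0 refl
      zero^ (suc m) _   = ≡⇒mod (ℤ.*-zeroˡ (0ℤ ℤ.^ m))
    fermat-ℕ (suc k) = mod-trans (mod-^ p (≡⇒mod (ℤ.+-comm 1ℤ (+ k)))) (mod-trans (^-suc-fermat (+ k))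
      (mod-trans (mod-+ (fermat-ℕ k) (mod-refl {a = 1ℤ})) (≡⇒mod (ℤ.+-comm (+ k) 1ℤ))))

    fermat : ∀ s → s ℤ.^ p ≡ s [mod p ]
    fermat s = mod-trans (mod-^ p (mod-%ℕ s)) (mod-trans (fermat-ℕ _) (mod-sym (mod-%ℕ s)))
      where open LinearSystem p pp

    -- The function `r`: the witness of Fermat's congruence is the exact integer `(s ^ p - s) / p`.
    fermatQuotient : ℤ → ℤ
    fermatQuotient s = _≡_[mod_].quotient (fermat s)

    ^p-expand : ∀ s → s ℤ.^ p ≡ s + fermatQuotient s * + p
    ^p-expand s = _≡_[mod_].equality (fermat s)

    *p-cancel : ∀ a b → a * + p ≡ b * + p → a ≡ b
    *p-cancel a b = ℤ.*-cancelʳ-≡ a b (+ p)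

    module Carry (h : ℤ) (h≢0 : ¬ h ≡ 0ℤ [mod p ]) where
      open Derivation p h
      private
        module D₀ = Derivation₀ h

      -- Ψ = ((X + h) ^ p - X ^ p - h ^ p) / p
      Ψ : Series
      Ψ = series λ i → _≡_[mod_].quotient (at (frobenius h h≢0) i)

      Ψ-spec : t ^ p Ring₀.≈ X ^ p ⊕ const (h ℤ.^ p) ⊕ const (+ p) ⊛ Ψ
      Ψ-spec = Ring₀.≗⇒≈ λ i → trans (_≡_[mod_].equality (at (frobenius h h≢0) i))
        (cong (λ z → (X ^ p) ‼ i + const (h ℤ.^ p) ‼ i + z)
          (trans (ℤ.*-comm (Ψ ‼ i) (+ p)) (sym (const-⊛ (+ p) Ψ i))))

      p-cancel : ∀ f g → const (+ p) ⊛ f Ring₀.≈ const (+ p) ⊛ g → f Ring₀.≈ g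
      p-cancel f g e = Ring₀.≗⇒≈ λ i → ℤ.*-cancelˡ-≡ (+ p) (f ‼ i) (g ‼ i)
        (trans (sym (const-⊛ (+ p) f i)) (trans (mod-0⇒≡ (Ring₀.at e i)) (const-⊛ (+ p) g i)))

      -- Apply `θ` to `Ψ-spec`: both `θ (t ^ p)` and `θ (X ^ p)` carry a factor `p`. It can be
      -- cancelled over ℤ, whereas modulo `p` the relation would read `0 = 0`; hence the modulus 0.
      θ-Ψ₀ : θ Ψ Ring₀.≈ X ⊛ t ^ p ⊕ ⊖ (t ⊛ X ^ p)
      θ-Ψ₀ = p-cancel _ _ (begin
        const (+ p) ⊛ θ Ψ
          ≈⟨ D₀.θ-const-⊛ (+ p) Ψ ⟨
        θ (const (+ p) ⊛ Ψ)
          ≈⟨ solve 3 (λ x c d → d := x :+ c :+ d :+ :- (x :+ c)) Ring₀.≈-refl (θ (X ^ p)) (θ (const (h ℤ.^ p))) _ ⟩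
        θ (X ^ p) ⊕ θ (const (h ℤ.^ p)) ⊕ θ (const (+ p) ⊛ Ψ) ⊕ ⊖ (θ (X ^ p) ⊕ θ (const (h ℤ.^ p)))
          ≈⟨ Ring₀.+-cong
               (Ring₀.≈-trans (Ring₀.≈-sym (Ring₀.≈-trans (D₀.θ-⊕ _ _) (Ring₀.+-congʳ (D₀.θ-⊕ _ _))))
                 (Ring₀.≈-trans (D₀.θ-cong (Ring₀.≈-sym Ψ-spec)) (D₀.θ-eigen-^ p D₀.θ-t)))
               (Ring₀.-‿cong (Ring₀.+-cong
                 (D₀.θ-eigen-^ p (Ring₀.≈-trans D₀.θ-X (Ring₀.*-comm X t))) (D₀.θ-const (h ℤ.^ p)))) ⟩
        const (+ p) ⊛ (X ⊛ t ^ p) ⊕ ⊖ (const (+ p) ⊛ (t ⊛ X ^ p) ⊕ const 0ℤ)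
          ≈⟨ solve 3 (λ c a b → c :* a :+ :- (c :* b :+ con 0ℤ) := c :* (a :+ :- b)) Ring₀.≈-refl
               (const (+ p)) (X ⊛ t ^ p) (t ⊛ X ^ p) ⟩
        const (+ p) ⊛ (X ⊛ t ^ p ⊕ ⊖ (t ⊛ X ^ p)) ∎)
        where
        open import Relation.Binary.Reasoning.Setoid Ring₀.setoid
        open Ring₀.Solver

      ₀⇒≈ : ∀ {f g} → f Ring₀.≈ g → f ≈ g
      ₀⇒≈ e = coeffs λ i → mod-0⇒mod (Ring₀.at e i)

      -- Modulo `p` the power `t ^ p` becomes `X ^ p + h`, and `X ^ (p + 1)` cancels in
      -- `X (X ^ p + h) - (X + h) X ^ p`.
      θ-Ψ : θ Ψ ≈ const h ⊛ (X ⊕ ⊖ (X ^ p))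
      θ-Ψ = ≈-trans (₀⇒≈ θ-Ψ₀) (≈-trans
        (+-congʳ (*-congˡ (≈-trans (frobenius h h≢0) (+-congˡ (const-cong (fermat h))))))
        (solve 3 (λ x z h → x :* (z :+ h) :+ :- ((x :+ h) :* z) := h :* (x :+ :- z)) ≈-refl X (X ^ p) (const h)))
        where open Solver

      Deg₀-Ψ : Polynomial₀.Deg p Ψ
      Deg₀-Ψ = Polynomial₀.deg λ i p<i → ≡⇒mod (ℤ.*-cancelˡ-≡ (+ p) (Ψ ‼ i) 0ℤ (trans (sym (const-⊛ (+ p) Ψ i))
        (trans (lem ((X ^ p) ‼ i) (const (h ℤ.^ p) ‼ i) ((const (+ p) ⊛ Ψ) ‼ i))
          (trans (cong (λ z → z - ((X ^ p) ‼ i + const (h ℤ.^ p) ‼ i)) (sym (mod-0⇒≡ (Ring₀.at Ψ-spec i))))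
            (trans (cong₂ _-_ (mod-0⇒≡ (vanish₀ (Deg^ D₀.Deg-t) i p<i))
              (cong₂ _+_ (mod-0⇒≡ (vanish₀ (Deg^ Polynomial₀.Deg-X) i p<i))
                (mod-0⇒≡ (vanish₀ (Polynomial₀.Deg-const (h ℤ.^ p)) i (ℕ.≤-<-trans z≤n p<i)))))
            (sym (ℤ.*-zeroʳ (+ p))))))))
        where
        lem : ∀ x y z → z ≡ x + y + z - (x + y)
        lem = solve-∀
        vanish₀ = Polynomial₀.vanish
        Deg^ : ∀ {f} → Polynomial₀.Deg 1 f → Polynomial₀.Deg p (f ^ p)
        Deg^ d = Polynomial₀.Deg-mono (ℕ.≤-reflexive (ℕ.*-identityʳ p)) (Polynomial₀.Deg-^ p d)

      Deg-Ψ : Deg p Ψ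
      Deg-Ψ = deg λ i p<i → mod-0⇒mod (Polynomial₀.vanish Deg₀-Ψ i p<i)

      -- Evaluate `Ψ-spec` at `s` and write each `p`-th power as `x + r(x) p`: the terms `s + h`,
      -- `s` and `h` cancel, and the remaining factor `p` is divided out over ℤ.
      Ψ-value : ∀ s → Ψ ⇓[ s ] fermatQuotient (s + h) - fermatQuotient s - fermatQuotient h
      Ψ-value s = value p Deg-Ψ (≡⇒mod (*p-cancel v _ (begin
        v * + p
          ≡⟨ lem₁ v (+ p) (s ℤ.^ p) (h ℤ.^ p) ⟩
        s ℤ.^ p + h ℤ.^ p + + p * v - s ℤ.^ p - h ℤ.^ p
          ≡⟨ cong (λ z → z - s ℤ.^ p - h ℤ.^ p) (sym expansion) ⟩
        (s + h) ℤ.^ p - s ℤ.^ p - h ℤ.^ p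
          ≡⟨ cong₂ _-_ (cong₂ _-_ (^p-expand (s + h)) (^p-expand s)) (^p-expand h) ⟩
        s + h + r (s + h) * + p - (s + r s * + p) - (h + r h * + p)
          ≡⟨ lem₂ s h (r (s + h)) (r s) (r h) (+ p) ⟩
        (r (s + h) - r s - r h) * + p ∎)))
        where
        open ≡.≡-Reasoning
        r : ℤ → ℤ
        r = fermatQuotient
        v : ℤ
        v = ev p s Ψ
        expansion : (s + h) ℤ.^ p ≡ s ℤ.^ p + h ℤ.^ p + + p * v
        expansion = mod-0⇒≡ (Polynomial₀.⇓-unique
          (Polynomial₀.⇓-^ p (Polynomial₀.⇓-⊕ {u = s} {v = h} Polynomial₀.⇓-X (Polynomial₀.⇓-const h)))
          (Polynomial₀.⇓-cong (Ring₀.≈-sym Ψ-spec)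
            (Polynomial₀.⇓-⊕ {u = s ℤ.^ p + h ℤ.^ p} {v = + p * v}
              (Polynomial₀.⇓-⊕ {u = s ℤ.^ p} {v = h ℤ.^ p} (Polynomial₀.⇓-^ p Polynomial₀.⇓-X) (Polynomial₀.⇓-const (h ℤ.^ p)))
              (Polynomial₀.⇓-⊛ {u = + p} {v = v} (Polynomial₀.⇓-const (+ p)) (Polynomial₀.value p Deg₀-Ψ mod-refl)))))
        lem₁ : ∀ v p a b → v * p ≡ a + b + p * v - a - b
        lem₁ = solve-∀
        lem₂ : ∀ s h a b c p → s + h + a * p - (s + b * p) - (h + c * p) ≡ (a - b - c) * p
        lem₂ = solve-∀

  -- Choice of parameters

  -- The size condition of `stepanov` for `M = b ^ 2`, `B = C = 2 b` and `A = 4 E b ^ 2`: at most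
  -- `10 q e` conditions against `16 q e` unknowns, where `e = E q`. The saving is the ratio of `M`
  -- to `B + C`, of size `b`, and `A B ≤ p` allows `b` up to about the cube root of `p / E`.
  parameter-size : ∀ E b → 1 ≤ E → 1 ≤ b → let q = b ℕ.* b in
    q ℕ.* suc (2 ℕ.* b ℕ.+ 4 ℕ.* (E ℕ.* q) ℕ.+ 2 ℕ.* b ℕ.* E ℕ.+ q) < 2 ℕ.* b ℕ.* (4 ℕ.* (E ℕ.* q)) ℕ.* (2 ℕ.* b)
  parameter-size E b 1≤E 1≤b = begin-strict
    q ℕ.* suc (2 ℕ.* b ℕ.+ 4 ℕ.* e ℕ.+ 2 ℕ.* b ℕ.* E ℕ.+ q)
      ≤⟨ ℕ.*-monoʳ-≤ q (ℕ.+-mono-≤ 1≤e (ℕ.+-mono-≤ (ℕ.+-mono-≤ (ℕ.+-monoˡ-≤ (4 ℕ.* e) (ℕ.*-monoʳ-≤ 2 b≤e)) 2bE≤2e) q≤e)) ⟩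
    q ℕ.* (e ℕ.+ (2 ℕ.* e ℕ.+ 4 ℕ.* e ℕ.+ 2 ℕ.* e ℕ.+ e))
      ≡⟨ lem₁ q e ⟩
    10 ℕ.* (q ℕ.* e)
      <⟨ ℕ.*-monoˡ-< (q ℕ.* e) {{ℕ.>-nonZero (ℕ.*-mono-≤ (ℕ.*-mono-≤ 1≤b 1≤b) 1≤e)}} (ℕ.m≤m+n 11 5) ⟩
    16 ℕ.* (q ℕ.* e)
      ≡⟨ lem₂ b e ⟩
    2 ℕ.* b ℕ.* (4 ℕ.* e) ℕ.* (2 ℕ.* b) ∎
    where
    open ℕ.≤-Reasoning
    q = b ℕ.* b
    e = E ℕ.* q
    b≤q : b ≤ q
    b≤q = ℕ.m≤m*n b b {{ℕ.>-nonZero 1≤b}}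
    q≤e : q ≤ e
    q≤e = ℕ.m≤n*m q E {{ℕ.>-nonZero 1≤E}}
    b≤e : b ≤ e
    b≤e = ℕ.≤-trans b≤q q≤e
    1≤e : 1 ≤ e
    1≤e = ℕ.≤-trans 1≤b b≤e
    2bE≤2e : 2 ℕ.* b ℕ.* E ≤ 2 ℕ.* e
    2bE≤2e = ℕ.≤-trans (ℕ.≤-reflexive (lem b E)) (ℕ.*-monoʳ-≤ 2 (ℕ.*-monoʳ-≤ E b≤q))
      where
      lem : ∀ b E → 2 ℕ.* b ℕ.* E ≡ 2 ℕ.* (E ℕ.* b)
      lem = ℕ-Solver.solve-∀
    lem₁ : ∀ q e → q ℕ.* (e ℕ.+ (2 ℕ.* e ℕ.+ 4 ℕ.* e ℕ.+ 2 ℕ.* e ℕ.+ e)) ≡ 10 ℕ.* (q ℕ.* e)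
    lem₁ = ℕ-Solver.solve-∀
    lem₂ : ∀ b e → 16 ℕ.* (b ℕ.* b ℕ.* e) ≡ 2 ℕ.* b ℕ.* (4 ℕ.* e) ℕ.* (2 ℕ.* b)
    lem₂ = ℕ-Solver.solve-∀

  cube : ℕ → ℕ
  cube b = b ℕ.* b ℕ.* b

  cube-mono : ∀ {a b} → a ≤ b → cube a ≤ cube b
  cube-mono a≤b = ℕ.*-mono-≤ (ℕ.*-mono-≤ a≤b a≤b) a≤b

  integer-root : ∀ (f : ℕ → ℕ) n Y → f 0 ≤ Y → Y < f n → ∃ λ b → f b ≤ Y × Y < f (suc b)
  integer-root f zero    Y f0≤Y Y<f0 with () ← ℕ.<⇒≱ Y<f0 f0≤Y
  integer-root f (suc n) Y f0≤Y Y<fn with f n ℕ.≤? Y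
  ... | yes ≤Y = n , ≤Y , Y<fn
  ... | no  ≰Y = integer-root f n Y f0≤Y (ℕ.≰⇒> ≰Y)

  cube-root : ∀ K p → 1 ≤ K → ∃ λ b → K ℕ.* cube b ≤ p × p < K ℕ.* cube (suc b)
  cube-root K p 1≤K = integer-root (λ b → K ℕ.* cube b) (suc p) p (ℕ.≤-trans (ℕ.≤-reflexive (ℕ.*-zeroʳ K)) z≤n)
    (ℕ.≤-trans (ℕ.m≤m*n (suc p) (suc p ℕ.* suc p))
      (ℕ.≤-trans (ℕ.≤-reflexive (sym (ℕ.*-assoc (suc p) (suc p) (suc p)))) (ℕ.m≤n*m (cube (suc p)) K {{ℕ.>-nonZero 1≤K}})))

  -- Opaque, because the numeral would otherwise be unfolded to unary.
  opaque
    κ : ℕ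
    κ = 1728

    1≤κ : 1 ≤ κ
    1≤κ = ℕ.m≤m+n 1 1727

    -- Take the largest admissible `b`. The trivial `T ≤ p` added to `T b ≤ 5 p` gives
    -- `T (b + 1) ≤ 6 p`, while `p < 8 E (b + 1) ^ 3`; the constant is `8 * 6 ^ 3 = 1728`.
    cube-bound : ∀ E p T → 1 ≤ E → 1 ≤ p → T ≤ p → (∀ b → 8 ℕ.* E ℕ.* cube b ≤ p → T ℕ.* b ≤ 5 ℕ.* p) →
      cube T ≤ κ ℕ.* (E ℕ.* (p ℕ.* p))
    cube-bound E p T 1≤E 1≤p T≤p bound with cube-root (8 ℕ.* E) p (ℕ.≤-trans 1≤E (ℕ.m≤n*m E 8))
    ... | b , ≤p , p< = ℕ.*-cancelʳ-≤ (cube T) _ p {{ℕ.>-nonZero 1≤p}} (begin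
      cube T ℕ.* p
        ≤⟨ ℕ.*-monoʳ-≤ (cube T) (ℕ.<⇒≤ p<) ⟩
      cube T ℕ.* (8 ℕ.* E ℕ.* cube (suc b))
        ≡⟨ lem₁ T E (suc b) ⟩
      8 ℕ.* E ℕ.* cube (T ℕ.* suc b)
        ≤⟨ ℕ.*-monoʳ-≤ (8 ℕ.* E) (cube-mono Tb≤6p) ⟩
      8 ℕ.* E ℕ.* cube (6 ℕ.* p)
        ≡⟨ lem₂ E p ⟩
      1728 ℕ.* (E ℕ.* (p ℕ.* p)) ℕ.* p ∎)
      where
      open ℕ.≤-Reasoning
      Tb≤6p : T ℕ.* suc b ≤ 6 ℕ.* p
      Tb≤6p = ℕ.≤-trans (ℕ.≤-reflexive (ℕ.*-suc T b)) (ℕ.+-mono-≤ T≤p (bound b ≤p))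
      lem₁ : ∀ T E b → T ℕ.* T ℕ.* T ℕ.* (8 ℕ.* E ℕ.* (b ℕ.* b ℕ.* b)) ≡ 8 ℕ.* E ℕ.* (T ℕ.* b ℕ.* (T ℕ.* b) ℕ.* (T ℕ.* b))
      lem₁ = ℕ-Solver.solve-∀
      lem₂ : ∀ E p → 8 ℕ.* E ℕ.* (6 ℕ.* p ℕ.* (6 ℕ.* p) ℕ.* (6 ℕ.* p)) ≡ 1728 ℕ.* (E ℕ.* (p ℕ.* p)) ℕ.* p
      lem₂ = ℕ-Solver.solve-∀

  -- Pairs of solutions with a fixed difference

  module PairBound (p : ℕ) (pp : Prime p) where
    open Ring p
    open Polynomial p
    open PrimeField p pp
    open Sums p
    open Frobenius p pp

    -- the substitution X ↦ X + h in a polynomial of degree at most k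
    translate : ℤ → ℕ → Series → Series
    translate h zero    f = const (f ‼ 0)
    translate h (suc k) f = const (f ‼ 0) ⊕ (X ⊕ const h) ⊛ translate h k (tail f)

    Deg-translate : ∀ h k f → Deg k (translate h k f)
    Deg-translate h zero    f = Deg-const (f ‼ 0)
    Deg-translate h (suc k) f = Deg-⊕ (Deg-mono z≤n (Deg-const (f ‼ 0)))
      (Deg-⊛ (Derivation.Deg-t p h) (Deg-translate h k (tail f)))

    translate-value : ∀ h k f s → translate h k f ⇓[ s ] ev k (s + h) f
    translate-value h zero    f s = ⇓-const (f ‼ 0)
    translate-value h (suc k) f s = ⇓-⊕ {u = f ‼ 0} {v = (s + h) * ev k (s + h) (tail f)} (⇓-const (f ‼ 0))
      (⇓-⊛ {u = s + h} {v = ev k (s + h) (tail f)} (⇓-⊕ {u = s} {v = h} ⇓-X (⇓-const h)) (translate-value h k (tail f) s))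

    -- `positive` and `small` place `u` and `u + h` strictly between 0 and `p`, so the factor
    -- `X (X + h)` of `θ` is invertible at `u`.
    record FermatPair (E : ℕ) (f : Series) (h u : ℕ) : Set where
      field
        positive : 0 < u
        small    : u ℕ.+ h < p
        first    : fermatQuotient (+ u) ≡ ev E (+ u) f [mod p ]
        second   : fermatQuotient (+ (u ℕ.+ h)) ≡ ev E (+ (u ℕ.+ h)) f [mod p ]

    module _ (E : ℕ) (f : Series) (1≤E : 1 ≤ E) (Deg-f : Deg E f) (h : ℕ) (0<h : 0 < h) (h<p : h < p)
      (us : List ℕ) (unique : Unique us) (pairs : All (FermatPair E f h) us) where

      private
        h≢0 : ¬ + h ≡ 0ℤ [mod p ]
        h≢0 = pos≢0 0<h h<p
        open Carry (+ h) h≢0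

        G : Series
        G = translate (+ h) E f ⊕ ⊖ f ⊕ const (- fermatQuotient (+ h))

        Deg-G : Deg E G
        Deg-G = Deg-⊕ (Deg-⊕ (Deg-translate (+ h) E f) (deg λ i E<i → mod-neg (vanish Deg-f i E<i)))
          (Deg-mono z≤n (Deg-const (- fermatQuotient (+ h))))

        open Stepanov p pp (+ h) h≢0 Ψ G E θ-Ψ Deg-Ψ Deg-G fermat

        u<p : ∀ {u} → FermatPair E f h u → u < p
        u<p {u} P = ℕ.≤-<-trans (ℕ.m≤m+n u h) (FermatPair.small P)

        Ψ~G : ∀ {u} → FermatPair E f h u → Ψ ~[ + u ] G
        Ψ~G {u} P = agree (⇓-≡ (mod-+ (mod-+ second (mod-neg first)) (mod-refl {a = - fermatQuotient (+ h)})) (Ψ-value (+ u)))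
          (⇓-⊕ {v = - fermatQuotient (+ h)} (⇓-⊕ {v = - ev E (+ u) f} (translate-value (+ h) E f (+ u)) (⇓-⊖ (value E Deg-f mod-refl)))
            (⇓-const (- fermatQuotient (+ h))))
          where open FermatPair P

        distinct : ∀ {us} → Unique us → All (FermatPair E f h) us → AllPairs (λ u v → ¬ + u ≡ + v [mod p ]) us
        distinct []         []       = []
        distinct (u≢ ∷ unq) (P ∷ Ps) =
          All.zipWith (λ (u≢v , Q) e → u≢v (residue-injective (u<p P) (u<p Q) e)) (u≢ , Ps) ∷ distinct unq Ps

      -- `stepanov` bounds `length us` times `b ^ 2` by `4 b p + A`; since `A ≤ p ≤ p b`, one factor
      -- `b` cancels.
      pair-bound : ∀ b → 8 ℕ.* E ℕ.* cube b ≤ p → length us ℕ.* b ≤ 5 ℕ.* p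
      pair-bound zero    _ = ℕ.≤-trans (ℕ.≤-reflexive (ℕ.*-zeroʳ (length us))) z≤n
      pair-bound b@(suc b′) size = ℕ.*-cancelʳ-≤ (length us ℕ.* b) (5 ℕ.* p) b (begin
        length us ℕ.* b ℕ.* b
          ≡⟨ trans (ℕ.*-assoc (length us) b b) (cong (ℕ._* q) (sym (length-map +_ us))) ⟩
        length (map +_ us) ℕ.* q
          ≤⟨ stepanov A (2 ℕ.* b) (2 ℕ.* b) q (map +_ us) {{A≢0}} AB≤p q≤p (parameter-size E b 1≤E (s≤s z≤n))
               (All.map⁺ (All.map (λ P → pos≢0 (FermatPair.positive P) (u<p P)) pairs))
               (AllPairs.map⁺ (distinct unique pairs))
               (All.map⁺ (All.map (λ P → pos≢0 (ℕ.≤-trans 0<h (ℕ.m≤n+m h _)) (FermatPair.small P) , Ψ~G P) pairs)) ⟩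
        2 ℕ.* b ℕ.* p ℕ.+ (A ℕ.+ 2 ℕ.* b ℕ.* p)
          ≤⟨ ℕ.+-monoʳ-≤ (2 ℕ.* b ℕ.* p) (ℕ.+-monoˡ-≤ (2 ℕ.* b ℕ.* p) (ℕ.≤-trans A≤p (ℕ.m≤m*n p b))) ⟩
        2 ℕ.* b ℕ.* p ℕ.+ (p ℕ.* b ℕ.+ 2 ℕ.* b ℕ.* p)
          ≡⟨ lem₁ b p ⟩
        5 ℕ.* p ℕ.* b ∎)
        where
        open ℕ.≤-Reasoning
        q = b ℕ.* b
        A = 4 ℕ.* (E ℕ.* q)
        lem₁ : ∀ b p → 2 ℕ.* b ℕ.* p ℕ.+ (p ℕ.* b ℕ.+ 2 ℕ.* b ℕ.* p) ≡ 5 ℕ.* p ℕ.* b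
        lem₁ = ℕ-Solver.solve-∀
        lem₂ : ∀ E b → 4 ℕ.* (E ℕ.* (b ℕ.* b)) ℕ.* (2 ℕ.* b) ≡ 8 ℕ.* E ℕ.* (b ℕ.* b ℕ.* b)
        lem₂ = ℕ-Solver.solve-∀
        AB≤p : A ℕ.* (2 ℕ.* b) ≤ p
        AB≤p = ℕ.≤-trans (ℕ.≤-reflexive (lem₂ E b)) size
        A≤p : A ≤ p
        A≤p = ℕ.≤-trans (ℕ.m≤m*n A (2 ℕ.* b)) AB≤p
        q≤A : q ≤ A
        q≤A = ℕ.≤-trans (ℕ.m≤n*m q E {{ℕ.>-nonZero 1≤E}}) (ℕ.m≤n*m (E ℕ.* q) 4)
        q≤p : q ≤ p
        q≤p = ℕ.≤-trans q≤A A≤p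
        A≢0 : NonZero A
        A≢0 = ℕ.>-nonZero (ℕ.<-≤-trans (s≤s z≤n) q≤A)

      pair-cube-bound : length us ≤ p → cube (length us) ≤ κ ℕ.* (E ℕ.* (p ℕ.* p))
      pair-cube-bound us≤p = cube-bound E p (length us) 1≤E (ℕ.<-trans 0<h h<p) us≤p pair-bound

  -- From differences to the whole set

  sum< : ℕ → (ℕ → ℕ) → ℕ
  sum< zero    χ = 0
  sum< (suc n) χ = χ 0 ℕ.+ sum< n (χ ∘ suc)

  sum<-cong : ∀ n {χ ψ} → (∀ i → i < n → χ i ≡ ψ i) → sum< n χ ≡ sum< n ψ
  sum<-cong zero    e = refl
  sum<-cong (suc n) e = cong₂ ℕ._+_ (e 0 (s≤s z≤n)) (sum<-cong n (λ i i<n → e (suc i) (s≤s i<n)))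

  sum<-linear : ∀ n c χ ψ → sum< n (λ i → c ℕ.* χ i ℕ.+ ψ i) ≡ c ℕ.* sum< n χ ℕ.+ sum< n ψ
  sum<-linear zero    c χ ψ = sym (trans (ℕ.+-identityʳ _) (ℕ.*-zeroʳ c))
  sum<-linear (suc n) c χ ψ = trans (cong (λ z → c ℕ.* χ 0 ℕ.+ ψ 0 ℕ.+ z) (sum<-linear n c (χ ∘ suc) (ψ ∘ suc)))
    (lem c (χ 0) (ψ 0) (sum< n (χ ∘ suc)) (sum< n (ψ ∘ suc)))
    where
    lem : ∀ c a b s r → c ℕ.* a ℕ.+ b ℕ.+ (c ℕ.* s ℕ.+ r) ≡ c ℕ.* (a ℕ.+ s) ℕ.+ (b ℕ.+ r)
    lem = ℕ-Solver.solve-∀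

  sum<-bound : ∀ n χ K → (∀ i → i < n → χ i ≤ K) → sum< n χ ≤ n ℕ.* K
  sum<-bound zero    χ K e = z≤n
  sum<-bound (suc n) χ K e = ℕ.+-mono-≤ (e 0 (s≤s z≤n)) (sum<-bound n (χ ∘ suc) K (λ i i<n → e (suc i) (s≤s i<n)))

  sum<-last : ∀ n χ → sum< n χ ≤ sum< (suc n) χ
  sum<-last zero    χ = z≤n
  sum<-last (suc n) χ = ℕ.+-monoʳ-≤ (χ 0) (sum<-last n (χ ∘ suc))

  correlation : ℕ → (ℕ → ℕ) → ℕ → ℕ
  correlation N χ h = sum< (N ∸ h) (λ u → χ u ℕ.* χ (u ℕ.+ h))

  -- Counting pairs by their difference.
  square≤correlations : ∀ N χ → (∀ u → χ u ≤ 1) →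
    sum< N χ ℕ.* sum< N χ ≤ sum< N χ ℕ.+ 2 ℕ.* sum< N (λ h → correlation N χ (suc h))
  square≤correlations zero    χ χ≤1 = z≤n
  square≤correlations (suc N) χ χ≤1 = begin
    (x ℕ.+ s) ℕ.* (x ℕ.+ s)
      ≡⟨ lem₁ x s ⟩
    x ℕ.* x ℕ.+ 2 ℕ.* (x ℕ.* s) ℕ.+ s ℕ.* s
      ≤⟨ ℕ.+-mono-≤ (ℕ.+-monoˡ-≤ (2 ℕ.* (x ℕ.* s)) (ℕ.*-monoˡ-≤ x (χ≤1 0))) (square≤correlations N (χ ∘ suc) (χ≤1 ∘ suc)) ⟩
    1 ℕ.* x ℕ.+ 2 ℕ.* (x ℕ.* s) ℕ.+ (s ℕ.+ 2 ℕ.* r)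
      ≡⟨ lem₂ x s r ⟩
    x ℕ.+ s ℕ.+ 2 ℕ.* (x ℕ.* s ℕ.+ r)
      ≡⟨ cong (λ z → x ℕ.+ s ℕ.+ 2 ℕ.* z) (sym (trans (sum<-cong N peel) (sum<-linear N x _ _))) ⟩
    x ℕ.+ s ℕ.+ 2 ℕ.* sum< N (λ h → correlation (suc N) χ (suc h))
      ≤⟨ ℕ.+-monoʳ-≤ (x ℕ.+ s) (ℕ.*-monoʳ-≤ 2 (sum<-last N (λ h → correlation (suc N) χ (suc h)))) ⟩
    x ℕ.+ s ℕ.+ 2 ℕ.* sum< (suc N) (λ h → correlation (suc N) χ (suc h)) ∎
    where
    open ℕ.≤-Reasoning
    x = χ 0
    s = sum< N (χ ∘ suc)
    r = sum< N (λ h → correlation N (χ ∘ suc) (suc h))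
    -- Adding a first point lengthens the range of the correlation by one, which truncated
    -- subtraction gives for `h < N` only; the term at `h = N` is supplied by `sum<-last`.
    peel : ∀ h → h < N → correlation (suc N) χ (suc h) ≡ x ℕ.* χ (suc h) ℕ.+ correlation N (χ ∘ suc) (suc h)
    peel h h<N = cong (λ n → sum< n (λ u → χ u ℕ.* χ (u ℕ.+ suc h))) (ℕ.+-∸-assoc 1 h<N)
    lem₁ : ∀ x s → (x ℕ.+ s) ℕ.* (x ℕ.+ s) ≡ x ℕ.* x ℕ.+ 2 ℕ.* (x ℕ.* s) ℕ.+ s ℕ.* s
    lem₁ = ℕ-Solver.solve-∀
    lem₂ : ∀ x s r → 1 ℕ.* x ℕ.+ 2 ℕ.* (x ℕ.* s) ℕ.+ (s ℕ.+ 2 ℕ.* r) ≡ x ℕ.+ s ℕ.+ 2 ℕ.* (x ℕ.* s ℕ.+ r)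
    lem₂ = ℕ-Solver.solve-∀

  indicator : ∀ {P : Set} → Dec P → ℕ
  indicator (yes _) = 1
  indicator (no _)  = 0

  indicator≤1 : ∀ {P : Set} (d : Dec P) → indicator d ≤ 1
  indicator≤1 (yes _) = ℕ.≤-refl
  indicator≤1 (no _)  = z≤n

  indicator-× : ∀ {P Q : Set} (d : Dec P) (e : Dec Q) → indicator (d ×-dec e) ≡ indicator d ℕ.* indicator e
  indicator-× (yes _) (yes _) = refl
  indicator-× (yes _) (no _)  = refl
  indicator-× (no _)  _       = refl

  count : ∀ {P : ℕ → Set} → Decidable P → ℕ → ℕ
  count P? N = length (filter P? (upTo N))

  count≡sum : ∀ {P : ℕ → Set} (P? : Decidable P) N → count P? N ≡ sum< N (λ u → indicator (P? u))
  count≡sum P? N = go id N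
    where
    go : ∀ f N → length (filter P? (applyUpTo f N)) ≡ sum< N (λ u → indicator (P? (f u)))
    go f zero = refl
    go f (suc N) with P? (f 0)
    ... | yes _ = cong suc (go (f ∘ suc) N)
    ... | no _  = go (f ∘ suc) N

  count≤ : ∀ {P : ℕ → Set} (P? : Decidable P) N → count P? N ≤ N
  count≤ P? N = ℕ.≤-trans (length-filter P? (upTo N)) (ℕ.≤-reflexive (length-upTo N))

  count-pairs : ∀ {P : ℕ → Set} (P? : Decidable P) N K →
    (∀ h → h < N → count (λ u → P? u ×-dec P? (u ℕ.+ suc h)) (N ∸ suc h) ≤ K) →
    count P? N ℕ.* count P? N ≤ count P? N ℕ.+ 2 ℕ.* (N ℕ.* K)
  count-pairs P? N K bound = subst (λ F → F ℕ.* F ≤ F ℕ.+ 2 ℕ.* (N ℕ.* K)) (sym (count≡sum P? N))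
    (ℕ.≤-trans (square≤correlations N χ (λ u → indicator≤1 (P? u)))
      (ℕ.+-monoʳ-≤ (sum< N χ) (ℕ.*-monoʳ-≤ 2 (sum<-bound N _ K λ h h<N →
        ℕ.≤-trans (ℕ.≤-reflexive (trans (sum<-cong (N ∸ suc h) λ u _ → sym (indicator-× (P? u) (P? (u ℕ.+ suc h))))
          (sym (count≡sum (λ u → P? u ×-dec P? (u ℕ.+ suc h)) (N ∸ suc h))))) (bound h h<N)))))
    where
    χ : ℕ → ℕ
    χ u = indicator (P? u)

  cube-cancel : ∀ {a b Y} → cube a ≤ Y → Y < cube (suc b) → a ≤ b
  cube-cancel {a} {b} a³≤Y Y<b³ = ℕ.≮⇒≥ λ b<a → ℕ.<⇒≱ (ℕ.<-≤-trans Y<b³ (cube-mono b<a)) a³≤Y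

  -- Solutions of `r(u) = f(u)` in an initial interval

  module FermatCount (p : ℕ) (pp : Prime p) where
    open Polynomial p
    open Frobenius p pp
    open PairBound p pp

    -- The integer cube root `T` of `κ E p ^ 2` bounds the pairs for every difference at once, so
    -- the count satisfies `F ^ 2 ≤ F + 2 N T ≤ 3 N T`. Cubing removes the root and gives the factor
    -- 27.
    count-bound : ∀ E f N {P : ℕ → Set} (P? : Decidable P) → 1 ≤ E → Deg E f → 1 ≤ N → N ≤ p →
      (∀ u → u < N → P u → 0 < u × fermatQuotient (+ u) ≡ ev E (+ u) f [mod p ]) →
      cube (count P? N ℕ.* count P? N) ≤ 27 ℕ.* κ ℕ.* (cube N ℕ.* (E ℕ.* (p ℕ.* p)))
    count-bound E f N {P} P? 1≤E Deg-f 1≤N N≤p hyp = begin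
      cube (F ℕ.* F)
        ≤⟨ cube-mono (ℕ.≤-trans (count-pairs P? N T pair-count) (ℕ.+-monoˡ-≤ (2 ℕ.* (N ℕ.* T)) F≤NT)) ⟩
      cube (N ℕ.* T ℕ.+ 2 ℕ.* (N ℕ.* T))
        ≡⟨ lem₁ N T ⟩
      27 ℕ.* (cube N ℕ.* (1 ℕ.* cube T))
        ≤⟨ ℕ.*-monoʳ-≤ 27 (ℕ.*-monoʳ-≤ (cube N) (proj₁ (proj₂ root))) ⟩
      27 ℕ.* (cube N ℕ.* (κ ℕ.* (E ℕ.* (p ℕ.* p))))
        ≡⟨ lem₂ (cube N) (E ℕ.* (p ℕ.* p)) κ ⟩
      27 ℕ.* κ ℕ.* (cube N ℕ.* (E ℕ.* (p ℕ.* p))) ∎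
      where
      open ℕ.≤-Reasoning
      F = count P? N
      Y = κ ℕ.* (E ℕ.* (p ℕ.* p))
      root : ∃ λ T → 1 ℕ.* cube T ≤ Y × Y < 1 ℕ.* cube (suc T)
      root = cube-root 1 Y ℕ.≤-refl
      T = proj₁ root
      1≤p : 1 ≤ p
      1≤p = ℕ.≤-trans 1≤N N≤p
      Y<T³ : Y < cube (suc T)
      Y<T³ = subst (Y <_) (ℕ.*-identityˡ (cube (suc T))) (proj₂ (proj₂ root))
      1≤T : 1 ≤ T
      1≤T = cube-cancel (ℕ.*-mono-≤ 1≤κ (ℕ.*-mono-≤ 1≤E (ℕ.*-mono-≤ 1≤p 1≤p))) Y<T³
      F≤NT : F ≤ N ℕ.* T
      F≤NT = ℕ.≤-trans (count≤ P? N) (ℕ.m≤m*n N T {{ℕ.>-nonZero 1≤T}})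
      lem₁ : ∀ N T → let x = N ℕ.* T ℕ.+ 2 ℕ.* (N ℕ.* T) in
        x ℕ.* x ℕ.* x ≡ 27 ℕ.* (N ℕ.* N ℕ.* N ℕ.* (1 ℕ.* (T ℕ.* T ℕ.* T)))
      lem₁ = ℕ-Solver.solve-∀
      lem₂ : ∀ a b k → 27 ℕ.* (a ℕ.* (k ℕ.* b)) ≡ 27 ℕ.* k ℕ.* (a ℕ.* b)
      lem₂ = ℕ-Solver.solve-∀
      pair-count : ∀ h → h < N → count (λ u → P? u ×-dec P? (u ℕ.+ suc h)) (N ∸ suc h) ≤ T
      pair-count h h<N with suc h ℕ.<? p
      -- A difference of at least `p` has an empty range because `N ≤ p`.
      ... | no h≮p = ℕ.≤-trans (count≤ _ (N ∸ suc h))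
        (ℕ.≤-trans (ℕ.≤-reflexive (ℕ.m≤n⇒m∸n≡0 (ℕ.≤-trans N≤p (ℕ.≮⇒≥ h≮p)))) z≤n)
      ... | yes h<p = cube-cancel (pair-cube-bound E f 1≤E Deg-f (suc h) (s≤s z≤n) h<p us
          (Unique.filter⁺ Q? (Unique.upTo⁺ (N ∸ suc h)))
          (All.zipWith pair (All.filter⁺ Q? (All.applyUpTo⁺₁ id (N ∸ suc h) id) , All.all-filter Q? (upTo (N ∸ suc h))))
          (ℕ.≤-trans (count≤ Q? (N ∸ suc h)) (ℕ.≤-trans (ℕ.m∸n≤m N (suc h)) N≤p))) Y<T³
        where
        Q? : Decidable (λ u → P u × P (u ℕ.+ suc h))
        Q? u = P? u ×-dec P? (u ℕ.+ suc h)
        us = filter Q? (upTo (N ∸ suc h))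
        pair : ∀ {u} → u < N ∸ suc h × P u × P (u ℕ.+ suc h) → FermatPair E f (suc h) u
        pair {u} (u< , Pu , Pv) = record
          { positive = proj₁ (hyp u (ℕ.<-≤-trans u< (ℕ.m∸n≤m N (suc h))) Pu)
          ; small    = ℕ.<-≤-trans v<N N≤p
          ; first    = proj₂ (hyp u (ℕ.<-≤-trans u< (ℕ.m∸n≤m N (suc h))) Pu)
          ; second   = proj₂ (hyp (u ℕ.+ suc h) v<N Pv)
          }
          where
          v<N : u ℕ.+ suc h < N
          v<N = ℕ.<-≤-trans (ℕ.+-monoˡ-< (suc h) u<) (ℕ.≤-reflexive (ℕ.m∸n+n≡m h<N))

  -- Polynomial quotients

  sixth : ℕ → ℕ
  sixth b = cube (b ℕ.* b)

  n≤sixth : ∀ n → n ≤ sixth n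
  n≤sixth zero      = z≤n
  n≤sixth n@(suc _) = ℕ.≤-trans (ℕ.m≤m*n n n) (ℕ.≤-trans (ℕ.m≤m*n (n ℕ.* n) (n ℕ.* n)) (ℕ.m≤m*n (n ℕ.* n ℕ.* (n ℕ.* n)) (n ℕ.* n)))

  sixth-mono : ∀ {a b} → a ≤ b → sixth a ≤ sixth b
  sixth-mono a≤b = cube-mono (ℕ.*-mono-≤ a≤b a≤b)

  sixth-root : ∀ Y → ∃ λ K → sixth K ≤ Y × (∀ {a} → sixth a ≤ Y → a ≤ K)
  sixth-root Y with integer-root sixth (suc Y) Y z≤n (n≤sixth (suc Y))
  ... | K , K⁶≤Y , Y<K⁶ = K , K⁶≤Y , λ a⁶≤Y → ℕ.≮⇒≥ λ K<a → ℕ.<⇒≱ (ℕ.<-≤-trans Y<K⁶ (sixth-mono K<a)) a⁶≤Y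

  length-filter-∷ : ∀ {P : ℕ → Set} (P? : Decidable P) x xs →
    length (filter P? (x ∷ xs)) ≡ indicator (P? x) ℕ.+ length (filter P? xs)
  length-filter-∷ P? x xs with P? x
  ... | yes _ = refl
  ... | no _  = refl

  indicator-⊎ : ∀ {P Q R : Set} (d : Dec P) (e : Dec Q) (f : Dec R) → (P → Q ⊎ R) → indicator d ≤ indicator e ℕ.+ indicator f
  indicator-⊎ (no _)  _       _       _ = z≤n
  indicator-⊎ (yes _) (yes _) _       _ = s≤s z≤n
  indicator-⊎ (yes _) (no _)  (yes _) _ = ℕ.≤-refl
  indicator-⊎ (yes p) (no ¬q) (no ¬r) g with g p
  ... | inj₁ q = ⊥-elim (¬q q)
  ... | inj₂ r = ⊥-elim (¬r r)

  length-filter-⊎ : ∀ {P Q R : ℕ → Set} (P? : Decidable P) (Q? : Decidable Q) (R? : Decidable R) xs →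
    (∀ {x} → x ∈ xs → P x → Q x ⊎ R x) → length (filter P? xs) ≤ length (filter Q? xs) ℕ.+ length (filter R? xs)
  length-filter-⊎ P? Q? R? []       _ = z≤n
  length-filter-⊎ P? Q? R? (x ∷ xs) g = begin
    length (filter P? (x ∷ xs))
      ≡⟨ length-filter-∷ P? x xs ⟩
    indicator (P? x) ℕ.+ length (filter P? xs)
      ≤⟨ ℕ.+-mono-≤ (indicator-⊎ (P? x) (Q? x) (R? x) (g (here refl))) (length-filter-⊎ P? Q? R? xs (g ∘ there)) ⟩
    indicator (Q? x) ℕ.+ indicator (R? x) ℕ.+ (length (filter Q? xs) ℕ.+ length (filter R? xs))
      ≡⟨ lem (indicator (Q? x)) (indicator (R? x)) _ _ ⟩
    indicator (Q? x) ℕ.+ length (filter Q? xs) ℕ.+ (indicator (R? x) ℕ.+ length (filter R? xs))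
      ≡⟨ sym (cong₂ ℕ._+_ (length-filter-∷ Q? x xs) (length-filter-∷ R? x xs)) ⟩
    length (filter Q? (x ∷ xs)) ℕ.+ length (filter R? (x ∷ xs)) ∎
    where
    open ℕ.≤-Reasoning
    lem : ∀ a b c d → a ℕ.+ b ℕ.+ (c ℕ.+ d) ≡ a ℕ.+ c ℕ.+ (b ℕ.+ d)
    lem = ℕ-Solver.solve-∀

  -- One class is removed at a time and the induction continues with the points outside it. The
  -- predicate shrinks on the way, which is why the bound is stated for every decidable part of a
  -- class.
  length-filter-classes : ∀ (class : ℕ → ℕ) xs K L {P : ℕ → Set} (P? : Decidable P) →
    (∀ {x} → x ∈ xs → P x → class x ∈ L) →
    (∀ a {Q : ℕ → Set} (Q? : Decidable Q) → (∀ {x} → Q x → P x × class x ≡ a) → length (filter Q? xs) ≤ K) →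
    length (filter P? xs) ≤ length L ℕ.* K
  length-filter-classes class xs K [] P? covered _ =
    ℕ.≤-reflexive (cong length (filter-none P? (All.tabulate λ x∈xs Px → absurd (covered x∈xs Px))))
    where
    absurd : ∀ {a} → a ∈ [] → _
    absurd ()
  length-filter-classes class xs K (a ∷ L) {P} P? covered bound = ℕ.≤-trans
    (length-filter-⊎ P? Q? R? xs λ {x} _ Px → split x Px)
    (ℕ.+-mono-≤ (bound a Q? id) (length-filter-classes class xs K L R?
      (λ x∈xs (Px , c≢a) → other (covered x∈xs Px) c≢a)
      (λ b S? S⇒R → bound b S? λ Sx → proj₁ (proj₁ (S⇒R Sx)) , proj₂ (S⇒R Sx))))
    where
    Q? : Decidable (λ x → P x × class x ≡ a)
    Q? x = P? x ×-dec (class x ℕ.≟ a)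
    R? : Decidable (λ x → P x × ¬ class x ≡ a)
    R? x = P? x ×-dec ¬? (class x ℕ.≟ a)
    split : ∀ x → P x → (P x × class x ≡ a) ⊎ (P x × ¬ class x ≡ a)
    split x Px with class x ℕ.≟ a
    ... | yes c≡a = inj₁ (Px , c≡a)
    ... | no  c≢a = inj₂ (Px , c≢a)
    other : ∀ {b} → b ∈ a ∷ L → ¬ b ≡ a → b ∈ L
    other (here refl) b≢a = ⊥-elim (b≢a refl)
    other (there b∈L) _   = b∈L

  count-≡0 : ∀ N → count (ℕ._≟ 0) N ≤ 1
  count-≡0 zero    = z≤n
  count-≡0 (suc N) = ℕ.≤-trans (ℕ.≤-reflexive (count≡sum (ℕ._≟ 0) (suc N)))
    (s≤s (ℕ.≤-trans (sum<-bound N _ 0 (λ i _ → ℕ.≤-refl)) (ℕ.≤-reflexive (ℕ.*-zeroʳ N))))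

  pos-^ : ∀ a m → + (a ℕ.^ m) ≡ (+ a) ℤ.^ m
  pos-^ a zero    = refl
  pos-^ a (suc m) = trans (ℤ.pos-* a (a ℕ.^ m)) (cong (λ z → + a * z) (pos-^ a m))

  -- The binomial theorem modulo `q ^ 2`. With `q = p` it expands `(u + r(u) p) ^ w` to the
  -- precision that survives the division by `p`.
  ^-first-order : ∀ a b q m → ∃ λ k →
    (a + b * q) ℤ.^ suc m ≡ a ℤ.^ suc m + (+ suc m * a ℤ.^ m * b + k * q) * q
  ^-first-order a b q zero = 0ℤ , lem a b q
    where
    lem : ∀ a b q → (a + b * q) * 1ℤ ≡ a * 1ℤ + (1ℤ * 1ℤ * b + 0ℤ * q) * q
    lem = solve-∀
  ^-first-order a b q (suc m) with ^-first-order a b q m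
  ... | k , e = a * k + b * (+ suc m * a ℤ.^ m * b + k * q) ,
    trans (cong (λ z → (a + b * q) * z) e) (lem a b q (+ suc m) (a ℤ.^ m) k)
    where
    lem : ∀ a b q n x k → (a + b * q) * (a * x + (n * x * b + k * q) * q) ≡
      a * (a * x) + ((1ℤ + n) * (a * x) * b + (a * k + b * (n * x * b + k * q)) * q) * q
    lem = solve-∀

  module PolynomialQuotient (p : ℕ) (pp : Prime p) where
    open Ring p
    open Polynomial p
    open PrimeField p pp
    open Sums p
    open Frobenius p pp
    open LinearSystem p pp
    open FermatCount p pp

    1<p : 1 < p
    1<p = ℕ.nonTrivial⇒n>1 p {{prime⇒nonTrivial pp}}

    0<p : 0 < p
    0<p = ℕ.<-trans (s≤s z≤n) 1<p

    /ℕ-exact : ∀ D x → D ≡ x * + p → D ℤ./ℕ p ≡ x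
    /ℕ-exact D x e = *p-cancel _ x (trans (sym (ℤ.+-identityˡ _))
      (trans (cong (λ z → + z + D ℤ./ℕ p * + p) (sym rem≡0)) (trans (sym (ℤ.a≡a%ℕn+[a/ℕn]*n D p)) e)))
      where
      rem≡0 : D ℤ.%ℕ p ≡ 0
      rem≡0 = residue-injective (ℤ.n%ℕd<d D p) 0<p
        (mod-trans (mod-sym (mod-%ℕ D)) (by x (trans e (sym (ℤ.+-identityˡ _)))))

    polyQuot-≡ : ∀ m u → + polyQuot p (suc m) u ≡ - (+ suc m * (+ u) ℤ.^ m * fermatQuotient (+ u)) [mod p ]
    polyQuot-≡ m u = mod-trans (mod-sym (mod-%ℕ (D ℤ./ℕ p))) (mod-trans (≡⇒mod (/ℕ-exact D x D≡)) (mod-neg (by k refl)))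
      where
      D = + (u ℕ.^ suc m) - + (u ℕ.^ (suc m ℕ.* p))
      a = + u
      r = fermatQuotient a
      k = proj₁ (^-first-order a r (+ p) m)
      c = + suc m * a ℤ.^ m * r
      x = - (c + k * + p)
      lem : ∀ A y q → A - (A + y * q) ≡ - y * q
      lem = solve-∀
      D≡ : D ≡ x * + p
      D≡ = trans (cong₂ _-_ (pos-^ u (suc m))
          (trans (cong (λ n → + (u ℕ.^ n)) (ℕ.*-comm (suc m) p))
          (trans (cong +_ (sym (ℕ.^-*-assoc u p (suc m))))
          (trans (pos-^ (u ℕ.^ p) (suc m))
          (trans (cong (ℤ._^ suc m) (trans (pos-^ u p) (^p-expand a)))
            (proj₂ (^-first-order a r (+ p) m)))))))
        (lem (a ℤ.^ suc m) (c + k * + p) (+ p))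

    toSeries : ∀ {n} → Vec (Fin p) n → Series
    toSeries []       = const 0ℤ
    toSeries (a ∷ as) = series λ { zero → + toℕ a ; (suc i) → toSeries as ‼ i }

    toSeries-vanish : ∀ {n} (f : Vec (Fin p) n) i → n ≤ i → toSeries f ‼ i ≡ 0ℤ
    toSeries-vanish []       zero    _         = refl
    toSeries-vanish []       (suc i) _         = refl
    toSeries-vanish (a ∷ as) (suc i) (s≤s n≤i) = toSeries-vanish as i n≤i

    ev-toSeries : ∀ d (f : Vec (Fin p) (suc d)) u → ev d (+ u) (toSeries f) ≡ + evalℕ f u [mod p ]
    ev-toSeries zero    (a ∷ [])  u = ≡⇒mod (cong +_ (sym (trans (cong (toℕ a ℕ.+_) (ℕ.*-zeroʳ u)) (ℕ.+-identityʳ _))))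
    ev-toSeries (suc d) (a ∷ as) u = mod-trans
      (mod-+ (mod-refl {a = + toℕ a}) (mod-* (mod-refl {a = + u})
        (mod-trans (ev-cong {tail (toSeries (a ∷ as))} {toSeries as} d (+ u) (≗⇒≈ λ i → refl)) (ev-toSeries d as u))))
      (≡⇒mod (sym (trans (ℤ.pos-+ (toℕ a) _) (cong (λ z → + toℕ a + z) (ℤ.pos-* u _)))))

    Deg-toSeries : ∀ {d} (f : Vec (Fin p) (suc d)) → Deg d (toSeries f)
    Deg-toSeries f = deg λ i d<i → ≡⇒mod (toSeries-vanish f i d<i)

    toSeries-value : ∀ {d} (f : Vec (Fin p) (suc d)) u → toSeries f ⇓[ + u ] + evalℕ f u
    toSeries-value {d} f u = value d (Deg-toSeries f) (ev-toSeries d f u)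

    suc-pred-p : suc (p ∸ 1) ≡ p
    suc-pred-p = ℕ.m+[n∸m]≡n 0<p

    suc-p∸2 : suc (p ∸ 2) ≡ p ∸ 1
    suc-p∸2 = sym (ℕ.+-∸-assoc 1 1<p)

    ^[p-1] : ∀ a → ¬ a ≡ 0ℤ [mod p ] → a ℤ.^ (p ∸ 1) ≡ 1ℤ [mod p ]
    ^[p-1] a a≢0 = sub≡0⇒≡ (*-cancel-0 a _ a≢0 (mod-trans (≡⇒mod (lem a (a ℤ.^ (p ∸ 1))))
      (≡⇒sub≡0 (subst (λ n → a ℤ.^ n ≡ a [mod p ]) (sym suc-pred-p) (fermat a)))))
      where
      lem : ∀ a b → a * (b - 1ℤ) ≡ a * b - a
      lem = solve-∀

    *^[p-2] : ∀ a → ¬ a ≡ 0ℤ [mod p ] → a * a ℤ.^ (p ∸ 2) ≡ 1ℤ [mod p ]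
    *^[p-2] a a≢0 = subst (λ n → a ℤ.^ n ≡ 1ℤ [mod p ]) (sym suc-p∸2) (^[p-1] a a≢0)

    module _ (m : ℕ) (w<p : suc m < p) {d : ℕ} (f : Vec (Fin p) (suc d)) where

      private
        W : ℤ
        W = + suc m

        W≢0 : ¬ W ≡ 0ℤ [mod p ]
        W≢0 = pos≢0 (s≤s z≤n) w<p

      Solution : ℕ → Set
      Solution u = polyQuot p (suc m) u ≡ polyEval p f u

      solution? : Decidable Solution
      solution? u = polyQuot p (suc m) u ℕ.≟ polyEval p f u

      solution-≡ : ∀ u → Solution u → + evalℕ f u ≡ - (W * (+ u) ℤ.^ m * fermatQuotient (+ u)) [mod p ]
      solution-≡ u e = mod-trans (mod-%ℕ (+ evalℕ f u)) (mod-trans (≡⇒mod (cong +_ (sym e))) (polyQuot-≡ m u))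

      -- `W ^ (p - 2)` inverts `w`, and `u ^ (p - w)` inverts `u ^ (w - 1)` since the exponents add
      -- up to `p - 1`.
      globalPoly : Series
      globalPoly = const (- W ℤ.^ (p ∸ 2)) ⊛ (X ^ (p ∸ suc m) ⊛ toSeries f)

      Deg-globalPoly : Deg (p ∸ suc m ℕ.+ d) globalPoly
      Deg-globalPoly = Deg-⊛ (Deg-const _) (Deg-⊛
        (Deg-mono (ℕ.≤-reflexive (ℕ.*-identityʳ (p ∸ suc m))) (Deg-^ (p ∸ suc m) Deg-X)) (Deg-toSeries f))

      globalPoly-value : ∀ u → 0 < u → u < p → Solution u →
        fermatQuotient (+ u) ≡ ev (p ∸ suc m ℕ.+ d) (+ u) globalPoly [mod p ]
      globalPoly-value u 0<u u<p e = mod-sym (⇓-unique (value _ Deg-globalPoly mod-refl)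
        (⇓-≡ (mod-trans (mod-* (mod-refl {a = - V}) (mod-* (mod-refl {a = a ℤ.^ (p ∸ suc m)}) (solution-≡ u e)))
            (mod-trans (≡⇒mod (lem V (a ℤ.^ (p ∸ suc m)) W (a ℤ.^ m) r))
              (mod-trans (mod-* (mod-* (*^[p-2] W W≢0) u-power) (mod-refl {a = r})) (≡⇒mod (ℤ.*-identityˡ r)))))
          (⇓-⊛ {u = - V} {v = a ℤ.^ (p ∸ suc m) * + evalℕ f u} (⇓-const (- V))
            (⇓-⊛ {u = a ℤ.^ (p ∸ suc m)} {v = + evalℕ f u} (⇓-^ (p ∸ suc m) ⇓-X) (toSeries-value f u)))))
        where
        a = + u
        r = fermatQuotient a
        V = W ℤ.^ (p ∸ 2)
        lem : ∀ V x W y r → - V * (x * - (W * y * r)) ≡ W * V * (x * y) * r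
        lem = solve-∀
        u-power : a ℤ.^ (p ∸ suc m) * a ℤ.^ m ≡ 1ℤ [mod p ]
        u-power = mod-trans (≡⇒mod (trans (sym (ℤ.^-distribˡ-+-* a (p ∸ suc m) m)) (cong (a ℤ.^_) exponent)))
          (^[p-1] a (pos≢0 0<u u<p))
          where
          exponent : p ∸ suc m ℕ.+ m ≡ p ∸ 1
          exponent = trans (cong (ℕ._+ m) (sym (ℕ.∸-+-assoc p 1 m))) (ℕ.m∸n+n≡m (ℕ.<⇒≤ (ℕ.<⇒≤pred w<p)))

      class : ℕ → ℕ
      class u = u ℕ.^ suc m ℕ.% p

      class-≡ : ∀ u → + class u ≡ (+ u) ℤ.^ suc m [mod p ]
      class-≡ u = mod-trans (mod-sym (mod-%ℕ (+ (u ℕ.^ suc m)))) (≡⇒mod (pos-^ u (suc m)))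

      -- Within a class `u * u ^ (w - 1)` is the constant `c`, so a single factor `X` replaces
      -- `X ^ (p - w)` and the degree is only `d + 1`.
      classPoly : ℕ → Series
      classPoly c = const (- (W * + c) ℤ.^ (p ∸ 2)) ⊛ (X ⊛ toSeries f)

      Deg-classPoly : ∀ c → Deg (suc d) (classPoly c)
      Deg-classPoly c = Deg-⊛ (Deg-const _) (Deg-⊛ Deg-X (Deg-toSeries f))

      classPoly-value : ∀ c u → 0 < u → u < p → Solution u → class u ≡ c →
        fermatQuotient (+ u) ≡ ev (suc d) (+ u) (classPoly c) [mod p ]
      classPoly-value c u 0<u u<p e refl = mod-sym (⇓-unique (value _ (Deg-classPoly c) mod-refl)
        (⇓-≡ (mod-trans (mod-* (mod-refl {a = - V}) (mod-* (mod-refl {a = a}) (solution-≡ u e)))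
            (mod-trans (≡⇒mod (lem V a W (a ℤ.^ m) r))
              (mod-trans (mod-* (mod-* (mod-* (mod-refl {a = W}) (mod-sym (class-≡ u))) (mod-refl {a = V})) (mod-refl {a = r}))
                (mod-trans (mod-* (*^[p-2] (W * + c) Wc≢0) (mod-refl {a = r})) (≡⇒mod (ℤ.*-identityˡ r))))))
          (⇓-⊛ {u = - V} {v = a * + evalℕ f u} (⇓-const (- V))
            (⇓-⊛ {u = a} {v = + evalℕ f u} ⇓-X (toSeries-value f u)))))
        where
        a = + u
        r = fermatQuotient a
        V = (W * + c) ℤ.^ (p ∸ 2)
        lem : ∀ V x W y r → - V * (x * - (W * y * r)) ≡ W * (x * y) * V * r
        lem = solve-∀
        Wc≢0 : ¬ W * + c ≡ 0ℤ [mod p ]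
        Wc≢0 z = ^-≢0 a (suc m) (pos≢0 0<u u<p) 1≢0 (mod-trans (mod-sym (class-≡ u)) (*-cancel-0 W (+ c) W≢0 z))

    -- The case of multiplicity one of `root-count`, for `X ^ n - 1`, which is nonzero by its
    -- leading coefficient.
    unity-roots : ∀ n → 0 < n → ∀ as → AllPairs _≢_ as → All (λ a → a < p × (+ a) ℤ.^ n ≡ 1ℤ [mod p ]) as →
      length as ≤ n
    unity-roots (suc n) _ as unique ok = ℕ.≤-trans
      (ℕ.≤-reflexive (trans (sym (length-map +_ as)) (sym (ℕ.*-identityʳ _))))
      (root-count (map +_ as) 1 (All.map⁺ (All.map nonzero ok)) (AllPairs.map⁺ (distinct unique ok)) degree nontrivial
        (All.map⁺ (All.map simple ok)))
      where
      P : Series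
      P = X ^ suc n ⊕ const (- 1ℤ)
      nonzero : ∀ {a} → a < p × (+ a) ℤ.^ suc n ≡ 1ℤ [mod p ] → ¬ + a ≡ 0ℤ [mod p ]
      nonzero {a} (_ , e) z = 1≢0 (mod-trans (mod-sym e)
        (mod-trans (mod-* z (mod-refl {a = (+ a) ℤ.^ n})) (≡⇒mod (ℤ.*-zeroˡ ((+ a) ℤ.^ n)))))
      distinct : ∀ {as} → AllPairs _≢_ as → All (λ a → a < p × (+ a) ℤ.^ suc n ≡ 1ℤ [mod p ]) as →
        AllPairs (λ a b → ¬ + a ≡ + b [mod p ]) as
      distinct []         []                = []
      distinct (a≢ ∷ unq) ((a<p , _) ∷ oks) =
        All.zipWith (λ (a≢b , b<p , _) e → a≢b (residue-injective a<p b<p e)) (a≢ , oks) ∷ distinct unq oks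
      degree : Deg (suc n) P
      degree = Deg-⊕ (Deg-mono (ℕ.≤-reflexive (ℕ.*-identityʳ (suc n))) (Deg-^ (suc n) Deg-X))
        (Deg-mono z≤n (Deg-const (- 1ℤ)))
      nontrivial : ¬ P ≈ const 0ℤ
      nontrivial e = 1≢0 (mod-trans (≡⇒mod (sym (trans (ℤ.+-identityʳ _) (X^-leading (suc n))))) (at e (suc n)))
      simple : ∀ {a} → a < p × (+ a) ℤ.^ suc n ≡ 1ℤ [mod p ] → RootOfOrder (+ a) 1 P
      simple {a} (_ , e) =
        let q , pq , eq = factor (⇓-≡ (≡⇒sub≡0 e) (⇓-⊕ {u = (+ a) ℤ.^ suc n} {v = - 1ℤ} (⇓-^ (suc n) ⇓-X) (⇓-const (- 1ℤ))))
        in root q pq (≈-trans eq (*-congʳ (≈-sym (*-identityʳ (lin (+ a))))))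

    -- The two sixth-power bounds

    module _ (m : ℕ) (w<p : suc m < p) {d : ℕ} (1≤d : 1 ≤ d) (f : Vec (Fin p) (suc d)) (N : ℕ) (1≤N : 1 ≤ N) (N≤p : N ≤ p) where

      private
        w F g E : ℕ
        w = suc m
        F = countF w N p f
        g = gcd w (p ∸ 1)
        E = p ∸ w ℕ.+ d

        Positive : ℕ → Set
        Positive u = 0 < u × Solution m w<p f u

        positive? : Decidable Positive
        positive? u = (0 ℕ.<? u) ×-dec solution? m w<p f u

        -- The point 0 is set aside because the passage to `r(u) = g(u)` divides by `u`.
        F≤1+positive : F ≤ 1 ℕ.+ count positive? N
        F≤1+positive = ℕ.≤-trans
          (length-filter-⊎ (solution? m w<p f) (ℕ._≟ 0) positive? (upTo N) λ {x} _ → split x)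
          (ℕ.+-monoˡ-≤ (count positive? N) (count-≡0 N))
          where
          split : ∀ x → Solution m w<p f x → x ≡ 0 ⊎ Positive x
          split zero    _ = inj₁ refl
          split (suc x) e = inj₂ (s≤s z≤n , e)

        energy : ℕ → ℕ
        energy E = 27 ℕ.* κ ℕ.* (cube N ℕ.* (E ℕ.* (p ℕ.* p)))

        1≤energy : ∀ E → 1 ≤ E → 1 ≤ energy E
        1≤energy E 1≤E = ℕ.*-mono-≤ (ℕ.*-mono-≤ (ℕ.m≤m+n 1 26) 1≤κ)
          (ℕ.*-mono-≤ (cube-mono 1≤N) (ℕ.*-mono-≤ 1≤E (ℕ.*-mono-≤ 0<p 0<p)))

        1+K≤2K : ∀ {K} → 1 ≤ K → 1 ℕ.+ K ≤ 2 ℕ.* K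
        1+K≤2K {K} 1≤K = ℕ.+-mono-≤ 1≤K (ℕ.≤-reflexive (sym (ℕ.+-identityʳ K)))

      global-bound : ∃ λ K → F ≤ 2 ℕ.* K × sixth K ≤ energy E
      global-bound =
        let K , K⁶≤ , max = sixth-root (energy E)
            1≤E = ℕ.≤-trans 1≤d (ℕ.m≤n+m d (p ∸ w))
            F₊≤K = max (count-bound E (globalPoly m w<p f) N positive? 1≤E (Deg-globalPoly m w<p f) 1≤N N≤p
                     λ u u<N (0<u , e) → 0<u , globalPoly-value m w<p f u 0<u (ℕ.<-≤-trans u<N N≤p) e)
        -- `K ≥ 1`, because `energy E ≥ 1`; doubling `K` therefore absorbs the point 0.
        in K , ℕ.≤-trans F≤1+positive (ℕ.≤-trans (ℕ.+-monoʳ-≤ 1 F₊≤K) (1+K≤2K (max (1≤energy E 1≤E)))) , K⁶≤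

      -- With `n = (p - 1) / g`, each `u ^ w` is an `n`-th root of unity because `g` divides `w`, so
      -- there are at most `n` classes. Each contributes at most `K`, and multiplying `F ≤ 1 + n K`
      -- by `g` turns `n` into `p - 1`.
      class-bound : ∃ λ K → F ℕ.* g ≤ 2 ℕ.* (p ℕ.* K) × sixth K ≤ energy (suc d)
      class-bound with gcd[m,n]∣m w (p ∸ 1) | gcd[m,n]∣n w (p ∸ 1)
      ... | ℕ∣.divides k w≡kg | ℕ∣.divides n p-1≡ng =
        let K , K⁶≤ , max = sixth-root (energy (suc d))
            F₊≤nK = ℕ.≤-trans (length-filter-classes (class m w<p f) (upTo N) K classes positive? covered
                      λ c Q? Q⇒ → max (count-bound (suc d) (classPoly m w<p f c) N Q? (s≤s z≤n) (Deg-classPoly m w<p f c) 1≤N N≤p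
                        λ u u<N Qu → let (0<u , e) , c≡ = Q⇒ Qu in
                          0<u , classPoly-value m w<p f c u 0<u (ℕ.<-≤-trans u<N N≤p) e c≡))
                    (ℕ.*-monoˡ-≤ K classes≤n)
        in K , total K (max (1≤energy (suc d) (s≤s z≤n))) (ℕ.≤-trans F≤1+positive (ℕ.+-monoʳ-≤ 1 F₊≤nK)) , K⁶≤
        where
        0<n : 0 < n
        0<n = ℕ.n≢0⇒n>0 λ n≡0 → ℕ.<⇒≢ (ℕ.m<n⇒0<n∸m 1<p) (sym (trans p-1≡ng (cong (ℕ._* g) n≡0)))
        member? : Decidable (λ a → a ℕ.^ n ℕ.% p ≡ 1)
        member? a = a ℕ.^ n ℕ.% p ℕ.≟ 1
        classes : List ℕ
        classes = filter member? (upTo p)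
        classes≤n : length classes ≤ n
        classes≤n = unity-roots n 0<n classes (Unique.filter⁺ member? (Unique.upTo⁺ p))
          (All.zipWith (λ {a} (a<p , e) → a<p , mod-trans (≡⇒mod (sym (pos-^ a n)))
              (mod-trans (mod-%ℕ (+ (a ℕ.^ n))) (≡⇒mod (cong +_ e))))
            (All.filter⁺ member? (All.all-upTo p) , All.all-filter member? (upTo p)))
        covered : ∀ {u} → u ∈ upTo N → Positive u → class m w<p f u ∈ classes
        covered {u} u∈ (0<u , _) = ∈-filter⁺ member? (∈-upTo⁺ (ℕ.m%n<n (u ℕ.^ w) p))
          (residue-injective (ℕ.m%n<n (class m w<p f u ℕ.^ n) p) 1<p (mod-trans (mod-sym (mod-%ℕ (+ (class m w<p f u ℕ.^ n))))
            (mod-trans (≡⇒mod (pos-^ (class m w<p f u) n)) (mod-trans (mod-^ n (class-≡ m w<p f u))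
              (mod-trans (≡⇒mod exponent) (mod-trans (mod-^ k (^[p-1] (+ u) (pos≢0 0<u (ℕ.<-≤-trans (∈-upTo⁻ u∈) N≤p))))
                (≡⇒mod (ℤ.^-zeroˡ k))))))))
          where
          exponent : ((+ u) ℤ.^ w) ℤ.^ n ≡ ((+ u) ℤ.^ (p ∸ 1)) ℤ.^ k
          exponent = trans (ℤ.^-*-assoc (+ u) w n) (trans (cong ((+ u) ℤ.^_)
            (trans (cong (ℕ._* n) w≡kg) (trans (lem k g n) (cong (ℕ._* k) (sym p-1≡ng)))))
            (sym (ℤ.^-*-assoc (+ u) (p ∸ 1) k)))
            where
            lem : ∀ k g n → k ℕ.* g ℕ.* n ≡ n ℕ.* g ℕ.* k
            lem = ℕ-Solver.solve-∀
        total : ∀ K → 1 ≤ K → F ≤ 1 ℕ.+ n ℕ.* K → F ℕ.* g ≤ 2 ℕ.* (p ℕ.* K)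
        total K 1≤K F≤ = begin
          F ℕ.* g
            ≤⟨ ℕ.*-monoˡ-≤ g F≤ ⟩
          (1 ℕ.+ n ℕ.* K) ℕ.* g
            ≡⟨ lem n K g ⟩
          g ℕ.+ n ℕ.* g ℕ.* K
            ≤⟨ ℕ.+-mono-≤ (ℕ.≤-trans (ℕ.m≤n*m g n {{ℕ.>-nonZero 0<n}}) (ℕ.m≤m*n (n ℕ.* g) K {{ℕ.>-nonZero 1≤K}})) ℕ.≤-refl ⟩
          n ℕ.* g ℕ.* K ℕ.+ n ℕ.* g ℕ.* K
            ≤⟨ ℕ.+-mono-≤ ngK≤pK ngK≤pK ⟩
          p ℕ.* K ℕ.+ p ℕ.* K
            ≡⟨ cong (p ℕ.* K ℕ.+_) (sym (ℕ.+-identityʳ (p ℕ.* K))) ⟩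
          2 ℕ.* (p ℕ.* K) ∎
          where
          open ℕ.≤-Reasoning
          ngK≤pK : n ℕ.* g ℕ.* K ≤ p ℕ.* K
          ngK≤pK = ℕ.*-monoˡ-≤ K (ℕ.≤-trans (ℕ.≤-reflexive (sym p-1≡ng)) (ℕ.m∸n≤m p 1))
          lem : ∀ n K g → (1 ℕ.+ n ℕ.* K) ℕ.* g ≡ g ℕ.+ n ℕ.* g ℕ.* K
          lem = ℕ-Solver.solve-∀

-- Clearing the fractional exponents

open StepanovMethod using (cube; κ; sixth; sixth-mono; count≤; module PolynomialQuotient)
open import Data.Nat using (_+_; _*_; _^_; >-nonZero)

^-distribʳ-* : ∀ a b n → (a * b) ^ n ≡ a ^ n * b ^ n
^-distribʳ-* a b zero    = refl
^-distribʳ-* a b (suc n) = trans (cong (a * b *_) (^-distribʳ-* a b n)) (lem a b (a ^ n) (b ^ n))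
  where
  lem : ∀ a b x y → a * b * (x * y) ≡ a * x * (b * y)
  lem = ℕ-Solver.solve-∀

module _ (c₀ : ℕ) where

  -- `128 = 2 ^ 6 * 2`, from `x ≤ 2 m K` and `E ≤ 2 D`. The sum dominates both the constant of the
  -- eighth-power bound and its square, which the twelfth power needs.
  sixthConst finalConst : ℕ
  sixthConst = 128 * c₀
  finalConst = sixthConst + sixthConst * sixthConst

  -- Applied with `x = F`, `m = 1` and with `x` the product of `F` and the gcd, `m = p`. The bound
  -- on `x ^ 6` is squared for the twelfth power, and multiplied by the trivial `x ^ 2 ≤ m N * m p`
  -- for the eighth.
  final-bounds : ∀ x K m N E D p → x ≤ 2 * (m * K) → sixth K ≤ c₀ * (cube N * (E * (p * p))) → x ≤ m * N →
    N ≤ p → E ≤ 2 * D → 1 ≤ D →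
    x ^ 12 ≤ finalConst * (D ^ 3 * N ^ 6 * (m ^ 12 * p ^ 4)) × x ^ 8 ≤ finalConst * (D * N ^ 4 * (m ^ 8 * p ^ 3))
  final-bounds x K m N E D p x≤2mK K⁶≤ x≤mN N≤p E≤2D 1≤D = twelfth , eighth
    where
    open ℕ.≤-Reasoning
    open +-*-Solver
    c = sixthConst
    Q = sixth m * (cube N * (D * (p * p)))
    x⁶≤ : sixth x ≤ c * Q
    x⁶≤ = begin
      sixth x                                                    ≤⟨ sixth-mono x≤2mK ⟩
      sixth (2 * (m * K))                                        ≡⟨ lem₁ m K ⟩
      64 * (sixth m * sixth K)                                   ≤⟨ ℕ.*-monoʳ-≤ 64 (ℕ.*-monoʳ-≤ (sixth m) K⁶≤) ⟩
      64 * (sixth m * (c₀ * (cube N * (E * (p * p)))))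
        ≤⟨ ℕ.*-monoʳ-≤ 64 (ℕ.*-monoʳ-≤ (sixth m) (ℕ.*-monoʳ-≤ c₀ (ℕ.*-monoʳ-≤ (cube N) (ℕ.*-monoˡ-≤ (p * p) E≤2D)))) ⟩
      64 * (sixth m * (c₀ * (cube N * (2 * D * (p * p)))))       ≡⟨ lem₂ (sixth m) c₀ (cube N) D (p * p) ⟩
      c * Q ∎
      where
      lem₁ : ∀ m K → let y = 2 * (m * K) in
        y * y * (y * y) * (y * y) ≡ 64 * (m * m * (m * m) * (m * m) * (K * K * (K * K) * (K * K)))
      lem₁ = ℕ-Solver.solve-∀
      lem₂ : ∀ a c b D q → 64 * (a * (c * (b * (2 * D * q)))) ≡ 128 * c * (a * (b * (D * q)))
      lem₂ = ℕ-Solver.solve-∀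
    twelfth : x ^ 12 ≤ finalConst * (D ^ 3 * N ^ 6 * (m ^ 12 * p ^ 4))
    twelfth = begin
      x ^ 12                                ≡⟨ lem₁ x ⟩
      sixth x * sixth x                     ≤⟨ ℕ.*-mono-≤ x⁶≤ x⁶≤ ⟩
      -- The square carries `D ^ 2`; a further factor `D ≥ 1` brings it to the stated `D ^ 3`.
      c * Q * (c * Q)                       ≤⟨ ℕ.m≤m*n _ D {{>-nonZero 1≤D}} ⟩
      c * Q * (c * Q) * D                   ≡⟨ lem₂ c m N D p ⟩
      c * c * (D ^ 3 * N ^ 6 * (m ^ 12 * p ^ 4))
        ≤⟨ ℕ.*-monoˡ-≤ (D ^ 3 * N ^ 6 * (m ^ 12 * p ^ 4)) (ℕ.m≤n+m (c * c) c) ⟩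
      finalConst * (D ^ 3 * N ^ 6 * (m ^ 12 * p ^ 4)) ∎
      where
      lem₁ : ∀ x → x ^ 12 ≡ x * x * (x * x) * (x * x) * (x * x * (x * x) * (x * x))
      lem₁ = solve 1 (λ x → x :^ 12 := x :* x :* (x :* x) :* (x :* x) :* (x :* x :* (x :* x) :* (x :* x))) refl
      lem₂ : ∀ c m N D p → let Q = m * m * (m * m) * (m * m) * (N * N * N * (D * (p * p))) in
        c * Q * (c * Q) * D ≡ c * c * (D ^ 3 * N ^ 6 * (m ^ 12 * p ^ 4))
      lem₂ = solve 5 (λ c m N D p → let Q = m :* m :* (m :* m) :* (m :* m) :* (N :* N :* N :* (D :* (p :* p))) in
        c :* Q :* (c :* Q) :* D := c :* c :* (D :^ 3 :* N :^ 6 :* (m :^ 12 :* p :^ 4))) refl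
    eighth : x ^ 8 ≤ finalConst * (D * N ^ 4 * (m ^ 8 * p ^ 3))
    eighth = begin
      x ^ 8                                 ≡⟨ lem₁ x ⟩
      sixth x * (x * x)
        ≤⟨ ℕ.*-mono-≤ x⁶≤ (ℕ.*-mono-≤ x≤mN (ℕ.≤-trans x≤mN (ℕ.*-monoʳ-≤ m N≤p))) ⟩
      c * Q * (m * N * (m * p))             ≡⟨ lem₂ c m N D p ⟩
      c * (D * N ^ 4 * (m ^ 8 * p ^ 3))     ≤⟨ ℕ.*-monoˡ-≤ (D * N ^ 4 * (m ^ 8 * p ^ 3)) (ℕ.m≤m+n c (c * c)) ⟩
      finalConst * (D * N ^ 4 * (m ^ 8 * p ^ 3)) ∎
      where
      lem₁ : ∀ x → x ^ 8 ≡ x * x * (x * x) * (x * x) * (x * x)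
      lem₁ = solve 1 (λ x → x :^ 8 := x :* x :* (x :* x) :* (x :* x) :* (x :* x)) refl
      lem₂ : ∀ c m N D p → c * (m * m * (m * m) * (m * m) * (N * N * N * (D * (p * p)))) * (m * N * (m * p)) ≡
        c * (D * N ^ 4 * (m ^ 8 * p ^ 3))
      lem₂ = solve 5 (λ c m N D p →
        c :* (m :* m :* (m :* m) :* (m :* m) :* (N :* N :* N :* (D :* (p :* p)))) :* (m :* N :* (m :* p)) :=
        c :* (D :* N :^ 4 :* (m :^ 8 :* p :^ 3))) refl

theorem1 : ∃ λ (c : ℕ) →
    ∀ (p : ℕ) .{{_ : NonZero p}} → Prime p → p ≢ 2 →
    ∀ (w : ℕ) → 1 ≤ w → w < p →
    ∀ (N : ℕ) → 1 ≤ N → N ≤ p →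
    ∀ (d : ℕ) → 1 ≤ d → (f : Vec (Fin p) (suc d)) → toℕ (last f) ≢ 0 →
    (countF w N p f ^ 12 ≤ c * ((p ∸ 1 ∸ w + d) ^ 3 * N ^ 6 * p ^ 4))
    × (countF w N p f ^ 8 ≤ c * ((p ∸ 1 ∸ w + d) * N ^ 4 * p ^ 3))
    × (countF w N p f ^ 12 * gcd w (p ∸ 1) ^ 12 ≤ c * (d ^ 3 * N ^ 6 * p ^ 16))
    × (countF w N p f ^ 8 * gcd w (p ∸ 1) ^ 8 ≤ c * (d * N ^ 4 * p ^ 11))
theorem1 = finalConst (27 * κ) , proof
  where
  c = finalConst (27 * κ)
  proof : ∀ (p : ℕ) .{{_ : NonZero p}} → Prime p → p ≢ 2 →
    ∀ (w : ℕ) → 1 ≤ w → w < p →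
    ∀ (N : ℕ) → 1 ≤ N → N ≤ p →
    ∀ (d : ℕ) → 1 ≤ d → (f : Vec (Fin p) (suc d)) → toℕ (last f) ≢ 0 →
    (countF w N p f ^ 12 ≤ c * ((p ∸ 1 ∸ w + d) ^ 3 * N ^ 6 * p ^ 4))
    × (countF w N p f ^ 8 ≤ c * ((p ∸ 1 ∸ w + d) * N ^ 4 * p ^ 3))
    × (countF w N p f ^ 12 * gcd w (p ∸ 1) ^ 12 ≤ c * (d ^ 3 * N ^ 6 * p ^ 16))
    × (countF w N p f ^ 8 * gcd w (p ∸ 1) ^ 8 ≤ c * (d * N ^ 4 * p ^ 11))
  proof p pp _ w@(suc m) _ w<p N 1≤N N≤p d 1≤d f _ =
    let K , F≤ , K⁶≤ = global-bound m w<p 1≤d f N 1≤N N≤p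
        K′ , Fg≤ , K′⁶≤ = class-bound m w<p 1≤d f N 1≤N N≤p
        b₁ , b₂ = final-bounds (27 * κ) F K 1 N E D p
          (subst (λ z → F ≤ 2 * z) (sym (ℕ.*-identityˡ K)) F≤) K⁶≤
          (subst (F ≤_) (sym (ℕ.*-identityˡ N)) F≤N) N≤p E≤2D 1≤D
        b₃ , b₄ = final-bounds (27 * κ) (F * g) K′ p N (suc d) d p Fg≤ K′⁶≤
          (ℕ.≤-trans (ℕ.*-mono-≤ F≤N g≤p) (ℕ.≤-reflexive (ℕ.*-comm N p))) N≤p (1+≤2* 1≤d) 1≤d
    in subst (λ z → F ^ 12 ≤ c * (D ^ 3 * N ^ 6 * z)) (ℕ.*-identityˡ (p ^ 4)) b₁ ,
       subst (λ z → F ^ 8 ≤ c * (D * N ^ 4 * z)) (ℕ.*-identityˡ (p ^ 3)) b₂ ,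
       subst₂ (λ y z → y ≤ c * (d ^ 3 * N ^ 6 * z)) (^-distribʳ-* F g 12) (sym (ℕ.^-distribˡ-+-* p 12 4)) b₃ ,
       subst₂ (λ y z → y ≤ c * (d * N ^ 4 * z)) (^-distribʳ-* F g 8) (sym (ℕ.^-distribˡ-+-* p 8 3)) b₄
    where
    open PolynomialQuotient p pp
    F = countF w N p f
    g = gcd w (p ∸ 1)
    D = p ∸ 1 ∸ w + d
    E = p ∸ w + d
    F≤N : F ≤ N
    F≤N = count≤ (solution? m w<p f) N
    g≤p : g ≤ p
    g≤p = ℕ.≤-trans (gcd[m,n]≤n w (p ∸ 1) {{>-nonZero (ℕ.m<n⇒0<n∸m 1<p)}}) (ℕ.m∸n≤m p 1)
    1≤D : 1 ≤ D
    1≤D = ℕ.≤-trans 1≤d (ℕ.m≤n+m d (p ∸ 1 ∸ w))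
    1+≤2* : ∀ {n} → 1 ≤ n → suc n ≤ 2 * n
    1+≤2* {n} 1≤n = ℕ.+-mono-≤ 1≤n (ℕ.≤-reflexive (sym (ℕ.+-identityʳ n)))
    -- The degree of `globalPoly` is bounded by `p - w + d`, one more than `D`; as `D ≥ d ≥ 1`,
    -- doubling covers the difference.
    E≤2D : E ≤ 2 * D
    E≤2D = ℕ.≤-trans (ℕ.≤-reflexive (cong (_+ d) p∸w)) (1+≤2* 1≤D)
      where
      p∸w : p ∸ w ≡ suc (p ∸ 1 ∸ w)
      p∸w = trans (ℕ.+-∸-assoc 1 w<p) (cong suc (sym (ℕ.∸-+-assoc p 1 w)))
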